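{- For every prime power $q$, there exist seven planes of $\mathrm{PG}(5,q)$ in higgledy-piggledy arrangement.
   Context: For $k\in\{0,1,\dots,n-1\}$, a strong $k$-blocking set in $\mathrm{PG}(n,q)$ is a point set meeting every $(n-k)$-dimensional subspace $\kappa$ in a set of points spanning $\kappa$. A set $\mathcal{K}$ of $k$-dimensional subspaces of $\mathrm{PG}(n,q)$ is in higgledy-piggledy arrangement (a higgledy-piggledy set) if the union of the points contained in the elements of $\mathcal{K}$ is a strong $k$-blocking set. -}

module Defs where

open import Level using (0ℓ)
open import Algebra.Bundles using (CommutativeRing)
open import Data.Nat using (ℕ; zero; suc; _≥_; _∸_) renaming (_^_ to _^ℕ_)
open import Data.Nat.Primality using (Prime)
open import Data.Fin using (Fin; zero; suc)
open import Data.Product using (Σ; ∃; ∃-syntax; _×_; _,_)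
open import Relation.Binary.PropositionalEquality as ≡ using (_≡_; _≢_)
open import Relation.Nullary using (¬_)
open import Function.Bundles using (Inverse)

IsPrimePower : ℕ → Set
IsPrimePower q = ∃[ p ] ∃[ k ] (Prime p × k ≥ 1 × q ≡ p ^ℕ k)

IsField : CommutativeRing 0ℓ 0ℓ → Set
IsField R = ¬ (0# ≈ 1#) × (∀ x → ¬ (x ≈ 0#) → ∃[ y ] (x * y ≈ 1#))
  where open CommutativeRing R

HasCard : CommutativeRing 0ℓ 0ℓ → ℕ → Set
HasCard R q = Inverse (≡.setoid (Fin q)) (CommutativeRing.setoid R)

module Lin (R : CommutativeRing 0ℓ 0ℓ) where
  open CommutativeRing R using (Carrier; _≈_; _+_; _*_; 0#; 1#)

  Vec : ℕ → Set
  Vec d = Fin d → Carrier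

  Σ′ : (m : ℕ) → (Fin m → Carrier) → Carrier
  Σ′ zero    f = 0#
  Σ′ (suc m) f = f zero + Σ′ m (λ j → f (suc j))

  lincomb : ∀ {d m} → (Fin m → Carrier) → (Fin m → Vec d) → Vec d
  lincomb {m = m} c vs i = Σ′ m (λ j → c j * vs j i)

  InSpan : ∀ {d m} → (Fin m → Vec d) → Vec d → Set
  InSpan {d} vs u = ∃[ c ] (∀ i → u i ≈ lincomb c vs i)

  LinIndep : ∀ {d m} → (Fin m → Vec d) → Set
  LinIndep {d} {m} vs = ∀ c → (∀ i → lincomb c vs i ≈ 0#) → ∀ j → c j ≈ 0#

  SameSpan : ∀ {d m m′} → (Fin m → Vec d) → (Fin m′ → Vec d) → Set
  SameSpan {d} A B = (∀ u → InSpan A u → InSpan B u) × (∀ u → InSpan B u → InSpan A u)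

  -- A k-dimensional projective subspace of PG(n,R) is the span of k+1 linearly
  -- independent vectors of R^(n+1); a point (nonzero vector up to scalars) lies on it
  -- iff a representative lies in that span.
  -- A family of k-spaces K (each given by k+1 independent spanning vectors) is
  -- higgledy-piggledy in PG(n,R) if the union of their points meets every
  -- (n-k)-space κ in a point set spanning κ.
  HigglePiggle : ∀ n k {t} → (Fin t → Fin (suc k) → Vec (suc n)) → Set
  HigglePiggle n k {t} K =
    (κ : Fin (suc (n ∸ k)) → Vec (suc n)) → LinIndep κ →
    ∀ u → InSpan κ u →
      ∃[ m ] ∃[ xs ]
        ((∀ j → ¬ (∀ i → xs j i ≈ 0#)) ×
         (∀ j → InSpan κ (xs j)) ×
         (∀ j → ∃[ a ] InSpan (K a) (xs j)) ×
         InSpan {m = m} xs u)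

{-# OPTIONS --safe #-}

-- Fix N such that θ³ = θ² + N is irreducible over F (x³ - x² takes the value 0 twice, hence misses
-- some N) and identify F⁶ with E², E = F(θ).  All planes are elements { (σ x , τ x) : x ∈ E } of the
-- Desarguesian spread.  If their points in a solid κ fail to span κ, a functional on κ kills these
-- points; extending it by zero over each plane gives vectors y (τ , σ), y ∈ E*, one for each plane,
-- in a coset of the two-dimensional annihilator of κ, so any four of them are linearly dependent.
--
-- The slopes are ∞, 0 and - v / Q(v) for five v = p + r θ + θ², where Q is a functional composed with
-- the quadratic map v ↦ Norm(v) / v, such that Q is anisotropic on ⟨ 1 , θ ⟩.  After scaling, the
-- vectors for ∞ and 0 are (1 , 0) and (0 , X), and the dependences say l(v) Q(v) = R(v) at the five
-- v for a linear form l and a form R of the same kind as Q.  The five v are chosen so that this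
-- forces l = g c₂ and R = g Q, where c₂ is the θ²-coefficient.  As (1 , 0) and (0 , X) span a subline,
-- l and R vanish at X⁻¹; anisotropy gives g = 0, and then every v would be a multiple of X⁻¹.
-- Such v exist as soon as F has an element other than 0, 1 and -1; 𝔽₃ needs its own five v.  Over 𝔽₂
-- any seven slopes will do, since the coset has only four elements.
module Submission where

open import Defs
open import Level using (0ℓ)
open import Algebra.Bundles using (CommutativeRing)
import Algebra.Consequences.Setoid as Consequences
import Algebra.Properties.Group
import Algebra.Properties.Ring
import Algebra.Properties.Semiring.Mult.TCOptimised
import Algebra.Solver.Ring
open import Algebra.Solver.Ring.AlmostCommutativeRing using (fromCommutativeRing; _-Raw-AlmostCommutative⟶_)
open import Data.Nat using (ℕ; zero; suc) renaming (_^_ to _^ℕ_)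
import Data.Nat as ℕ
import Data.Nat.Properties as ℕₚ
open import Data.Integer as ℤ using (ℤ; +_; -[1+_]; _⊖_)
import Data.Integer.Properties as ℤₚ
open import Data.Fin using (Fin; #_; finToFun; funToFin; _↑ˡ_; _↑ʳ_) renaming (zero to fzero; suc to fsuc)
import Data.Fin as Fin
import Data.Fin.Properties as Finₚ
open import Data.List as List using (List; length; filter; allFin)
open import Data.List.Membership.Propositional using (_∈_)
open import Data.List.Membership.Propositional.Properties using (∈-allFin; ∈-filter⁺; ∈-filter⁻; ∈-lookup)
open import Data.List.Relation.Unary.Any using () renaming (index to position)
open import Data.List.Relation.Unary.Any.Properties using (lookup-index)
open import Data.Maybe using (Maybe; just; nothing)
open import Data.Product using (_×_; _,_; proj₁; proj₂; ∃; ∃-syntax; Σ-syntax)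
open import Data.Sum using (_⊎_; inj₁; inj₂; [_,_]′)
open import Data.Vec as Vector using ([]; _∷_; lookup)
open import Data.Vec.Functional using (_++_)
open import Data.Vec.Functional.Properties using (lookup-++ˡ; lookup-++ʳ)
open import Function using (_∘_)
open import Function.Bundles using (Inverse)
open import Relation.Binary.Bundles using (Setoid)
open import Relation.Binary.Definitions using (tri<; tri≈; tri>)
open import Relation.Binary.PropositionalEquality as ≡ using (_≡_; _≢_)
import Relation.Binary.Reasoning.Setoid
open import Relation.Binary.Structures using (IsEquivalence)
open import Relation.Nullary using (¬_; Dec; yes; no; contradiction)
open import Relation.Nullary.Decidable using (map′; ¬?; _×-dec_; decidable-stable)

-- A linear form l and a form R have three coefficients each, and each of the five v gives one
-- equation l(v) k(v) = R(v), where k(v) is, up to sign, the denominator of its slope. Five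
-- homogeneous equations in six unknowns always have a nonzero solution, so l = R = 0 cannot be
-- forced directly. The denominators are therefore chosen such that the unavoidable solution is
-- known: c₂(v) = 1 at all five v, so (c₂ , Q) solves the system, and the best that five v can do is
-- to leave only its multiples. This pair is then excluded because X⁻¹ is a common zero of l and R,
-- whereas c₂ and Q have no common zero but 0; that is the purpose of the anisotropy of Q on the
-- kernel ⟨ 1 , θ ⟩ of c₂. The denominators lie in F so that the constant left after eliminating one
-- of four dependent vectors is a multiple of 1 and drops out of a determinant that has 1 as its
-- first entry.

Irreducible : (F : CommutativeRing 0ℓ 0ℓ) → CommutativeRing.Carrier F → Set
Irreducible F N = ∀ x → ¬ (x * x * x ≈ x * x + N)
  where open CommutativeRing F

SevenPlanes : CommutativeRing 0ℓ 0ℓ → Set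
SevenPlanes F = ∃[ K ] ((∀ (a : Fin 7) → LinIndep {6} {3} (K a)) ×
                        (∀ (a b : Fin 7) → a ≢ b → ¬ SameSpan (K a) (K b)) ×
                        HigglePiggle 5 2 {7} K)
  where open Lin F

-- Lets the tables of pairwise distinctness below list only the pairs above the diagonal.
distinct-from-< : ∀ {n} {P : Fin n → Fin n → Set} → (∀ {i j} → P i j → P j i) →
                  (∀ i j → i Fin.< j → ¬ P i j) → ∀ i j → i ≢ j → ¬ P i j
distinct-from-< sym-P <⇒¬P i j i≢j p with Finₚ.<-cmp i j
... | tri< i<j _ _ = <⇒¬P i j i<j p
... | tri≈ _ i≡j _ = i≢j i≡j
... | tri> _ _ j<i = <⇒¬P j i j<i (sym-P p)

-- A ring solver with integer coefficients over any commutative ring.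

module IntegerSolver (R : CommutativeRing 0ℓ 0ℓ) where
  open CommutativeRing R
  open Algebra.Properties.Ring ring
  open Algebra.Properties.Semiring.Mult.TCOptimised semiring
    renaming (_×_ to _×ℕ_)
  open Relation.Binary.Reasoning.Setoid setoid

  ⟦_⟧ℤ : ℤ → Carrier
  ⟦ + n ⟧ℤ      = n ×ℕ 1#
  ⟦ -[1+ n ] ⟧ℤ = - (suc n ×ℕ 1#)

  suc×1 : ∀ n → suc n ×ℕ 1# ≈ 1# + n ×ℕ 1#
  suc×1 n = ×-homo-+ 1# 1 n

  ⊖-homo : ∀ m n → ⟦ m ⊖ n ⟧ℤ ≈ m ×ℕ 1# + - (n ×ℕ 1#)
  ⊖-homo m       zero    = sym (trans (+-congˡ -0#≈0#) (+-identityʳ _))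
  ⊖-homo zero    (suc n) = sym (+-identityˡ _)
  ⊖-homo (suc m) (suc n) = begin
    ⟦ suc m ⊖ suc n ⟧ℤ                    ≡⟨ ≡.cong ⟦_⟧ℤ (ℤₚ.[1+m]⊖[1+n]≡m⊖n m n) ⟩
    ⟦ m ⊖ n ⟧ℤ                            ≈⟨ ⊖-homo m n ⟩
    x + - y                               ≈⟨ +-congˡ (+-identityˡ _) ⟨
    x + (0# + - y)                        ≈⟨ +-congˡ (+-congʳ (-‿inverseʳ 1#)) ⟨
    x + ((1# + - 1#) + - y)               ≈⟨ +-congˡ (+-assoc _ _ _) ⟩
    x + (1# + (- 1# + - y))               ≈⟨ +-assoc _ _ _ ⟨
    (x + 1#) + (- 1# + - y)               ≈⟨ +-cong (+-comm _ _) (-‿+-comm 1# y) ⟩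
    (1# + x) + - (1# + y)                 ≈⟨ +-cong (suc×1 m) (-‿cong (suc×1 n)) ⟨
    suc m ×ℕ 1# + - (suc n ×ℕ 1#)           ∎
    where x = m ×ℕ 1#
          y = n ×ℕ 1#

  +-homo : ∀ i j → ⟦ i ℤ.+ j ⟧ℤ ≈ ⟦ i ⟧ℤ + ⟦ j ⟧ℤ
  +-homo (+ m)    (+ n)    = ×-homo-+ 1# m n
  +-homo (+ m)    -[1+ n ] = ⊖-homo m (suc n)
  +-homo -[1+ m ] (+ n)    = trans (⊖-homo n (suc m)) (+-comm _ _)
  +-homo -[1+ m ] -[1+ n ] = begin
    - (suc (suc (m ℕ.+ n)) ×ℕ 1#)          ≡⟨ ≡.cong (λ k → - (k ×ℕ 1#)) (ℕₚ.+-suc (suc m) n) ⟨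
    - ((suc m ℕ.+ suc n) ×ℕ 1#)            ≈⟨ -‿cong (×-homo-+ 1# (suc m) (suc n)) ⟩
    - (suc m ×ℕ 1# + suc n ×ℕ 1#)           ≈⟨ -‿+-comm _ _ ⟨
    - (suc m ×ℕ 1#) + - (suc n ×ℕ 1#)       ∎

  -‿homo : ∀ i → ⟦ ℤ.- i ⟧ℤ ≈ - ⟦ i ⟧ℤ
  -‿homo (+ zero)  = sym -0#≈0#
  -‿homo (+ suc n) = refl
  -‿homo -[1+ n ]  = sym (-‿involutive _)

  *-homo⁺ : ∀ m n → ⟦ + m ℤ.* + n ⟧ℤ ≈ ⟦ + m ⟧ℤ * ⟦ + n ⟧ℤ
  *-homo⁺ m n = trans (reflexive (≡.cong ⟦_⟧ℤ (≡.sym (ℤₚ.pos-* m n)))) (×1-homo-* m n)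

  *-homo⁺ˡ : ∀ m j → ⟦ + m ℤ.* j ⟧ℤ ≈ ⟦ + m ⟧ℤ * ⟦ j ⟧ℤ
  *-homo⁺ˡ m (+ n)    = *-homo⁺ m n
  *-homo⁺ˡ m -[1+ n ] = begin
    ⟦ + m ℤ.* -[1+ n ] ⟧ℤ                 ≡⟨ ≡.cong ⟦_⟧ℤ (ℤₚ.neg-distribʳ-* (+ m) (+ suc n)) ⟨
    ⟦ ℤ.- (+ m ℤ.* + suc n) ⟧ℤ            ≈⟨ -‿homo (+ m ℤ.* + suc n) ⟩
    - ⟦ + m ℤ.* + suc n ⟧ℤ                ≈⟨ -‿cong (*-homo⁺ m (suc n)) ⟩
    - (⟦ + m ⟧ℤ * ⟦ + suc n ⟧ℤ)           ≈⟨ -‿distribʳ-* _ _ ⟩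
    ⟦ + m ⟧ℤ * ⟦ -[1+ n ] ⟧ℤ              ∎

  *-homo : ∀ i j → ⟦ i ℤ.* j ⟧ℤ ≈ ⟦ i ⟧ℤ * ⟦ j ⟧ℤ
  *-homo (+ m)    j = *-homo⁺ˡ m j
  *-homo -[1+ m ] j = begin
    ⟦ -[1+ m ] ℤ.* j ⟧ℤ                   ≡⟨ ≡.cong ⟦_⟧ℤ (ℤₚ.neg-distribˡ-* (+ suc m) j) ⟨
    ⟦ ℤ.- (+ suc m ℤ.* j) ⟧ℤ              ≈⟨ -‿homo (+ suc m ℤ.* j) ⟩
    - ⟦ + suc m ℤ.* j ⟧ℤ                  ≈⟨ -‿cong (*-homo⁺ˡ (suc m) j) ⟩
    - (⟦ + suc m ⟧ℤ * ⟦ j ⟧ℤ)             ≈⟨ -‿distribˡ-* _ _ ⟩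
    ⟦ -[1+ m ] ⟧ℤ * ⟦ j ⟧ℤ                ∎

  -- Equality of integer coefficients is computable, which lets the normal forms cancel. In return
  -- `solve` proves only identities that hold in every commutative ring, so a special characteristic
  -- has to enter through explicit multiples of 1 + 1 or 1 + 1 + 1.
  morphism : ℤ.+-*-rawRing -Raw-AlmostCommutative⟶ fromCommutativeRing R
  morphism = record
    { ⟦_⟧    = ⟦_⟧ℤ
    ; +-homo = +-homo
    ; *-homo = *-homo
    ; -‿homo = -‿homo
    ; 0-homo = refl
    ; 1-homo = refl
    }

  _coeff≟_ : ∀ i j → Maybe (⟦ i ⟧ℤ ≈ ⟦ j ⟧ℤ)
  i coeff≟ j with i ℤ.≟ j
  ... | yes i≡j = just (reflexive (≡.cong ⟦_⟧ℤ i≡j))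
  ... | no  _   = nothing

  open Algebra.Solver.Ring ℤ.+-*-rawRing (fromCommutativeRing R) morphism _coeff≟_ public
    using (Polynomial; var; con; _:+_; _:*_; _:-_; :-_; _:=_; ⟦_⟧; ⟦_⟧↓; prove; solve)

-- The cubic extension of F by a root θ of x³ - x² - N.

record Triple (A : Set) : Set where
  constructor ⟨_,_,_⟩
  field
    c₀ c₁ c₂ : A
open Triple

-- Abstract in the two operations, so that the same product is available for elements of F and for
-- the polynomials of the solver.
module TripleOps {A : Set} (_+_ _*_ : A → A → A) (N : A) where
  -- Coordinates refer to the basis 1, θ, θ², where θ³ = θ² + N and hence θ⁴ = θ² + N θ + N.
  mul : Triple A → Triple A → Triple A
  mul ⟨ a₀ , a₁ , a₂ ⟩ ⟨ b₀ , b₁ , b₂ ⟩ =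
    ⟨ (a₀ * b₀) + (N * (d₃ + d₄))
    , ((a₀ * b₁) + (a₁ * b₀)) + (N * d₄)
    , (((a₀ * b₂) + (a₁ * b₁)) + (a₂ * b₀)) + (d₃ + d₄)
    ⟩
    where d₃ = (a₁ * b₂) + (a₂ * b₁)
          d₄ = a₂ * b₂

  add : Triple A → Triple A → Triple A
  add a b = ⟨ c₀ a + c₀ b , c₁ a + c₁ b , c₂ a + c₂ b ⟩

module CubicExtension (F : CommutativeRing 0ℓ 0ℓ) (N : CommutativeRing.Carrier F) where
  open CommutativeRing F
  open IntegerSolver F

  infix 4 _≈ᴱ_
  infixl 6 _+ᴱ_
  infixl 7 _*ᴱ_

  _≈ᴱ_ : Triple Carrier → Triple Carrier → Set
  a ≈ᴱ b = c₀ a ≈ c₀ b × c₁ a ≈ c₁ b × c₂ a ≈ c₂ b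

  _+ᴱ_ _*ᴱ_ : Triple Carrier → Triple Carrier → Triple Carrier
  _+ᴱ_ = TripleOps.add _+_ _*_ N
  _*ᴱ_ = TripleOps.mul _+_ _*_ N

  -ᴱ_ : Triple Carrier → Triple Carrier
  -ᴱ a = ⟨ - c₀ a , - c₁ a , - c₂ a ⟩

  0ᴱ 1ᴱ θ θ² : Triple Carrier
  0ᴱ = ⟨ 0# , 0# , 0# ⟩
  1ᴱ = ⟨ 1# , 0# , 0# ⟩
  θ  = ⟨ 0# , 1# , 0# ⟩
  θ² = ⟨ 0# , 0# , 1# ⟩

  scalar : Carrier → Triple Carrier
  scalar f = ⟨ f , 0# , 0# ⟩

  ⟦_⟧ᴱ : ∀ {n} → Triple (Polynomial n) → Vector.Vec Carrier n → Triple Carrier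
  ⟦ a ⟧ᴱ ρ = ⟨ ⟦ c₀ a ⟧ ρ , ⟦ c₁ a ⟧ ρ , ⟦ c₂ a ⟧ ρ ⟩

  ⟦_⟧ᴱ↓ : ∀ {n} → Triple (Polynomial n) → Vector.Vec Carrier n → Triple Carrier
  ⟦ a ⟧ᴱ↓ ρ = ⟨ ⟦ c₀ a ⟧↓ ρ , ⟦ c₁ a ⟧↓ ρ , ⟦ c₂ a ⟧↓ ρ ⟩

  proveᴱ : ∀ {n} (ρ : Vector.Vec Carrier n) (a b : Triple (Polynomial n)) →
           ⟦ a ⟧ᴱ↓ ρ ≈ᴱ ⟦ b ⟧ᴱ↓ ρ → ⟦ a ⟧ᴱ ρ ≈ᴱ ⟦ b ⟧ᴱ ρ
  proveᴱ ρ a b (e₀ , e₁ , e₂) =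
    prove ρ (c₀ a) (c₀ b) e₀ , prove ρ (c₁ a) (c₁ b) e₁ , prove ρ (c₂ a) (c₂ b) e₂

  ≈ᴱ-refl : ∀ {a} → a ≈ᴱ a
  ≈ᴱ-refl = refl , refl , refl

  private
    module _ {n : ℕ} where
      N′ : Polynomial (1 ℕ.+ n)
      N′ = var (# 0)

      infixl 7 _·_
      _·_ : Triple (Polynomial (1 ℕ.+ n)) → Triple (Polynomial (1 ℕ.+ n)) → Triple (Polynomial (1 ℕ.+ n))
      _·_ = TripleOps.mul _:+_ _:*_ N′

      _⊕_ : Triple (Polynomial (1 ℕ.+ n)) → Triple (Polynomial (1 ℕ.+ n)) → Triple (Polynomial (1 ℕ.+ n))
      _⊕_ = TripleOps.add _:+_ _:*_ N′

    x₁ : ∀ {n} → Triple (Polynomial (4 ℕ.+ n))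
    x₁ = ⟨ var (# 1) , var (# 2) , var (# 3) ⟩
    x₂ : ∀ {n} → Triple (Polynomial (7 ℕ.+ n))
    x₂ = ⟨ var (# 4) , var (# 5) , var (# 6) ⟩
    x₃ : ∀ {n} → Triple (Polynomial (10 ℕ.+ n))
    x₃ = ⟨ var (# 7) , var (# 8) , var (# 9) ⟩

  *ᴱ-assoc : ∀ a b c → (a *ᴱ b) *ᴱ c ≈ᴱ a *ᴱ (b *ᴱ c)
  *ᴱ-assoc ⟨ a₀ , a₁ , a₂ ⟩ ⟨ b₀ , b₁ , b₂ ⟩ ⟨ d₀ , d₁ , d₂ ⟩ =
    proveᴱ (N ∷ a₀ ∷ a₁ ∷ a₂ ∷ b₀ ∷ b₁ ∷ b₂ ∷ d₀ ∷ d₁ ∷ d₂ ∷ [])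
           (x₁ · x₂ · x₃) (x₁ · (x₂ · x₃)) ≈ᴱ-refl

  *ᴱ-comm : ∀ a b → a *ᴱ b ≈ᴱ b *ᴱ a
  *ᴱ-comm ⟨ a₀ , a₁ , a₂ ⟩ ⟨ b₀ , b₁ , b₂ ⟩ =
    proveᴱ (N ∷ a₀ ∷ a₁ ∷ a₂ ∷ b₀ ∷ b₁ ∷ b₂ ∷ []) (x₁ · x₂) (x₂ · x₁) ≈ᴱ-refl

  *ᴱ-distribʳ : ∀ c a b → (a +ᴱ b) *ᴱ c ≈ᴱ a *ᴱ c +ᴱ b *ᴱ c
  *ᴱ-distribʳ ⟨ a₀ , a₁ , a₂ ⟩ ⟨ b₀ , b₁ , b₂ ⟩ ⟨ d₀ , d₁ , d₂ ⟩ =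
    proveᴱ (N ∷ a₀ ∷ a₁ ∷ a₂ ∷ b₀ ∷ b₁ ∷ b₂ ∷ d₀ ∷ d₁ ∷ d₂ ∷ [])
           ((x₂ ⊕ x₃) · x₁) ((x₂ · x₁) ⊕ (x₃ · x₁)) ≈ᴱ-refl

  *ᴱ-identityˡ : ∀ a → 1ᴱ *ᴱ a ≈ᴱ a
  *ᴱ-identityˡ ⟨ a₀ , a₁ , a₂ ⟩ =
    proveᴱ (N ∷ a₀ ∷ a₁ ∷ a₂ ∷ []) (⟨ con (+ 1) , con (+ 0) , con (+ 0) ⟩ · x₁) x₁ ≈ᴱ-refl

  +ᴱ-cong : ∀ {a b c d} → a ≈ᴱ b → c ≈ᴱ d → a +ᴱ c ≈ᴱ b +ᴱ d
  +ᴱ-cong (p₀ , p₁ , p₂) (q₀ , q₁ , q₂) = +-cong p₀ q₀ , +-cong p₁ q₁ , +-cong p₂ q₂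

  *ᴱ-cong : ∀ {a b c d} → a ≈ᴱ b → c ≈ᴱ d → a *ᴱ c ≈ᴱ b *ᴱ d
  *ᴱ-cong (p₀ , p₁ , p₂) (q₀ , q₁ , q₂) =
      +-cong (*-cong p₀ q₀) (*-congˡ (+-cong d₃ d₄))
    , +-cong (+-cong (*-cong p₀ q₁) (*-cong p₁ q₀)) (*-congˡ d₄)
    , +-cong (+-cong (+-cong (*-cong p₀ q₂) (*-cong p₁ q₁)) (*-cong p₂ q₀)) (+-cong d₃ d₄)
    where d₃ = +-cong (*-cong p₁ q₂) (*-cong p₂ q₁)
          d₄ = *-cong p₂ q₂

  cubicExtension : CommutativeRing 0ℓ 0ℓ
  cubicExtension = record
    { Carrier = Triple Carrier
    ; _≈_     = _≈ᴱ_
    ; _+_     = _+ᴱ_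
    ; _*_     = _*ᴱ_
    ; -_      = -ᴱ_
    ; 0#      = 0ᴱ
    ; 1#      = 1ᴱ
    ; isCommutativeRing = record
      { isRing = record
        { +-isAbelianGroup = record
          { isGroup = record
            { isMonoid = record
              { isSemigroup = record
                { isMagma = record
                  { isEquivalence = isEquivalenceᴱ
                  ; ∙-cong = +ᴱ-cong
                  }
                ; assoc = λ a b c → +-assoc _ _ _ , +-assoc _ _ _ , +-assoc _ _ _
                }
              ; identity = (λ a → +-identityˡ _ , +-identityˡ _ , +-identityˡ _)
                         , (λ a → +-identityʳ _ , +-identityʳ _ , +-identityʳ _)
              }
            ; inverse = (λ a → -‿inverseˡ _ , -‿inverseˡ _ , -‿inverseˡ _)
                      , (λ a → -‿inverseʳ _ , -‿inverseʳ _ , -‿inverseʳ _)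
            ; ⁻¹-cong = λ (p₀ , p₁ , p₂) → -‿cong p₀ , -‿cong p₁ , -‿cong p₂
            }
          ; comm = λ a b → +-comm _ _ , +-comm _ _ , +-comm _ _
          }
        ; *-cong = *ᴱ-cong
        ; *-assoc = *ᴱ-assoc
        ; *-identity = comm∧idˡ⇒id *ᴱ-comm *ᴱ-identityˡ
        ; distrib = comm∧distrʳ⇒distr +ᴱ-cong *ᴱ-comm *ᴱ-distribʳ
        }
      ; *-comm = *ᴱ-comm
      }
    }
    where
    isEquivalenceᴱ : IsEquivalence _≈ᴱ_
    isEquivalenceᴱ = record
      { refl  = ≈ᴱ-refl
      ; sym   = λ (p₀ , p₁ , p₂) → sym p₀ , sym p₁ , sym p₂
      ; trans = λ (p₀ , p₁ , p₂) (q₀ , q₁ , q₂) → trans p₀ q₀ , trans p₁ q₁ , trans p₂ q₂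
      }
    setoidᴱ : Setoid 0ℓ 0ℓ
    setoidᴱ = record { isEquivalence = isEquivalenceᴱ }

    open Consequences setoidᴱ

-- Counting and linear algebra over a finite field.

module FiniteField (F : CommutativeRing 0ℓ 0ℓ) (isField : IsField F)
                   {q : ℕ} (card : HasCard F q) where
  open CommutativeRing F
  open IntegerSolver F
  open Lin F
  open Relation.Binary.Reasoning.Setoid setoid

  open Algebra.Properties.Group +-group using (x∙y⁻¹≈ε⇒x≈y; x≈y⇒x∙y⁻¹≈ε)
  open Algebra.Properties.Ring ring using (-0#≈0#; -‿involutive) public

  module Enum = Inverse card

  index : Carrier → Fin q
  index = Enum.from

  element : Fin q → Carrier
  element = Enum.to

  element-index : ∀ x → element (index x) ≈ x
  element-index = Enum.strictlyInverseˡ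

  index-injective : ∀ {x y} → index x ≡ index y → x ≈ y
  index-injective {x} {y} eq =
    trans (sym (element-index x)) (trans (reflexive (≡.cong element eq)) (element-index y))

  element-injective : ∀ {i j} → element i ≈ element j → i ≡ j
  element-injective {i} {j} eq =
    ≡.trans (≡.sym (Enum.strictlyInverseʳ i)) (≡.trans (Enum.from-cong eq) (Enum.strictlyInverseʳ j))

  infix 4 _≟_
  _≟_ : ∀ x y → Dec (x ≈ y)
  x ≟ y = map′ index-injective Enum.from-cong (index x Finₚ.≟ index y)

  stable : ∀ {x y} → ¬ ¬ (x ≈ y) → x ≈ y
  stable {x} {y} = decidable-stable (x ≟ y)

  any? : ∀ {P : Carrier → Set} → (∀ {x y} → x ≈ y → P x → P y) →
         (∀ x → Dec (P x)) → Dec (∃ P)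
  any? resp P? = map′ (λ (i , p) → element i , p)
                      (λ (x , p) → index x , resp (sym (element-index x)) p)
                      (Finₚ.any? (P? ∘ element))

  0≉1 : ¬ (0# ≈ 1#)
  0≉1 = proj₁ isField

  1≉0 : ¬ (1# ≈ 0#)
  1≉0 = 0≉1 ∘ sym

  inverse : ∀ {x} → ¬ (x ≈ 0#) → ∃[ y ] (x * y ≈ 1#)
  inverse = proj₂ isField _

  *-cancelˡ-≉0 : ∀ {x y z} → ¬ (x ≈ 0#) → x * y ≈ x * z → y ≈ z
  *-cancelˡ-≉0 {x} {y} {z} x≉0 eq with inverse x≉0
  ... | x⁻¹ , inv = begin
    y               ≈⟨ *-identityˡ y ⟨
    1# * y          ≈⟨ *-congʳ inv ⟨
    x * x⁻¹ * y     ≈⟨ shuffle x x⁻¹ y ⟩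
    x⁻¹ * (x * y)   ≈⟨ *-congˡ eq ⟩
    x⁻¹ * (x * z)   ≈⟨ shuffle x x⁻¹ z ⟨
    x * x⁻¹ * z     ≈⟨ *-congʳ inv ⟩
    1# * z          ≈⟨ *-identityˡ z ⟩
    z               ∎
    where
    shuffle : ∀ a b c → a * b * c ≈ b * (a * c)
    shuffle = solve 3 (λ a b c → a :* b :* c := b :* (a :* c)) refl

  x≉0∧x*y≈0⇒y≈0 : ∀ {x y} → ¬ (x ≈ 0#) → x * y ≈ 0# → y ≈ 0#
  x≉0∧x*y≈0⇒y≈0 x≉0 eq = *-cancelˡ-≉0 x≉0 (trans eq (sym (zeroʳ _)))

  *-≉0 : ∀ {x y} → ¬ (x ≈ 0#) → ¬ (y ≈ 0#) → ¬ (x * y ≈ 0#)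
  *-≉0 x≉0 y≉0 = y≉0 ∘ x≉0∧x*y≈0⇒y≈0 x≉0

  x-y≈0⇒x≈y : ∀ {x y} → x - y ≈ 0# → x ≈ y
  x-y≈0⇒x≈y = x∙y⁻¹≈ε⇒x≈y _ _

  x≈y⇒x-y≈0 : ∀ {x y} → x ≈ y → x - y ≈ 0#
  x≈y⇒x-y≈0 = x≈y⇒x∙y⁻¹≈ε

  -x≈0⇒x≈0 : ∀ {x} → - x ≈ 0# → x ≈ 0#
  -x≈0⇒x≈0 {x} -x≈0 = trans (sym (-‿involutive x)) (trans (-‿cong -x≈0) -0#≈0#)

  irreducible⇒≉0 : ∀ {N} → Irreducible F N → ¬ (N ≈ 0#)
  irreducible⇒≉0 irreducible N≈0 = irreducible 0# (trans
    (solve 0 (con (+ 0) :* con (+ 0) :* con (+ 0) := con (+ 0) :* con (+ 0) :+ con (+ 0)) refl) (+-congˡ (sym N≈0)))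

  -- If every value were attained, each would have a preimage other than `j`, as `i` serves for the
  -- value at `j`. Together with `j` itself these preimages would inject a set of q + 1 elements
  -- into `Fin q`.
  missing-value : (f : Fin q → Carrier) {i j : Fin q} → i ≢ j → f i ≈ f j →
                  ∃[ z ] (∀ k → ¬ (f k ≈ z))
  missing-value f {i} {j} i≢j fi≈fj
    with any? {λ z → ¬ (∃[ k ] (f k ≈ z))}
              (λ x≈y ¬p (k , e) → ¬p (k , trans e (sym x≈y)))
              (λ z → ¬? (Finₚ.any? (λ k → f k ≟ z)))
  ... | yes (z , ¬hit) = z , λ k e → ¬hit (k , e)
  ... | no ¬missed = contradiction (λ {a} {b} → section-injective {a} {b}) (Finₚ.<⇒notInjective (ℕₚ.n<1+n q))
    where
    preimage : ∀ z → ∃[ k ] (f k ≈ z × k ≢ j)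
    preimage z with Finₚ.any? (λ k → f k ≟ z)
    ... | no ¬hit = contradiction (z , ¬hit) ¬missed
    ... | yes (k , fk≈z) with k Finₚ.≟ j
    ...   | yes ≡.refl = i , trans fi≈fj fk≈z , i≢j
    ...   | no  k≢j    = k , fk≈z , k≢j

    section : Fin (suc q) → Fin q
    section fzero    = j
    section (fsuc k) = proj₁ (preimage (element k))

    section-injective : ∀ {a b} → section a ≡ section b → a ≡ b
    section-injective {fzero}  {fzero}  eq = ≡.refl
    section-injective {fzero}  {fsuc b} eq = contradiction (≡.sym eq) (proj₂ (proj₂ (preimage (element b))))
    section-injective {fsuc a} {fzero}  eq = contradiction eq (proj₂ (proj₂ (preimage (element a))))
    section-injective {fsuc a} {fsuc b} eq = ≡.cong fsuc (element-injective (begin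
      element a                            ≈⟨ proj₁ (proj₂ (preimage (element a))) ⟨
      f (proj₁ (preimage (element a)))     ≡⟨ ≡.cong f eq ⟩
      f (proj₁ (preimage (element b)))     ≈⟨ proj₁ (proj₂ (preimage (element b))) ⟩
      element b                            ∎))

  Σ-cong : ∀ {n} {f g : Fin n → Carrier} → (∀ i → f i ≈ g i) → Σ′ n f ≈ Σ′ n g
  Σ-cong {ℕ.zero} f≈g = refl
  Σ-cong {suc n}  f≈g = +-cong (f≈g fzero) (Σ-cong (f≈g ∘ fsuc))

  Σ-0 : ∀ {n} {f : Fin n → Carrier} → (∀ i → f i ≈ 0#) → Σ′ n f ≈ 0#
  Σ-0 {ℕ.zero} f≈0 = refl
  Σ-0 {suc n}  f≈0 = trans (+-cong (f≈0 fzero) (Σ-0 (f≈0 ∘ fsuc))) (+-identityˡ 0#)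

  Σ-+ : ∀ {n} (f g : Fin n → Carrier) → Σ′ n (λ i → f i + g i) ≈ Σ′ n f + Σ′ n g
  Σ-+ {ℕ.zero} f g = sym (+-identityˡ 0#)
  Σ-+ {suc n}  f g = trans (+-congˡ (Σ-+ (f ∘ fsuc) (g ∘ fsuc)))
    (solve 4 (λ a b c d → a :+ b :+ (c :+ d) := a :+ c :+ (b :+ d)) refl _ _ _ _)

  Σ-*ˡ : ∀ {n} a (f : Fin n → Carrier) → Σ′ n (λ i → a * f i) ≈ a * Σ′ n f
  Σ-*ˡ {ℕ.zero} a f = sym (zeroʳ a)
  Σ-*ˡ {suc n}  a f = trans (+-congˡ (Σ-*ˡ a (f ∘ fsuc))) (sym (distribˡ a _ _))

  Σ-swap : ∀ {m n} (f : Fin m → Fin n → Carrier) →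
           Σ′ m (λ i → Σ′ n (f i)) ≈ Σ′ n (λ j → Σ′ m (λ i → f i j))
  Σ-swap {ℕ.zero} {n} f = sym (Σ-0 {n} (λ _ → refl))
  Σ-swap {suc m} {n} f = trans (+-congˡ (Σ-swap (f ∘ fsuc)))
    (sym (Σ-+ (f fzero) (λ j → Σ′ m (λ i → f (fsuc i) j))))

  _∙_ : ∀ {d} → Vec d → Vec d → Carrier
  φ ∙ v = Σ′ _ (λ i → φ i * v i)

  ∙-congʳ : ∀ {d} {φ} {u v : Vec d} → (∀ i → u i ≈ v i) → φ ∙ u ≈ φ ∙ v
  ∙-congʳ u≈v = Σ-cong (*-congˡ ∘ u≈v)

  ∙-congˡ : ∀ {d} {φ ψ v : Vec d} → (∀ i → φ i ≈ ψ i) → φ ∙ v ≈ ψ ∙ v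
  ∙-congˡ φ≈ψ = Σ-cong (*-congʳ ∘ φ≈ψ)

  ∙-comm : ∀ {d} (φ v : Vec d) → φ ∙ v ≈ v ∙ φ
  ∙-comm φ v = Σ-cong (λ i → *-comm (φ i) (v i))

  ∙-lincomb : ∀ {d m} (φ : Vec d) (c : Vec m) (A : Fin m → Vec d) →
              φ ∙ lincomb c A ≈ c ∙ (λ j → φ ∙ A j)
  ∙-lincomb {d} {m} φ c A = begin
    Σ′ d (λ i → φ i * Σ′ m (λ j → c j * A j i))      ≈⟨ Σ-cong (λ i → Σ-*ˡ (φ i) (λ j → c j * A j i)) ⟨
    Σ′ d (λ i → Σ′ m (λ j → φ i * (c j * A j i)))    ≈⟨ Σ-swap (λ i j → φ i * (c j * A j i)) ⟩
    Σ′ m (λ j → Σ′ d (λ i → φ i * (c j * A j i)))    ≈⟨ Σ-cong (λ j → Σ-cong (λ i → exchange (φ i) (c j) (A j i))) ⟩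
    Σ′ m (λ j → Σ′ d (λ i → c j * (φ i * A j i)))    ≈⟨ Σ-cong (λ j → Σ-*ˡ (c j) (λ i → φ i * A j i)) ⟩
    Σ′ m (λ j → c j * Σ′ d (λ i → φ i * A j i))      ∎
    where
    exchange : ∀ a b c → a * (b * c) ≈ b * (a * c)
    exchange = solve 3 (λ a b c → a :* (b :* c) := b :* (a :* c)) refl

  lincomb-∙ : ∀ {d m} (c : Vec m) (A : Fin m → Vec d) (v : Vec d) →
              lincomb c A ∙ v ≈ c ∙ (λ j → A j ∙ v)
  lincomb-∙ c A v = begin
    lincomb c A ∙ v            ≈⟨ ∙-comm (lincomb c A) v ⟩
    v ∙ lincomb c A            ≈⟨ ∙-lincomb v c A ⟩
    c ∙ (λ j → v ∙ A j)        ≈⟨ ∙-congʳ (λ j → ∙-comm v (A j)) ⟩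
    c ∙ (λ j → A j ∙ v)        ∎

  basis : ∀ {d} → Fin d → Vec d
  basis fzero    fzero    = 1#
  basis fzero    (fsuc j) = 0#
  basis (fsuc i) fzero    = 0#
  basis (fsuc i) (fsuc j) = basis i j

  basis-∙ : ∀ {d} (i : Fin d) (v : Vec d) → basis i ∙ v ≈ v i
  basis-∙ fzero v = trans (+-cong (*-identityˡ (v fzero)) (Σ-0 (λ i → zeroˡ (v (fsuc i)))))
                          (+-identityʳ (v fzero))
  basis-∙ (fsuc i) v = trans (+-cong (zeroˡ (v fzero)) (basis-∙ i (v ∘ fsuc))) (+-identityˡ _)

  ∙-linear : ∀ {d} (φ ψ v : Vec d) a b →
             (λ i → a * φ i + b * ψ i) ∙ v ≈ a * (φ ∙ v) + b * (ψ ∙ v)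
  ∙-linear φ ψ v a b = begin
    Σ′ _ (λ i → (a * φ i + b * ψ i) * v i)
      ≈⟨ Σ-cong (λ i → solve 5 (λ a x b y v → (a :* x :+ b :* y) :* v := a :* (x :* v) :+ b :* (y :* v)) refl a (φ i) b (ψ i) (v i)) ⟩
    Σ′ _ (λ i → a * (φ i * v i) + b * (ψ i * v i))
      ≈⟨ Σ-+ (λ i → a * (φ i * v i)) (λ i → b * (ψ i * v i)) ⟩
    Σ′ _ (λ i → a * (φ i * v i)) + Σ′ _ (λ i → b * (ψ i * v i))
      ≈⟨ +-cong (Σ-*ˡ a (λ i → φ i * v i)) (Σ-*ˡ b (λ i → ψ i * v i)) ⟩
    a * (φ ∙ v) + b * (ψ ∙ v) ∎

  Separates : ∀ {d m} → Vec d → (Fin m → Vec d) → Vec d → Set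
  Separates φ A f = (∀ j → φ ∙ A j ≈ 0#) × ¬ (φ ∙ f ≈ 0#)

  -- Induction on the number of vectors. A functional φ that separates f from the tail is kept if it
  -- kills the head a as well. Otherwise f is moved along a into the kernel of φ; a functional ψ
  -- separating the result from the tail is corrected by a multiple of φ so as to kill a. This
  -- alternative is the source of membership tests, dual families and extensions of functionals
  -- below.
  fredholm : ∀ {d m} (A : Fin m → Vec d) (f : Vec d) → InSpan A f ⊎ ∃[ φ ] Separates φ A f
  fredholm {d} {ℕ.zero} A f with Finₚ.any? (λ i → ¬? (f i ≟ 0#))
  ... | yes (i , fi≉0) = inj₂ (basis i , (λ ()) , fi≉0 ∘ trans (sym (basis-∙ i f)))
  ... | no  f≈0        = inj₁ ((λ ()) , λ i → stable (λ fi≉0 → f≈0 (i , fi≉0)))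
  fredholm {d} {suc m} A f with fredholm (A ∘ fsuc) f
  ... | inj₁ (c , f≈) = inj₁ (c⁺ , λ i → trans (f≈ i) (sym (trans (+-congʳ (zeroˡ _)) (+-identityˡ _))))
    where c⁺ : Vec (suc m)
          c⁺ fzero    = 0#
          c⁺ (fsuc j) = c j
  ... | inj₂ (φ , φA≈0 , φf≉0) with φ ∙ A fzero ≟ 0#
  ...   | yes φa≈0 = inj₂ (φ , (λ { fzero → φa≈0 ; (fsuc j) → φA≈0 j }) , φf≉0)
  ...   | no  φa≉0 with inverse φa≉0
  ...     | [φa]⁻¹ , inv with fredholm (A ∘ fsuc) (λ i → 1# * f i + (- (φ ∙ f * [φa]⁻¹)) * A fzero i)
  ...       | inj₁ (c , f′≈) = inj₁ (c⁺ , λ i → begin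
      f i                                ≈⟨ solve 3 (λ f b a → f := b :* a :+ (con (+ 1) :* f :+ :- b :* a)) refl (f i) β (A fzero i) ⟩
      β * A fzero i + (1# * f i + - β * A fzero i) ≈⟨ +-congˡ (f′≈ i) ⟩
      lincomb c⁺ A i                     ∎)
    where
    β = φ ∙ f * [φa]⁻¹
    c⁺ : Vec (suc m)
    c⁺ fzero    = β
    c⁺ (fsuc j) = c j
  ...       | inj₂ (ψ , ψA≈0 , ψf′≉0) = inj₂ (χ , χA≈0 , λ χf≈0 → ψf′≉0 (trans ψf′≈χf χf≈0))
    where
    a  = A fzero
    β  = φ ∙ f * [φa]⁻¹
    -- Chosen such that ψ + γ φ vanishes on a; its value at f is then the value of ψ at f - β a.
    γ  = - (ψ ∙ a * [φa]⁻¹)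
    χ : Vec d
    χ i = 1# * ψ i + γ * φ i

    χA≈0 : ∀ j → χ ∙ A j ≈ 0#
    χA≈0 fzero = begin
      χ ∙ a                                          ≈⟨ ∙-linear ψ φ a 1# γ ⟩
      1# * (ψ ∙ a) + - (ψ ∙ a * [φa]⁻¹) * (φ ∙ a)    ≈⟨ solve 3 (λ x y z → con (+ 1) :* x :+ :- (x :* y) :* z := x :- x :* (z :* y)) refl (ψ ∙ a) [φa]⁻¹ (φ ∙ a) ⟩
      ψ ∙ a - ψ ∙ a * (φ ∙ a * [φa]⁻¹)               ≈⟨ x≈y⇒x-y≈0 (sym (trans (*-congˡ inv) (*-identityʳ _))) ⟩
      0#                                             ∎
    χA≈0 (fsuc j) = begin
      χ ∙ A (fsuc j)                                 ≈⟨ ∙-linear ψ φ (A (fsuc j)) 1# γ ⟩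
      1# * (ψ ∙ A (fsuc j)) + γ * (φ ∙ A (fsuc j))   ≈⟨ +-cong (*-congˡ (ψA≈0 j)) (*-congˡ (φA≈0 j)) ⟩
      1# * 0# + γ * 0#                               ≈⟨ solve 1 (λ g → con (+ 1) :* con (+ 0) :+ g :* con (+ 0) := con (+ 0)) refl γ ⟩
      0#                                             ∎

    ψf′≈χf : ψ ∙ (λ i → 1# * f i + - β * a i) ≈ χ ∙ f
    ψf′≈χf = begin
      ψ ∙ (λ i → 1# * f i + - β * a i)               ≈⟨ ∙-comm ψ _ ⟩
      (λ i → 1# * f i + - β * a i) ∙ ψ               ≈⟨ ∙-linear f a ψ 1# (- β) ⟩
      1# * (f ∙ ψ) + - β * (a ∙ ψ)                   ≈⟨ +-cong (*-congˡ (∙-comm f ψ)) (*-congˡ (∙-comm a ψ)) ⟩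
      1# * (ψ ∙ f) + - (φ ∙ f * [φa]⁻¹) * (ψ ∙ a)    ≈⟨ solve 4 (λ x y z w → con (+ 1) :* x :+ :- (y :* z) :* w := con (+ 1) :* x :+ :- (w :* z) :* y) refl (ψ ∙ f) (φ ∙ f) [φa]⁻¹ (ψ ∙ a) ⟩
      1# * (ψ ∙ f) + γ * (φ ∙ f)                     ≈⟨ ∙-linear ψ φ f 1# γ ⟨
      χ ∙ f                                          ∎

  1<q : 1 ℕ.< q
  1<q = distinct⇒1<n (index 0#) (index 1#) (0≉1 ∘ index-injective)
    where
    distinct⇒1<n : ∀ {n} (i j : Fin n) → i ≢ j → 1 ℕ.< n
    distinct⇒1<n {suc ℕ.zero}    fzero fzero i≢j = contradiction ≡.refl i≢j
    distinct⇒1<n {suc (suc n)} _     _     _   = ℕ.s<s ℕ.z<s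

  funToFin-cong : ∀ {m n} {f g : Fin m → Fin n} → (∀ k → f k ≡ g k) → funToFin f ≡ funToFin g
  funToFin-cong {ℕ.zero} eq = ≡.refl
  funToFin-cong {suc m}  eq = ≡.cong₂ Fin.combine (eq fzero) (funToFin-cong (eq ∘ fsuc))

  tuple : ∀ {n} → Fin (q ^ℕ n) → Vec n
  tuple i = element ∘ finToFun i

  tuple-injective : ∀ {n} {i j : Fin (q ^ℕ n)} → (∀ k → tuple {n} i k ≈ tuple {n} j k) → i ≡ j
  tuple-injective {n} {i} {j} eq = ≡.trans (≡.sym (Finₚ.funToFin-finToFin {n} i))
    (≡.trans (funToFin-cong {n} (λ k → element-injective (eq k))) (Finₚ.funToFin-finToFin {n} j))

  -- There are more coefficient tuples than values of the combination, so two tuples have the same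
  -- combination; their difference is the relation.
  dependent : ∀ {d} (v : Fin (suc d) → Vec d) →
              ∃[ c ] (¬ (∀ j → c j ≈ 0#) × (∀ i → lincomb c v i ≈ 0#))
  dependent {d} v with Finₚ.pigeonhole (ℕₚ.^-monoʳ-< q 1<q (ℕₚ.n<1+n d))
    (λ k → funToFin {d} {q} (λ i → index (lincomb (tuple {suc d} k) v i)))
  ... | k , l , k<l , code-eq = c , nontrivial , combination
    where
    x y c : Vec (suc d)
    x = tuple {suc d} k
    y = tuple {suc d} l
    c j = x j - y j

    nontrivial : ¬ (∀ j → c j ≈ 0#)
    nontrivial c≈0 = Finₚ.<⇒≢ k<l (tuple-injective {suc d} (λ j → x-y≈0⇒x≈y (c≈0 j)))

    same : ∀ i → lincomb x v i ≈ lincomb y v i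
    same i = index-injective (≡.trans (≡.sym (Finₚ.finToFun-funToFin {d} {q} _ i))
      (≡.trans (≡.cong (λ m → finToFun {q} {d} m i) code-eq) (Finₚ.finToFun-funToFin {d} {q} _ i)))

    combination : ∀ i → lincomb c v i ≈ 0#
    combination i = begin
      Σ′ (suc d) (λ j → (x j - y j) * v j i)
        ≈⟨ Σ-cong (λ j → solve 3 (λ x y v → (x :- y) :* v := con (+ 1) :* (x :* v) :+ :- con (+ 1) :* (y :* v)) refl (x j) (y j) (v j i)) ⟩
      Σ′ (suc d) (λ j → 1# * (x j * v j i) + - 1# * (y j * v j i))
        ≈⟨ Σ-+ (λ j → 1# * (x j * v j i)) (λ j → - 1# * (y j * v j i)) ⟩
      Σ′ (suc d) (λ j → 1# * (x j * v j i)) + Σ′ (suc d) (λ j → - 1# * (y j * v j i))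
        ≈⟨ +-cong (Σ-*ˡ 1# (λ j → x j * v j i)) (Σ-*ˡ (- 1#) (λ j → y j * v j i)) ⟩
      1# * lincomb x v i + - 1# * lincomb y v i
        ≈⟨ +-congʳ (*-congˡ (same i)) ⟩
      1# * lincomb y v i + - 1# * lincomb y v i
        ≈⟨ solve 1 (λ z → con (+ 1) :* z :+ :- con (+ 1) :* z := con (+ 0)) refl _ ⟩
      0# ∎

-- Identities in commutative rings, for use in the cubic extension.

module RingIdentities (R : CommutativeRing 0ℓ 0ℓ) where
  open CommutativeRing R
  open IntegerSolver R

  factor-difference : ∀ y s t u v → y * s * v - y * t * u ≈ y * (s * v - t * u)
  factor-difference = solve 5 (λ y s t u v → y :* s :* v :- y :* t :* u := y :* (s :* v :- t :* u)) refl

  difference-bilinear : ∀ a b c d u v → (a - b) * v - (c - d) * u ≈ (a * v - c * u) - (b * v - d * u)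
  difference-bilinear = solve 6 (λ a b c d u v →
    (a :- b) :* v :- (c :- d) :* u := (a :* v :- c :* u) :- (b :* v :- d :* u)) refl

  -- With s m + t n = 1, this and the next identity say that a pair (u , v) with s v = t u has the
  -- form (s x , t x) for the parameter x = m u + n v.
  unimodular-lower : ∀ s t m n u v → s * v ≈ t * u → (s * m + t * n) * u ≈ s * (m * u + n * v)
  unimodular-lower s t m n u v sv≈tu = trans
    (solve 5 (λ s t m n u → (s :* m :+ t :* n) :* u := s :* (m :* u) :+ n :* (t :* u)) refl s t m n u)
    (trans (+-congˡ (*-congˡ (sym sv≈tu)))
      (solve 5 (λ s m n u v → s :* (m :* u) :+ n :* (s :* v) := s :* (m :* u :+ n :* v)) refl s m n u v))

  unimodular-upper : ∀ s t m n u v → s * v ≈ t * u → (s * m + t * n) * v ≈ t * (m * u + n * v)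
  unimodular-upper s t m n u v sv≈tu = trans
    (solve 5 (λ s t m n v → (s :* m :+ t :* n) :* v := m :* (s :* v) :+ t :* (n :* v)) refl s t m n v)
    (trans (+-congʳ (*-congˡ sv≈tu))
      (solve 5 (λ t m n u v → m :* (t :* u) :+ t :* (n :* v) := t :* (m :* u :+ n :* v)) refl t m n u v))

  recover-identity : ∀ s t m n x → (s * m + t * n) * x ≈ m * (s * x) + n * (t * x)
  recover-identity = solve 5 (λ s t m n x → (s :* m :+ t :* n) :* x := m :* (s :* x) :+ n :* (t :* x)) refl

  -- W = w⁻¹ times the difference of v₂ times the second relation and k₂ times the first.
  eliminate : ∀ c₀ c₁ c₂ x w y₁ y₂ v₁ v₂ k₁ k₂ W → w * W ≈ 1# →
    c₀ * (x * 0# - w * 1#) + (c₁ * (y₁ * v₁ - w * 1#) + c₂ * (y₂ * v₂ - w * 1#)) ≈ 0# →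
    c₀ * (x * 1# - w * 0#) + (c₁ * (y₁ * k₁ - w * 0#) + c₂ * (y₂ * k₂ - w * 0#)) ≈ 0# →
    (c₀ * (v₂ * (x * W)) + c₁ * (k₁ * (v₂ * (y₁ * W)) - k₂ * (v₁ * (y₁ * W)))) + (c₀ + c₁ + c₂) * k₂ ≈ 0#
  eliminate c₀ c₁ c₂ x w y₁ y₂ v₁ v₂ k₁ k₂ W wW≈1 eq₁ eq₂ = begin
    (c₀ * (v₂ * (x * W)) + c₁ * (k₁ * (v₂ * (y₁ * W)) - k₂ * (v₁ * (y₁ * W)))) + (c₀ + c₁ + c₂) * k₂
      ≈⟨ solve 10 (λ c₀ c₁ c₂ x y₁ v₁ v₂ k₁ k₂ W →
           (c₀ :* (v₂ :* (x :* W)) :+ c₁ :* (k₁ :* (v₂ :* (y₁ :* W)) :- k₂ :* (v₁ :* (y₁ :* W)))) :+ (c₀ :+ c₁ :+ c₂) :* k₂ :=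
           W :* (c₀ :* v₂ :* x :+ c₁ :* y₁ :* (k₁ :* v₂ :- k₂ :* v₁)) :+ con (+ 1) :* ((c₀ :+ c₁ :+ c₂) :* k₂))
           refl c₀ c₁ c₂ x y₁ v₁ v₂ k₁ k₂ W ⟩
    W * (c₀ * v₂ * x + c₁ * y₁ * (k₁ * v₂ - k₂ * v₁)) + 1# * ((c₀ + c₁ + c₂) * k₂)
      ≈⟨ +-congˡ (*-congʳ wW≈1) ⟨
    W * (c₀ * v₂ * x + c₁ * y₁ * (k₁ * v₂ - k₂ * v₁)) + w * W * ((c₀ + c₁ + c₂) * k₂)
      ≈⟨ solve 12 (λ c₀ c₁ c₂ x w y₁ y₂ v₁ v₂ k₁ k₂ W →
           W :* (c₀ :* v₂ :* x :+ c₁ :* y₁ :* (k₁ :* v₂ :- k₂ :* v₁)) :+ w :* W :* ((c₀ :+ c₁ :+ c₂) :* k₂) :=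
           W :* (v₂ :* (c₀ :* (x :* con (+ 1) :- w :* con (+ 0)) :+ (c₁ :* (y₁ :* k₁ :- w :* con (+ 0)) :+ c₂ :* (y₂ :* k₂ :- w :* con (+ 0))))
           :- k₂ :* (c₀ :* (x :* con (+ 0) :- w :* con (+ 1)) :+ (c₁ :* (y₁ :* v₁ :- w :* con (+ 1)) :+ c₂ :* (y₂ :* v₂ :- w :* con (+ 1))))))
           refl c₀ c₁ c₂ x w y₁ y₂ v₁ v₂ k₁ k₂ W ⟩
    W * (v₂ * _ - k₂ * _)
      ≈⟨ *-congˡ (+-cong (*-congˡ eq₂) (-‿cong (*-congˡ eq₁))) ⟩
    W * (v₂ * 0# - k₂ * 0#)
      ≈⟨ solve 3 (λ v k W → W :* (v :* con (+ 0) :- k :* con (+ 0)) := con (+ 0)) refl v₂ k₂ W ⟩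
    0# ∎
    where open Relation.Binary.Reasoning.Setoid setoid

  parallel⇒cross : ∀ {s t s′ t′ x} → s ≈ s′ * x → t ≈ t′ * x → s * t′ ≈ t * s′
  parallel⇒cross {s} {t} {s′} {t′} {x} s≈ t≈ = trans (*-congʳ s≈)
    (trans (solve 3 (λ s t x → s :* x :* t := t :* x :* s) refl s′ t′ x) (*-congʳ (sym t≈)))

  interchange-inverse : ∀ w x′ x w′ → w * x′ * (x * w′) ≈ w * w′ * (x * x′)
  interchange-inverse = solve 4 (λ w x′ x w′ → w :* x′ :* (x :* w′) := w :* w′ :* (x :* x′)) refl

  rearrange-product : ∀ v u y → v * (u * y) ≈ u * (v * y)
  rearrange-product = solve 3 (λ v u y → v :* (u :* y) := u :* (v :* y)) refl

  module CharacteristicTwo (2≈0 : 1# + 1# ≈ 0#) where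
    open Relation.Binary.Reasoning.Setoid setoid

    private
      o i : ∀ {n} → Polynomial n
      o = con (+ 0)
      i = con (+ 1)

      module _ {γ₀ γ₁ γ₂ t x y z : Carrier} (eq : γ₀ * (x - t) + (γ₁ * (y - t) + γ₂ * (z - t)) ≈ 0#) where
        -- The solver does not know that 1 + 1 = 0, so each identity is stated over the integers
        -- with an even correction (1 + 1) w.
        conclude : ∀ {ε₀ ε₁ ε₂} u v w → γ₀ ≈ ε₀ → γ₁ ≈ ε₁ → γ₂ ≈ ε₂ →
          u - v ≈ (ε₀ * (x - t) + (ε₁ * (y - t) + ε₂ * (z - t))) + (1# + 1#) * w → u ≈ v
        conclude {ε₀} {ε₁} {ε₂} u v w γ₀≈ γ₁≈ γ₂≈ u-v≈ = begin
          u                    ≈⟨ solve 2 (λ u v → u := u :- v :+ v) refl u v ⟩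
          u - v + v            ≈⟨ +-congʳ u-v≈ ⟩
          _ + (1# + 1#) * w + v ≈⟨ +-congʳ (+-cong (trans (+-cong (*-congʳ (sym γ₀≈)) (+-cong (*-congʳ (sym γ₁≈)) (*-congʳ (sym γ₂≈)))) eq) (*-congʳ 2≈0)) ⟩
          0# + 0# * w + v      ≈⟨ solve 2 (λ w v → con (+ 0) :+ con (+ 0) :* w :+ v := v) refl w v ⟩
          v                    ∎

    -- One lemma for each nonzero coefficient vector over 𝔽₂. A vector of weight one or two
    -- identifies two of the points t, x, y, z; only 111 leaves them distinct and makes their sum
    -- zero.
    module AffineRelation (γ₀ γ₁ γ₂ t x y z : Carrier)
                          (eq : γ₀ * (x - t) + (γ₁ * (y - t) + γ₂ * (z - t)) ≈ 0#) where
      relation-100 : γ₀ ≈ 1# → γ₁ ≈ 0# → γ₂ ≈ 0# → t ≈ x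
      relation-100 p q r = sym (conclude eq x t 0# p q r (solve 4 (λ t x y z → x :- t :=
        i :* (x :- t) :+ (o :* (y :- t) :+ o :* (z :- t)) :+ (i :+ i) :* o) refl t x y z))

      relation-010 : γ₀ ≈ 0# → γ₁ ≈ 1# → γ₂ ≈ 0# → t ≈ y
      relation-010 p q r = sym (conclude eq y t 0# p q r (solve 4 (λ t x y z → y :- t :=
        o :* (x :- t) :+ (i :* (y :- t) :+ o :* (z :- t)) :+ (i :+ i) :* o) refl t x y z))

      relation-001 : γ₀ ≈ 0# → γ₁ ≈ 0# → γ₂ ≈ 1# → t ≈ z
      relation-001 p q r = sym (conclude eq z t 0# p q r (solve 4 (λ t x y z → z :- t :=
        o :* (x :- t) :+ (o :* (y :- t) :+ i :* (z :- t)) :+ (i :+ i) :* o) refl t x y z))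

      relation-110 : γ₀ ≈ 1# → γ₁ ≈ 1# → γ₂ ≈ 0# → x ≈ y
      relation-110 p q r = conclude eq x y (t - y) p q r (solve 4 (λ t x y z → x :- y :=
        i :* (x :- t) :+ (i :* (y :- t) :+ o :* (z :- t)) :+ (i :+ i) :* (t :- y)) refl t x y z)

      relation-101 : γ₀ ≈ 1# → γ₁ ≈ 0# → γ₂ ≈ 1# → x ≈ z
      relation-101 p q r = conclude eq x z (t - z) p q r (solve 4 (λ t x y z → x :- z :=
        i :* (x :- t) :+ (o :* (y :- t) :+ i :* (z :- t)) :+ (i :+ i) :* (t :- z)) refl t x y z)

      relation-011 : γ₀ ≈ 0# → γ₁ ≈ 1# → γ₂ ≈ 1# → y ≈ z
      relation-011 p q r = conclude eq y z (t - z) p q r (solve 4 (λ t x y z → y :- z :=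
        o :* (x :- t) :+ (i :* (y :- t) :+ i :* (z :- t)) :+ (i :+ i) :* (t :- z)) refl t x y z)

      relation-111 : γ₀ ≈ 1# → γ₁ ≈ 1# → γ₂ ≈ 1# → z ≈ t + x + y
      relation-111 p q r = conclude eq z (t + x + y) (t - x - y) p q r (solve 4 (λ t x y z → z :- (t :+ x :+ y) :=
        i :* (x :- t) :+ (i :* (y :- t) :+ i :* (z :- t)) :+ (i :+ i) :* (t :- x :- y)) refl t x y z)

  -- Shows that equal vectors y (t , s) and y′ (t′ , s′) with invertible y and y′ belong to equal
  -- slopes.
  cross-multiply : ∀ {y s t y′ s′ t′} → y * t ≈ y′ * t′ → y * s ≈ y′ * s′ →
                   y * (y′ * (s * t′ - t * s′)) ≈ 0#
  cross-multiply {y} {s} {t} {y′} {s′} {t′} eq-t eq-s = begin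
    y * (y′ * (s * t′ - t * s′))          ≈⟨ solve 6 (λ y s t y′ s′ t′ → y :* (y′ :* (s :* t′ :- t :* s′)) := y :* s :* (y′ :* t′) :- y :* t :* (y′ :* s′)) refl y s t y′ s′ t′ ⟩
    y * s * (y′ * t′) - y * t * (y′ * s′) ≈⟨ +-cong (*-congʳ eq-s) (-‿cong (*-congʳ eq-t)) ⟩
    y′ * s′ * (y′ * t′) - y′ * t′ * (y′ * s′) ≈⟨ solve 3 (λ y s t → y :* s :* (y :* t) :- y :* t :* (y :* s) := con (+ 0)) refl y′ s′ t′ ⟩
    0#                                    ∎
    where open Relation.Binary.Reasoning.Setoid setoid

-- Annihilators of independent families, and the span of the points of a union.

module FiniteFieldVectors (F : CommutativeRing 0ℓ 0ℓ) (isField : IsField F)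
                          {q : ℕ} (card : HasCard F q) where
  open CommutativeRing F
  open IntegerSolver F
  open Lin F
  open FiniteField F isField card
  open Relation.Binary.Reasoning.Setoid setoid

  lincomb-lincomb : ∀ {d m n} (c : Vec n) (A : Fin n → Vec m) (B : Fin m → Vec d) i →
                    lincomb (lincomb c A) B i ≈ lincomb c (λ j → lincomb (A j) B) i
  lincomb-lincomb c A B i = lincomb-∙ c A (λ j → B j i)

  lincomb-congˡ : ∀ {d m} {c c′ : Vec m} (A : Fin m → Vec d) → (∀ j → c j ≈ c′ j) →
                  ∀ i → lincomb c A i ≈ lincomb c′ A i
  lincomb-congˡ A c≈c′ i = ∙-congˡ c≈c′

  inSpan? : ∀ {d m} (A : Fin m → Vec d) (f : Vec d) → Dec (InSpan A f)
  inSpan? A f with fredholm A f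
  ... | inj₁ f∈A = yes f∈A
  ... | inj₂ (φ , φA≈0 , φf≉0) = no λ (c , f≈) → φf≉0 (begin
    φ ∙ f                        ≈⟨ ∙-congʳ f≈ ⟩
    φ ∙ lincomb c A              ≈⟨ ∙-lincomb φ c A ⟩
    c ∙ (λ j → φ ∙ A j)          ≈⟨ Σ-0 (λ j → trans (*-congˡ (φA≈0 j)) (zeroʳ (c j))) ⟩
    0#                           ∎)

  inSpan-resp : ∀ {d m} {A : Fin m → Vec d} {f g : Vec d} → (∀ i → f i ≈ g i) → InSpan A f → InSpan A g
  inSpan-resp f≈g (c , f≈) = c , λ i → trans (sym (f≈g i)) (f≈ i)

  Σ-++ : ∀ {m n} (f : Fin (m ℕ.+ n) → Carrier) →
         Σ′ (m ℕ.+ n) f ≈ Σ′ m (λ i → f (i ↑ˡ n)) + Σ′ n (λ j → f (m ↑ʳ j))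
  Σ-++ {ℕ.zero} f = sym (+-identityˡ _)
  Σ-++ {suc m}  f = trans (+-congˡ (Σ-++ {m} (f ∘ fsuc))) (sym (+-assoc _ _ _))

  -- The Fredholm alternative for the transposed matrix: a separating vector would be a linear
  -- relation among the κ whose j-th coefficient is nonzero.
  dualFamily : ∀ {d m} (κ : Fin m → Vec d) → LinIndep κ →
               ∀ j → ∃[ η ] (∀ i → η ∙ κ i ≈ basis j i)
  dualFamily κ indep j with fredholm (λ k i → κ i k) (basis j)
  ... | inj₁ (η , e≈) = η , λ i → sym (e≈ i)
  ... | inj₂ (c , cκ≈0 , cj≉0) = contradiction
    (Σ-0 (λ i → trans (*-congʳ (indep c cκ≈0 i)) (zeroˡ (basis j i)))) cj≉0

  basis-sym : ∀ {d} (i j : Fin d) → basis i j ≈ basis j i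
  basis-sym fzero    fzero    = refl
  basis-sym fzero    (fsuc j) = refl
  basis-sym (fsuc i) fzero    = refl
  basis-sym (fsuc i) (fsuc j) = basis-sym i j

  lincomb-++ : ∀ {d m n} (c : Vec (m ℕ.+ n)) (A : Fin m → Vec d) (B : Fin n → Vec d) i →
               lincomb c (A ++ B) i ≈ lincomb (λ k → c (k ↑ˡ n)) A i + lincomb (λ j → c (m ↑ʳ j)) B i
  lincomb-++ {m = m} {n} c A B i = trans (Σ-++ {m} (λ k → c k * (A ++ B) k i)) (+-cong
    (Σ-cong (λ k → reflexive (≡.cong (λ v → c (k ↑ˡ n) * v i) (lookup-++ˡ A B k))))
    (Σ-cong (λ j → reflexive (≡.cong (λ v → c (m ↑ʳ j) * v i) (lookup-++ʳ A B j)))))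

  vanish-++ : ∀ {m n} (c : Vec (m ℕ.+ n)) → (∀ k → c (k ↑ˡ n) ≈ 0#) → (∀ j → c (m ↑ʳ j) ≈ 0#) →
              ∀ k → c k ≈ 0#
  vanish-++ {m} {n} c cˡ≈0 cʳ≈0 k with Fin.splitAt m k in eq
  ... | inj₁ i = ≡.subst (λ l → c l ≈ 0#) (Finₚ.splitAt⁻¹-↑ˡ {m} eq) (cˡ≈0 i)
  ... | inj₂ j = ≡.subst (λ l → c l ≈ 0#) (Finₚ.splitAt⁻¹-↑ʳ {m} eq) (cʳ≈0 j)

  dual-coefficients-vanish : ∀ {d m n} (κ η : Fin m → Vec d) (g : Fin n → Vec d) →
    (∀ j i → η j ∙ κ i ≈ basis j i) → (∀ k i → g k ∙ κ i ≈ 0#) →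
    (a : Vec n) (b : Vec m) → (∀ i → lincomb a g i + lincomb b η i ≈ 0#) → ∀ j → b j ≈ 0#
  dual-coefficients-vanish {d} {m} κ η g dual gκ≈0 a b vanishes j = begin
    b j                                               ≈⟨ basis-∙ j b ⟨
    basis j ∙ b                                       ≈⟨ ∙-comm (basis j) b ⟩
    b ∙ basis j                                       ≈⟨ ∙-congʳ (λ l → trans (basis-sym j l) (sym (dual l j))) ⟩
    b ∙ (λ l → η l ∙ κ j)                             ≈⟨ lincomb-∙ b η (κ j) ⟨
    lincomb b η ∙ κ j                                 ≈⟨ +-identityˡ _ ⟨
    0# + lincomb b η ∙ κ j                            ≈⟨ +-congʳ (Σ-0 (λ k → trans (*-congˡ (gκ≈0 k j)) (zeroʳ (a k)))) ⟨
    a ∙ (λ k → g k ∙ κ j) + lincomb b η ∙ κ j         ≈⟨ +-congʳ (lincomb-∙ a g (κ j)) ⟨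
    lincomb a g ∙ κ j + lincomb b η ∙ κ j             ≈⟨ Σ-+ (λ i → lincomb a g i * κ j i) (λ i → lincomb b η i * κ j i) ⟨
    Σ′ d (λ i → lincomb a g i * κ j i + lincomb b η i * κ j i) ≈⟨ Σ-cong (λ i → distribʳ (κ j i) (lincomb a g i) (lincomb b η i)) ⟨
    Σ′ d (λ i → (lincomb a g i + lincomb b η i) * κ j i)       ≈⟨ Σ-0 (λ i → trans (*-congʳ (vanishes i)) (zeroˡ (κ j i))) ⟩
    0#                                                ∎

  dependent-++ : ∀ {d m n} (κ η : Fin m → Vec d) (g : Fin n → Vec d) →
    (∀ j i → η j ∙ κ i ≈ basis j i) → (∀ k i → g k ∙ κ i ≈ 0#) →
    (∃[ c ] (¬ (∀ k → c k ≈ 0#) × (∀ i → lincomb c (g ++ η) i ≈ 0#))) →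
    ∃[ a ] (¬ (∀ k → a k ≈ 0#) × (∀ i → lincomb a g i ≈ 0#))
  dependent-++ {d} {m} {n} κ η g dual gκ≈0 (c , nontrivial , vanishes) =
    a , (λ a≈0 → nontrivial (vanish-++ {n} c a≈0 b≈0)) , λ i → begin
      lincomb a g i                    ≈⟨ +-identityʳ _ ⟨
      lincomb a g i + 0#               ≈⟨ +-congˡ (Σ-0 (λ j → trans (*-congʳ (b≈0 j)) (zeroˡ (η j i)))) ⟨
      lincomb a g i + lincomb b η i    ≈⟨ split i ⟩
      0#                               ∎
    where
    a : Vec n
    a k = c (k ↑ˡ m)

    b : Vec m
    b j = c (n ↑ʳ j)

    split : ∀ i → lincomb a g i + lincomb b η i ≈ 0#
    split i = trans (sym (lincomb-++ c g η i)) (vanishes i)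

    b≈0 : ∀ j → b j ≈ 0#
    b≈0 = dual-coefficients-vanish κ η g dual gκ≈0 a b split

  -- Bounds the dimension of the annihilator by n. The n + 1 annihilating functionals and the m dual
  -- ones are too many for dimension n + m, and evaluating a relation among them on κ shows that the
  -- dual ones do not occur in it.
  annihilators-dependent : ∀ {n m} (κ : Fin m → Vec (n ℕ.+ m)) → LinIndep κ →
    (g : Fin (suc n) → Vec (n ℕ.+ m)) → (∀ k i → g k ∙ κ i ≈ 0#) →
    ∃[ a ] (¬ (∀ k → a k ≈ 0#) × (∀ i → lincomb a g i ≈ 0#))
  annihilators-dependent κ indep g gκ≈0 =
    dependent-++ κ (λ j → proj₁ (dualFamily κ indep j)) g (λ j → proj₂ (dualFamily κ indep j)) gκ≈0
      (dependent (g ++ (λ j → proj₁ (dualFamily κ indep j))))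

  module Span {d r t n : ℕ} (K : Fin t → Fin n → Vec d) (κ : Fin r → Vec d) (indep : LinIndep κ) where

    InUnion : Vec r → Set
    InUnion c = ∃[ a ] InSpan (K a) (lincomb c κ)

    InUnion-resp : ∀ {c c′} → (∀ i → c i ≈ c′ i) → InUnion c → InUnion c′
    InUnion-resp c≈c′ (a , p) = a , inSpan-resp (lincomb-congˡ κ c≈c′) p

    Point : Vec r → Set
    Point c = ¬ (∀ i → lincomb c κ i ≈ 0#) × InUnion c

    point? : ∀ c → Dec (Point c)
    point? c = ¬? (Finₚ.all? (λ i → lincomb c κ i ≟ 0#)) ×-dec Finₚ.any? (λ a → inSpan? (K a) (lincomb c κ))

    points : List (Fin (q ^ℕ r))
    points = filter (λ k → point? (tuple {r} k)) (allFin _)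

    point : Fin (length points) → Vec r
    point j = tuple {r} (List.lookup points j)

    point-isPoint : ∀ j → Point (point j)
    point-isPoint j = proj₂ (∈-filter⁻ (λ k → point? (tuple {r} k)) {xs = allFin _} (∈-lookup j))

    Spanned : Vec d → Set
    Spanned u = ∃[ m ] ∃[ xs ] ((∀ j → ¬ (∀ i → xs j i ≈ 0#)) × (∀ j → InSpan κ (xs j)) ×
                                (∀ j → ∃[ a ] InSpan (K a) (xs j)) × InSpan {m = m} xs u)

    Obstruction : Vec r → Set
    Obstruction c₀ = ∃[ φ ] ((∀ c → InUnion c → φ ∙ c ≈ 0#) × ¬ (φ ∙ c₀ ≈ 0#))

    -- The Fredholm alternative for the finite list of all points of the union in κ. They are
    -- written in coordinates with respect to κ, so that the separating vector is a functional on κ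
    -- itself. The list omits the zero vector, which `kills` treats apart.
    spanned-or-obstructed : ∀ c → Spanned (lincomb c κ) ⊎ Obstruction c
    spanned-or-obstructed c with fredholm point c
    ... | inj₁ (e , c≈) = inj₁ (length points , (λ j → lincomb (point j) κ)
            , (λ j → proj₁ (point-isPoint j)) , (λ j → point j , λ i → refl) , (λ j → proj₂ (point-isPoint j))
            , e , λ i → trans (lincomb-congˡ κ c≈ i) (lincomb-lincomb e point κ i))
    ... | inj₂ (φ , φ-points , φc≉0) = inj₂ (φ , kills , φc≉0)
      where
      kills : ∀ c → InUnion c → φ ∙ c ≈ 0#
      kills c c∈∪ with Finₚ.all? (λ i → lincomb c κ i ≟ 0#)
      ... | yes c≈0 = Σ-0 (λ i → trans (*-congˡ (indep c c≈0 i)) (zeroʳ (φ i)))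
      ... | no  c≉0 = begin
          φ ∙ c                    ≈⟨ ∙-congʳ c≈tuple ⟩
          φ ∙ tuple {r} k          ≡⟨ ≡.cong (λ l → φ ∙ tuple {r} l) (lookup-index k∈points) ⟩
          φ ∙ point (position k∈points) ≈⟨ φ-points (position k∈points) ⟩
          0#                       ∎
        where
        k : Fin (q ^ℕ r)
        k = funToFin (index ∘ c)

        c≈tuple : ∀ i → c i ≈ tuple {r} k i
        c≈tuple i = trans (sym (element-index (c i)))
          (reflexive (≡.cong element (≡.sym (Finₚ.finToFun-funToFin (index ∘ c) i))))

        k∈points : k ∈ points
        k∈points = ∈-filter⁺ (λ k → point? (tuple {r} k)) (∈-allFin k)
          ((λ z → c≉0 (λ i → trans (lincomb-congˡ κ c≈tuple i) (z i))) , InUnion-resp c≈tuple c∈∪)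

-- Inverses in the cubic extension, the planes of the spread and the functionals that vanish on
-- them.

module CubicField (F : CommutativeRing 0ℓ 0ℓ) (isField : IsField F) {q : ℕ} (card : HasCard F q)
                  (N : CommutativeRing.Carrier F)
                  (irreducible : Irreducible F N) where
  open CommutativeRing F
  open IntegerSolver F
  open Lin F
  open FiniteField F isField card
  open FiniteFieldVectors F isField card
  open CubicExtension F N
  private
    module E where
      open CommutativeRing cubicExtension public
      open RingIdentities cubicExtension public
  open Relation.Binary.Reasoning.Setoid setoid

  E : Set
  E = Triple Carrier

  homogeneous-irreducible : ∀ x z → ¬ (z ≈ 0#) → ¬ (x * x * x ≈ x * x * z + N * (z * z * z))
  homogeneous-irreducible x z z≉0 eq with inverse z≉0
  ... | w , zw≈1 = irreducible (x * w) (begin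
    x * w * (x * w) * (x * w)
      ≈⟨ solve 2 (λ x w → x :* w :* (x :* w) :* (x :* w) := x :* x :* x :* (w :* w :* w)) refl x w ⟩
    x * x * x * (w * w * w)
      ≈⟨ *-congʳ eq ⟩
    (x * x * z + N * (z * z * z)) * (w * w * w)
      ≈⟨ solve 4 (λ n x z w → (x :* x :* z :+ n :* (z :* z :* z)) :* (w :* w :* w) :=
           x :* w :* (x :* w) :* (z :* w) :+ n :* (z :* w :* (z :* w) :* (z :* w))) refl N x z w ⟩
    x * w * (x * w) * (z * w) + N * (z * w * (z * w) * (z * w))
      ≈⟨ +-cong (*-congˡ zw≈1) (*-congˡ (*-cong (*-cong zw≈1 zw≈1) zw≈1)) ⟩
    x * w * (x * w) * 1# + N * (1# * 1# * 1#)
      ≈⟨ solve 3 (λ n x w → x :* w :* (x :* w) :* con (+ 1) :+ n :* (con (+ 1) :* con (+ 1) :* con (+ 1)) := x :* w :* (x :* w) :+ n) refl N x w ⟩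
    x * w * (x * w) + N ∎)

  Unit : E → Set
  Unit a = ∃[ b ] (a *ᴱ b ≈ᴱ 1ᴱ)

  unit-resp : ∀ {a b} → a ≈ᴱ b → Unit b → Unit a
  unit-resp a≈b (c , bc≈1) = c , E.trans (E.*-congʳ {c} a≈b) bc≈1

  unit-factor : ∀ a b → Unit (a *ᴱ b) → Unit a
  unit-factor a b (c , abc≈1) = b *ᴱ c , E.trans (E.sym (E.*-assoc a b c)) abc≈1

  scalar-* : ∀ x y → scalar x *ᴱ scalar y ≈ᴱ scalar (x * y)
  scalar-* x y = proveᴱ (N ∷ x ∷ y ∷ [])
    (TripleOps.mul _:+_ _:*_ (var (# 0)) ⟨ var (# 1) , con (+ 0) , con (+ 0) ⟩ ⟨ var (# 2) , con (+ 0) , con (+ 0) ⟩)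
    ⟨ var (# 1) :* var (# 2) , con (+ 0) , con (+ 0) ⟩ ≈ᴱ-refl

  scalar-*ˡ : ∀ k z → scalar k *ᴱ z ≈ᴱ ⟨ k * c₀ z , k * c₁ z , k * c₂ z ⟩
  scalar-*ˡ k z = proveᴱ (N ∷ k ∷ c₀ z ∷ c₁ z ∷ c₂ z ∷ [])
    (TripleOps.mul _:+_ _:*_ (var (# 0)) ⟨ var (# 1) , con (+ 0) , con (+ 0) ⟩ ⟨ var (# 2) , var (# 3) , var (# 4) ⟩)
    ⟨ var (# 1) :* var (# 2) , var (# 1) :* var (# 3) , var (# 1) :* var (# 4) ⟩ ≈ᴱ-refl

  scalar-unit : ∀ {x} → ¬ (x ≈ 0#) → Unit (scalar x)
  scalar-unit {x} x≉0 with inverse x≉0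
  ... | y , xy≈1 = scalar y , E.trans (scalar-* x y) (xy≈1 , refl , refl)

  -- For b ≠ 0, `norm` is the norm of a + b θ, that is - b³ times the value of x³ - x² - N at - a /
  -- b, and `cofactor` is the quotient of this norm by a + b θ.
  linear-unit : ∀ a b → ¬ (a ≈ 0# × b ≈ 0#) → Unit ⟨ a , b , 0# ⟩
  linear-unit a b ab≉0 with b ≟ 0#
  ... | yes b≈0 = unit-resp (refl , b≈0 , refl) (scalar-unit (λ a≈0 → ab≉0 (a≈0 , b≈0)))
  ... | no  b≉0 = unit-factor _ cofactor (unit-resp product (scalar-unit norm≉0))
    where
    cofactor : E
    cofactor = ⟨ a * a + a * b , - (a * b + b * b) , b * b ⟩

    norm : Carrier
    norm = a * a * a + a * a * b + N * (b * b * b)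

    product : ⟨ a , b , 0# ⟩ *ᴱ cofactor ≈ᴱ scalar norm
    product = proveᴱ (N ∷ a ∷ b ∷ [])
      (let n = var (# 0) ; a = var (# 1) ; b = var (# 2) in
       TripleOps.mul _:+_ _:*_ n ⟨ a , b , con (+ 0) ⟩ ⟨ a :* a :+ a :* b , :- (a :* b :+ b :* b) , b :* b ⟩)
      (let n = var (# 0) ; a = var (# 1) ; b = var (# 2) in
       ⟨ a :* a :* a :+ a :* a :* b :+ n :* (b :* b :* b) , con (+ 0) , con (+ 0) ⟩)
      ≈ᴱ-refl

    norm≉0 : ¬ (norm ≈ 0#)
    norm≉0 norm≈0 = homogeneous-irreducible (- a) b b≉0 (x-y≈0⇒x≈y (begin
      - a * - a * - a - (- a * - a * b + N * (b * b * b))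
        ≈⟨ solve 3 (λ n a b → :- a :* :- a :* :- a :- (:- a :* :- a :* b :+ n :* (b :* b :* b)) :=
             :- (a :* a :* a :+ a :* a :* b :+ n :* (b :* b :* b))) refl N a b ⟩
      - norm
        ≈⟨ trans (-‿cong norm≈0) -0#≈0# ⟩
      0# ∎))

  -- The cofactor is the linear polynomial that makes the θ²-coefficient of the product vanish.
  unit : ∀ x → ¬ (x ≈ᴱ 0ᴱ) → Unit x
  unit ⟨ a , b , c ⟩ x≉0 with c ≟ 0#
  ... | yes c≈0 = unit-resp (refl , refl , c≈0) (linear-unit a b (λ (a≈0 , b≈0) → x≉0 (a≈0 , b≈0 , c≈0)))
  ... | no  c≉0 = unit-factor _ ⟨ - (b + c) , c , 0# ⟩ (unit-resp product (linear-unit d e de≉0))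
    where
    d e : Carrier
    d = c * c * N - a * (b + c)
    e = a * c - b * (b + c)

    product : ⟨ a , b , c ⟩ *ᴱ ⟨ - (b + c) , c , 0# ⟩ ≈ᴱ ⟨ d , e , 0# ⟩
    product = proveᴱ (N ∷ a ∷ b ∷ c ∷ [])
      (let n = var (# 0) ; a = var (# 1) ; b = var (# 2) ; c = var (# 3) in
       TripleOps.mul _:+_ _:*_ n ⟨ a , b , c ⟩ ⟨ :- (b :+ c) , c , con (+ 0) ⟩)
      (let n = var (# 0) ; a = var (# 1) ; b = var (# 2) ; c = var (# 3) in
       ⟨ c :* c :* n :- a :* (b :+ c) , a :* c :- b :* (b :+ c) , con (+ 0) ⟩)
      ≈ᴱ-refl

    de≉0 : ¬ (d ≈ 0# × e ≈ 0#)
    de≉0 (d≈0 , e≈0) = homogeneous-irreducible (b + c) c c≉0 (x-y≈0⇒x≈y (begin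
      (b + c) * (b + c) * (b + c) - ((b + c) * (b + c) * c + N * (c * c * c))
        ≈⟨ solve 4 (λ n a b c →
             (b :+ c) :* (b :+ c) :* (b :+ c) :- ((b :+ c) :* (b :+ c) :* c :+ n :* (c :* c :* c)) :=
             :- (c :* (c :* c :* n :- a :* (b :+ c))) :- (b :+ c) :* (a :* c :- b :* (b :+ c))) refl N a b c ⟩
      - (c * d) - (b + c) * e
        ≈⟨ +-cong (-‿cong (*-congˡ d≈0)) (-‿cong (*-congˡ e≈0)) ⟩
      - (c * 0#) - (b + c) * 0#
        ≈⟨ solve 2 (λ b c → :- (c :* con (+ 0)) :- (b :+ c) :* con (+ 0) := con (+ 0)) refl b c ⟩
      0# ∎))

  unit-cancel : ∀ {x y} → Unit x → x *ᴱ y ≈ᴱ 0ᴱ → y ≈ᴱ 0ᴱ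
  unit-cancel {x} {y} (x⁻¹ , xx⁻¹≈1) xy≈0 =
    E.trans (E.sym (E.*-identityˡ y)) (E.trans (E.*-congʳ {y} (E.sym xx⁻¹≈1))
      (E.trans (E.*-congʳ {y} (E.*-comm x x⁻¹)) (E.trans (E.*-assoc x⁻¹ x y)
        (E.trans (E.*-congˡ {x⁻¹} xy≈0) (E.zeroʳ x⁻¹)))))

  -- The plane { (σ x , τ x) : x ∈ E } of E² = F⁶, where (σ , τ) is unimodular.
  record Slope : Set where
    constructor slope
    field
      σ τ μ ν    : E
      unimodular : σ *ᴱ μ +ᴱ τ *ᴱ ν ≈ᴱ 1ᴱ
  open Slope public

  power : Fin 3 → E
  power fzero               = 1ᴱ
  power (fsuc fzero)        = θ
  power (fsuc (fsuc fzero)) = θ²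

  pair : E → E → Vec 6
  pair a b fzero                                    = c₀ a
  pair a b (fsuc fzero)                             = c₁ a
  pair a b (fsuc (fsuc fzero))                      = c₂ a
  pair a b (fsuc (fsuc (fsuc fzero)))               = c₀ b
  pair a b (fsuc (fsuc (fsuc (fsuc fzero))))        = c₁ b
  pair a b (fsuc (fsuc (fsuc (fsuc (fsuc fzero))))) = c₂ b

  lower upper : Vec 6 → E
  lower u = ⟨ u (# 0) , u (# 1) , u (# 2) ⟩
  upper u = ⟨ u (# 3) , u (# 4) , u (# 5) ⟩

  triple : Vec 3 → E
  triple x = ⟨ x (# 0) , x (# 1) , x (# 2) ⟩

  pair-ext : ∀ {u v : Vec 6} → lower u ≈ᴱ lower v → upper u ≈ᴱ upper v → ∀ i → u i ≈ v i
  pair-ext (p₀ , p₁ , p₂) (p₃ , p₄ , p₅) fzero                                    = p₀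
  pair-ext (p₀ , p₁ , p₂) (p₃ , p₄ , p₅) (fsuc fzero)                             = p₁
  pair-ext (p₀ , p₁ , p₂) (p₃ , p₄ , p₅) (fsuc (fsuc fzero))                      = p₂
  pair-ext (p₀ , p₁ , p₂) (p₃ , p₄ , p₅) (fsuc (fsuc (fsuc fzero)))               = p₃
  pair-ext (p₀ , p₁ , p₂) (p₃ , p₄ , p₅) (fsuc (fsuc (fsuc (fsuc fzero))))        = p₄
  pair-ext (p₀ , p₁ , p₂) (p₃ , p₄ , p₅) (fsuc (fsuc (fsuc (fsuc (fsuc fzero))))) = p₅

  plane : Slope → Fin 3 → Vec 6
  plane P i = pair (σ P *ᴱ power i) (τ P *ᴱ power i)

  Σ-power : ∀ s x → ⟨ Σ′ 3 (λ j → x j * c₀ (s *ᴱ power j))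
                    , Σ′ 3 (λ j → x j * c₁ (s *ᴱ power j))
                    , Σ′ 3 (λ j → x j * c₂ (s *ᴱ power j)) ⟩ ≈ᴱ s *ᴱ triple x
  Σ-power ⟨ s₀ , s₁ , s₂ ⟩ x = proveᴱ (N ∷ s₀ ∷ s₁ ∷ s₂ ∷ x (# 0) ∷ x (# 1) ∷ x (# 2) ∷ [])
    ⟨ sum c₀ , sum c₁ , sum c₂ ⟩ (TripleOps.mul _:+_ _:*_ n s ⟨ x₀ , x₁ , x₂ ⟩) ≈ᴱ-refl
    where
    n  = var (# 0)
    s : Triple (Polynomial 7)
    s  = ⟨ var (# 1) , var (# 2) , var (# 3) ⟩
    x₀ = var (# 4)
    x₁ = var (# 5)
    x₂ = var (# 6)
    o i : Polynomial 7
    o = con (+ 0)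
    i = con (+ 1)
    _·_ = TripleOps.mul _:+_ _:*_ n
    sum : (Triple (Polynomial 7) → Polynomial 7) → Polynomial 7
    sum c = x₀ :* c (s · ⟨ i , o , o ⟩) :+ (x₁ :* c (s · ⟨ o , i , o ⟩) :+ (x₂ :* c (s · ⟨ o , o , i ⟩) :+ o))

  lincomb-plane : ∀ P x i → lincomb x (plane P) i ≈ pair (σ P *ᴱ triple x) (τ P *ᴱ triple x) i
  lincomb-plane P x = pair-ext (Σ-power (σ P) x) (Σ-power (τ P) x)

  unimodular-recover : ∀ P {x u v} → σ P *ᴱ x ≈ᴱ u → τ P *ᴱ x ≈ᴱ v → x ≈ᴱ μ P *ᴱ u +ᴱ ν P *ᴱ v
  unimodular-recover P {x} {u} {v} sx≈u tx≈v = E.trans (E.sym (E.*-identityˡ x))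
    (E.trans (E.*-congʳ {x} (E.sym (unimodular P)))
      (E.trans (E.recover-identity (σ P) (τ P) (μ P) (ν P) x)
        (E.+-cong (E.*-congˡ {μ P} sx≈u) (E.*-congˡ {ν P} tx≈v))))

  plane-indep : ∀ P → LinIndep (plane P)
  plane-indep P c c≈0 = coordinates (E.trans
    (unimodular-recover P {triple c} {0ᴱ} {0ᴱ} (zeroes (# 0) , zeroes (# 1) , zeroes (# 2)) (zeroes (# 3) , zeroes (# 4) , zeroes (# 5)))
    (E.trans (E.+-cong (E.zeroʳ (μ P)) (E.zeroʳ (ν P))) (E.+-identityʳ 0ᴱ)))
    where
    zeroes : ∀ i → pair (σ P *ᴱ triple c) (τ P *ᴱ triple c) i ≈ 0#
    zeroes i = trans (sym (lincomb-plane P c i)) (c≈0 i)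

    coordinates : triple c ≈ᴱ 0ᴱ → ∀ j → c j ≈ 0#
    coordinates (e₀ , e₁ , e₂) fzero               = e₀
    coordinates (e₀ , e₁ , e₂) (fsuc fzero)        = e₁
    coordinates (e₀ , e₁ , e₂) (fsuc (fsuc fzero)) = e₂

  -- The coordinates of the functional z ↦ c₂ (y z). Since c₂ takes the values 0, 0, 1, 1, 1 at 1,
  -- θ, θ², θ³, θ⁴, its matrix is a Hankel matrix that is triangular about the antidiagonal with
  -- ones on it, hence invertible over any F.
  dual : E → E
  dual y = ⟨ c₂ y , c₁ y + c₂ y , c₀ y + (c₁ y + c₂ y) ⟩

  dual-represents : ∀ y z → c₀ (dual y) * c₀ z + (c₁ (dual y) * c₁ z + (c₂ (dual y) * c₂ z + 0#)) ≈ c₂ (y *ᴱ z)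
  dual-represents ⟨ y₀ , y₁ , y₂ ⟩ ⟨ z₀ , z₁ , z₂ ⟩ =
    solve 7 (λ n y₀ y₁ y₂ z₀ z₁ z₂ →
      y₂ :* z₀ :+ ((y₁ :+ y₂) :* z₁ :+ ((y₀ :+ (y₁ :+ y₂)) :* z₂ :+ con (+ 0))) :=
      c₂ (TripleOps.mul _:+_ _:*_ n ⟨ y₀ , y₁ , y₂ ⟩ ⟨ z₀ , z₁ , z₂ ⟩)) refl N y₀ y₁ y₂ z₀ z₁ z₂

  dual-cong : ∀ {y z} → y ≈ᴱ z → dual y ≈ᴱ dual z
  dual-cong (e₀ , e₁ , e₂) = e₂ , +-cong e₁ e₂ , +-cong e₀ (+-cong e₁ e₂)

  dual-injective : ∀ {y} → dual y ≈ᴱ 0ᴱ → y ≈ᴱ 0ᴱ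
  dual-injective {⟨ y₀ , y₁ , y₂ ⟩} (d₀ , d₁ , d₂) = e₀ , e₁ , d₀
    where
    e₁ : y₁ ≈ 0#
    e₁ = trans (sym (+-identityʳ y₁)) (trans (+-congˡ (sym d₀)) d₁)
    e₀ : y₀ ≈ 0#
    e₀ = trans (sym (+-identityʳ y₀)) (trans (+-congˡ (sym d₁)) d₂)

  nondegenerate : ∀ {z} → (∀ i → c₂ (power i *ᴱ z) ≈ 0#) → z ≈ᴱ 0ᴱ
  nondegenerate {z} c₂≈0 = dual-injective
    ( trans (unfold 1ᴱ (solve 3 (λ z₀ z₁ z₂ → z₂ := o :* z₀ :+ ((o :+ o) :* z₁ :+ ((i :+ (o :+ o)) :* z₂ :+ o))) refl (c₀ z) (c₁ z) (c₂ z))) (c₂≈0 (# 0))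
    , trans (unfold θ (solve 3 (λ z₀ z₁ z₂ → z₁ :+ z₂ := o :* z₀ :+ ((i :+ o) :* z₁ :+ ((o :+ (i :+ o)) :* z₂ :+ o))) refl (c₀ z) (c₁ z) (c₂ z))) (c₂≈0 (# 1))
    , trans (unfold θ² (solve 3 (λ z₀ z₁ z₂ → z₀ :+ (z₁ :+ z₂) := i :* z₀ :+ ((o :+ i) :* z₁ :+ ((o :+ (o :+ i)) :* z₂ :+ o))) refl (c₀ z) (c₁ z) (c₂ z))) (c₂≈0 (# 2)) )
    where
    o i : ∀ {n} → Polynomial n
    o = con (+ 0)
    i = con (+ 1)
    unfold : ∀ y {x} → x ≈ c₀ (dual y) * c₀ z + (c₁ (dual y) * c₁ z + (c₂ (dual y) * c₂ z + 0#)) → x ≈ c₂ (y *ᴱ z)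
    unfold y x≈ = trans x≈ (dual-represents y z)

  -- The functional (u′ , u″) ↦ c₂ (b u″ - a u′). With this sign the arguments y τ, y σ give a
  -- functional that vanishes on all (σ x , τ x).
  annihilator : E → E → Vec 6
  annihilator a b = pair (-ᴱ dual a) (dual b)

  annihilator-∙ : ∀ a b u → annihilator a b ∙ u ≈ c₂ (b *ᴱ upper u +ᴱ (-ᴱ (a *ᴱ lower u)))
  annihilator-∙ a b u = begin
    annihilator a b ∙ u
      ≈⟨ solve 12 (λ a₀ a₁ a₂ b₀ b₁ b₂ u₀ u₁ u₂ u₃ u₄ u₅ →
           :- a₀ :* u₀ :+ (:- a₁ :* u₁ :+ (:- a₂ :* u₂ :+ (b₀ :* u₃ :+ (b₁ :* u₄ :+ (b₂ :* u₅ :+ con (+ 0)))))) :=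
           (b₀ :* u₃ :+ (b₁ :* u₄ :+ (b₂ :* u₅ :+ con (+ 0)))) :- (a₀ :* u₀ :+ (a₁ :* u₁ :+ (a₂ :* u₂ :+ con (+ 0)))))
           refl (c₀ (dual a)) (c₁ (dual a)) (c₂ (dual a)) (c₀ (dual b)) (c₁ (dual b)) (c₂ (dual b))
                (u (# 0)) (u (# 1)) (u (# 2)) (u (# 3)) (u (# 4)) (u (# 5)) ⟩
    (c₀ (dual b) * u (# 3) + (c₁ (dual b) * u (# 4) + (c₂ (dual b) * u (# 5) + 0#)))
      - (c₀ (dual a) * u (# 0) + (c₁ (dual a) * u (# 1) + (c₂ (dual a) * u (# 2) + 0#)))
      ≈⟨ +-cong (dual-represents b (upper u)) (-‿cong (dual-represents a (lower u))) ⟩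
    c₂ (b *ᴱ upper u) - c₂ (a *ᴱ lower u) ∎

  -- For every y, a functional on F⁶ that vanishes on the plane of slope P.
  conormal : Slope → E → Vec 6
  conormal P y = annihilator (y *ᴱ τ P) (y *ᴱ σ P)

  conormal-∙ : ∀ P y u → conormal P y ∙ u ≈ c₂ (y *ᴱ (σ P *ᴱ upper u +ᴱ (-ᴱ (τ P *ᴱ lower u))))
  conormal-∙ P y u = trans (annihilator-∙ (y *ᴱ τ P) (y *ᴱ σ P) u)
    (proj₂ (proj₂ (E.factor-difference y (σ P) (τ P) (lower u) (upper u))))

  -- By `nondegenerate` the three scalar conditions amount to σ u″ = τ u′ for the two halves of the
  -- vector, and the Bézout coefficients μ, ν then recover its parameter on the plane.
  conormals-vanish⇒inPlane : ∀ P u → (∀ i → conormal P (power i) ∙ u ≈ 0#) → InSpan (plane P) u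
  conormals-vanish⇒inPlane P u vanish = coordinates , λ i →
    trans (pair-ext {u} {pair (σ P *ᴱ x) (τ P *ᴱ x)}
            (recover (E.unimodular-lower (σ P) (τ P) (μ P) (ν P) (lower u) (upper u) σv≈τu))
            (recover (E.unimodular-upper (σ P) (τ P) (μ P) (ν P) (lower u) (upper u) σv≈τu)) i)
          (sym (lincomb-plane P coordinates i))
    where
    σv≈τu : σ P *ᴱ upper u ≈ᴱ τ P *ᴱ lower u
    σv≈τu = x-y≈0⇒x≈y e₀ , x-y≈0⇒x≈y e₁ , x-y≈0⇒x≈y e₂
      where
      difference : σ P *ᴱ upper u +ᴱ (-ᴱ (τ P *ᴱ lower u)) ≈ᴱ 0ᴱ
      difference = nondegenerate (λ i → trans (sym (conormal-∙ P (power i) u)) (vanish i))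
      e₀ = proj₁ difference
      e₁ = proj₁ (proj₂ difference)
      e₂ = proj₂ (proj₂ difference)

    x : E
    x = μ P *ᴱ lower u +ᴱ ν P *ᴱ upper u

    coordinates : Vec 3
    coordinates fzero               = c₀ x
    coordinates (fsuc fzero)        = c₁ x
    coordinates (fsuc (fsuc fzero)) = c₂ x

    recover : ∀ {z w} → (σ P *ᴱ μ P +ᴱ τ P *ᴱ ν P) *ᴱ z ≈ᴱ w → z ≈ᴱ w
    recover {z} eq = E.trans (E.sym (E.*-identityˡ z)) (E.trans (E.*-congʳ {z} (E.sym (unimodular P))) eq)

  Comb : Vec 3 → (Fin 3 → E) → E
  Comb c g = scalar (c (# 0)) *ᴱ g (# 0) +ᴱ (scalar (c (# 1)) *ᴱ g (# 1) +ᴱ scalar (c (# 2)) *ᴱ g (# 2))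

  Dependent : (g h : Fin 3 → E) → Set
  Dependent g h = ∃[ c ] (¬ (∀ k → c k ≈ 0#) × Comb c g ≈ᴱ 0ᴱ × Comb c h ≈ᴱ 0ᴱ)

  dual-Comb : ∀ c g → dual (Comb c g) ≈ᴱ ⟨ Σ′ 3 (λ k → c k * c₀ (dual (g k)))
                                         , Σ′ 3 (λ k → c k * c₁ (dual (g k)))
                                         , Σ′ 3 (λ k → c k * c₂ (dual (g k))) ⟩
  dual-Comb c g = E.trans (dual-cong (E.+-cong (scalar-*ˡ (c (# 0)) (g (# 0)))
      (E.+-cong (scalar-*ˡ (c (# 1)) (g (# 1))) (scalar-*ˡ (c (# 2)) (g (# 2))))))
    ( sum _ _ _
    , trans (add₂ _ _ _ _ _ _ _ _ _) (sum _ _ _)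
    , trans (add₃ _ _ _ _ _ _ _ _ _ _ _ _) (sum _ _ _))
    where
    sum : ∀ x y z → x + (y + z) ≈ x + (y + (z + 0#))
    sum x y z = +-congˡ (+-congˡ (sym (+-identityʳ z)))

    add₂ : ∀ a b c x y z x′ y′ z′ → (a * x + (b * y + c * z)) + (a * x′ + (b * y′ + c * z′)) ≈
                                      a * (x + x′) + (b * (y + y′) + c * (z + z′))
    add₂ = solve 9 (λ a b c x y z x′ y′ z′ → (a :* x :+ (b :* y :+ c :* z)) :+ (a :* x′ :+ (b :* y′ :+ c :* z′)) :=
                                      a :* (x :+ x′) :+ (b :* (y :+ y′) :+ c :* (z :+ z′))) refl

    add₃ : ∀ a b c x y z x′ y′ z′ x″ y″ z″ →
      (a * x + (b * y + c * z)) + ((a * x′ + (b * y′ + c * z′)) + (a * x″ + (b * y″ + c * z″))) ≈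
      a * (x + (x′ + x″)) + (b * (y + (y′ + y″)) + c * (z + (z′ + z″)))
    add₃ = solve 12 (λ a b c x y z x′ y′ z′ x″ y″ z″ →
      (a :* x :+ (b :* y :+ c :* z)) :+ ((a :* x′ :+ (b :* y′ :+ c :* z′)) :+ (a :* x″ :+ (b :* y″ :+ c :* z″))) :=
      a :* (x :+ (x′ :+ x″)) :+ (b :* (y :+ (y′ :+ y″)) :+ c :* (z :+ (z′ :+ z″)))) refl

  annihilators-Dependent : ∀ c g h → (∀ i → lincomb c (λ k → annihilator (g k) (h k)) i ≈ 0#) →
                           Comb c g ≈ᴱ 0ᴱ × Comb c h ≈ᴱ 0ᴱ
  annihilators-Dependent c g h vanish =
      dual-injective (E.trans (dual-Comb c g) (flip (vanish (# 0)) , flip (vanish (# 1)) , flip (vanish (# 2))))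
    , dual-injective (E.trans (dual-Comb c h) (vanish (# 3) , vanish (# 4) , vanish (# 5)))
    where
    flip : ∀ {a b c x y z} → a * - x + (b * - y + (c * - z + 0#)) ≈ 0# → a * x + (b * y + (c * z + 0#)) ≈ 0#
    flip {a} {b} {c} {x} {y} {z} eq = trans
      (solve 6 (λ a b c x y z → a :* x :+ (b :* y :+ (c :* z :+ con (+ 0))) :=
                             :- (a :* :- x :+ (b :* :- y :+ (c :* :- z :+ con (+ 0))))) refl a b c x y z)
      (trans (-‿cong eq) -0#≈0#)

  conormal-triple : ∀ P ψ u → conormal P (triple ψ) ∙ u ≈ Σ′ 3 (λ i → ψ i * (conormal P (power i) ∙ u))
  conormal-triple P ψ u = begin
    conormal P (triple ψ) ∙ u                        ≈⟨ conormal-∙ P (triple ψ) u ⟩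
    c₂ (triple ψ *ᴱ D)                               ≈⟨ proj₂ (proj₂ (E.*-comm (triple ψ) D)) ⟩
    c₂ (D *ᴱ triple ψ)                               ≈⟨ proj₂ (proj₂ (Σ-power D ψ)) ⟨
    Σ′ 3 (λ i → ψ i * c₂ (D *ᴱ power i))             ≈⟨ Σ-cong {3} (λ i → *-congˡ {ψ i} (trans
        (proj₂ (proj₂ (E.*-comm D (power i)))) (sym (conormal-∙ P (power i) u)))) ⟩
    Σ′ 3 (λ i → ψ i * (conormal P (power i) ∙ u))    ∎
    where
    D : E
    D = σ P *ᴱ upper u +ᴱ (-ᴱ (τ P *ᴱ lower u))

  conormal-0 : ∀ P {y} u → y ≈ᴱ 0ᴱ → conormal P y ∙ u ≈ 0#
  conormal-0 P u y≈0 = trans (conormal-∙ P _ u) (proj₂ (proj₂ (E.trans (E.*-congʳ {D} y≈0) (E.zeroˡ D))))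
    where
    D : E
    D = σ P *ᴱ upper u +ᴱ (-ᴱ (τ P *ᴱ lower u))

  conormal-difference : ∀ P Q y z u →
    annihilator (y *ᴱ τ P E.- z *ᴱ τ Q) (y *ᴱ σ P E.- z *ᴱ σ Q) ∙ u ≈ conormal P y ∙ u - conormal Q z ∙ u
  conormal-difference P Q y z u = begin
    annihilator (y *ᴱ τ P E.- z *ᴱ τ Q) (y *ᴱ σ P E.- z *ᴱ σ Q) ∙ u
      ≈⟨ annihilator-∙ (y *ᴱ τ P E.- z *ᴱ τ Q) (y *ᴱ σ P E.- z *ᴱ σ Q) u ⟩
    c₂ ((y *ᴱ σ P E.- z *ᴱ σ Q) *ᴱ upper u E.- (y *ᴱ τ P E.- z *ᴱ τ Q) *ᴱ lower u)
      ≈⟨ proj₂ (proj₂ (E.difference-bilinear (y *ᴱ σ P) (z *ᴱ σ Q) (y *ᴱ τ P) (z *ᴱ τ Q) (lower u) (upper u))) ⟩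
    c₂ (y *ᴱ σ P *ᴱ upper u E.- y *ᴱ τ P *ᴱ lower u) - c₂ (z *ᴱ σ Q *ᴱ upper u E.- z *ᴱ τ Q *ᴱ lower u)
      ≈⟨ +-cong (annihilator-∙ (y *ᴱ τ P) (y *ᴱ σ P) u) (-‿cong (annihilator-∙ (z *ᴱ τ Q) (z *ᴱ σ Q) u)) ⟨
    conormal P y ∙ u - conormal Q z ∙ u ∎

  -- The Fredholm alternative for the three basic conormals restricted to κ. A vector c separating φ
  -- from them would be a vector of κ on which all conormals of P vanish; it would lie in the plane,
  -- where φ is zero by assumption.
  conormal-extending : ∀ {r} P (κ : Fin r → Vec 6) (φ : Vec r) → (∀ c → InSpan (plane P) (lincomb c κ) → φ ∙ c ≈ 0#) →
                       ∃[ y ] (∀ j → conormal P y ∙ κ j ≈ φ j)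
  conormal-extending {r} P κ φ kills = conclude (fredholm rows φ)
    where
    rows : Fin 3 → Vec r
    rows i j = conormal P (power i) ∙ κ j

    conclude : InSpan rows φ ⊎ (∃[ c ] Separates c rows φ) → ∃[ y ] (∀ j → conormal P y ∙ κ j ≈ φ j)
    conclude (inj₁ (ψ , φ≈))               = triple ψ , λ j → trans (conormal-triple P ψ (κ j)) (sym (φ≈ j))
    conclude (inj₂ (c , c∙rows≈0 , cφ≉0)) = contradiction
      (trans (∙-comm c φ) (kills c (conormals-vanish⇒inPlane P (lincomb c κ)
        (λ i → trans (∙-lincomb (conormal P (power i)) c κ) (c∙rows≈0 i))))) cφ≉0

  -- The conormals that extend φ form a coset of the annihilator of κ, which has dimension 2.
  extensions-Dependent : (κ : Fin 4 → Vec 6) → LinIndep κ → ∀ (φ : Vec 4) {t} (P : Fin t → Slope) (y : Fin t → E) →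
    (∀ a j → conormal (P a) (y a) ∙ κ j ≈ φ j) → ∀ a (b : Fin 3 → Fin t) →
    Dependent (λ k → y (b k) *ᴱ τ (P (b k)) E.- y a *ᴱ τ (P a))
              (λ k → y (b k) *ᴱ σ (P (b k)) E.- y a *ᴱ σ (P a))
  extensions-Dependent κ indep φ P y extends a b =
    conclude g h (annihilators-dependent {2} κ indep (λ k → annihilator (g k) (h k)) vanish)
    where
    g h : Fin 3 → E
    g k = y (b k) *ᴱ τ (P (b k)) E.- y a *ᴱ τ (P a)
    h k = y (b k) *ᴱ σ (P (b k)) E.- y a *ᴱ σ (P a)

    vanish : ∀ k j → annihilator (g k) (h k) ∙ κ j ≈ 0#
    vanish k j = begin
      annihilator (g k) (h k) ∙ κ j
        ≈⟨ conormal-difference (P (b k)) (P a) (y (b k)) (y a) (κ j) ⟩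
      conormal (P (b k)) (y (b k)) ∙ κ j - conormal (P a) (y a) ∙ κ j
        ≈⟨ +-cong (extends (b k) j) (-‿cong (extends a j)) ⟩
      φ j - φ j
        ≈⟨ -‿inverseʳ (φ j) ⟩
      0# ∎

    conclude : ∀ g h → ∃[ c ] (¬ (∀ k → c k ≈ 0#) × (∀ i → lincomb c (λ k → annihilator (g k) (h k)) i ≈ 0#)) →
               Dependent g h
    conclude g h (c , nontrivial , vanish) = c , nontrivial , annihilators-Dependent c g h vanish

  -- All that is retained of κ and φ: nonzero multipliers such that any four of the vectors y (τ ,
  -- σ) are affinely dependent over F. The dependence is affine because the extensions of φ form a
  -- coset, not a subspace.
  Transversal : ∀ {t} → (Fin t → Slope) → Set
  Transversal {t} P = Σ[ y ∈ (Fin t → E) ] ((∀ a → ¬ (y a ≈ᴱ 0ᴱ)) ×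
    (∀ (a : Fin t) (b : Fin 3 → Fin t) →
      Dependent (λ k → y (b k) *ᴱ τ (P (b k)) E.- y a *ᴱ τ (P a))
                (λ k → y (b k) *ᴱ σ (P (b k)) E.- y a *ᴱ σ (P a))))

  extensions⇒transversal : ∀ {t} (P : Fin t → Slope) (κ : Fin 4 → Vec 6) → LinIndep κ → (φ : Vec 4) →
    ¬ (∀ j → φ j ≈ 0#) → (∀ a → ∃[ y ] (∀ j → conormal (P a) y ∙ κ j ≈ φ j)) → Transversal P
  extensions⇒transversal {t} P κ indep φ φ≉0 extension = y , y≉0 , extensions-Dependent κ indep φ P y extends
    where
    y : Fin t → E
    y a = proj₁ (extension a)

    extends : ∀ a j → conormal (P a) (y a) ∙ κ j ≈ φ j
    extends a = proj₂ (extension a)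

    y≉0 : ∀ a → ¬ (y a ≈ᴱ 0ᴱ)
    y≉0 a y≈0 = φ≉0 (λ j → begin
      φ j                          ≈⟨ extends a j ⟨
      conormal (P a) (y a) ∙ κ j   ≈⟨ conormal-0 (P a) {y a} (κ j) y≈0 ⟩
      0#                           ∎)

  obstruction⇒transversal : ∀ {t} (P : Fin t → Slope) (κ : Fin 4 → Vec 6) (indep : LinIndep κ) {c} →
    Span.Obstruction (λ a → plane (P a)) κ indep c → Transversal P
  obstruction⇒transversal P κ indep {c} (φ , kills , φc≉0) =
    extensions⇒transversal P κ indep φ
      (λ φ≈0 → φc≉0 (Σ-0 {f = λ j → φ j * c j} (λ j → trans (*-congʳ (φ≈0 j)) (zeroˡ (c j)))))
      (λ a → conormal-extending (P a) κ φ (λ c c∈K → kills c (a , c∈K)))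

  ¬transversal⇒higgledyPiggledy : ∀ {t} (P : Fin t → Slope) → ¬ Transversal P → HigglePiggle 5 2 (λ a → plane (P a))
  ¬transversal⇒higgledyPiggledy P ¬transversal κ indep u (c , u≈) =
    conclude (Span.spanned-or-obstructed (λ a → plane (P a)) κ indep c)
    where
    open Span (λ a → plane (P a)) κ indep using (Spanned; Obstruction)
    conclude : Spanned (lincomb c κ) ⊎ Obstruction c → Spanned u
    conclude (inj₁ (m , xs , xs≉0 , xs∈κ , xs∈K , e , eq)) = m , xs , xs≉0 , xs∈κ , xs∈K , e , λ i → trans (u≈ i) (eq i)
    conclude (inj₂ obstruction) = contradiction (obstruction⇒transversal P κ indep {c} obstruction) ¬transversal

-- The seven slopes, and the determinants that encode dependence of their conormals.

module SevenSlopes (F : CommutativeRing 0ℓ 0ℓ) (isField : IsField F) {q : ℕ} (card : HasCard F q)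
                   (N : CommutativeRing.Carrier F)
                  (irreducible : Irreducible F N) where
  open CommutativeRing F
  open IntegerSolver F
  open Lin F
  open FiniteField F isField card
  open FiniteFieldVectors F isField card
  open CubicExtension F N
  open CubicField F isField card N irreducible
  private
    module E where
      open CommutativeRing cubicExtension public
      open RingIdentities cubicExtension public
  open Relation.Binary.Reasoning.Setoid setoid

  ∞-slope 0-slope : Slope
  ∞-slope = slope 0ᴱ 1ᴱ 0ᴱ 1ᴱ (E.trans (E.+-cong (E.zeroˡ 0ᴱ) (E.*-identityˡ 1ᴱ)) (E.+-identityˡ 1ᴱ))
  0-slope = slope 1ᴱ 0ᴱ 1ᴱ 0ᴱ (E.trans (E.+-cong (E.*-identityˡ 1ᴱ) (E.zeroˡ 0ᴱ)) (E.+-identityʳ 1ᴱ))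

  finite-slope : ∀ k → ¬ (k ≈ 0#) → E → Slope
  finite-slope k k≉0 v = slope (scalar k) v (proj₁ (scalar-unit k≉0)) 0ᴱ
    (E.trans (E.+-cong (proj₂ (scalar-unit k≉0)) (E.zeroʳ v)) (E.+-identityʳ 1ᴱ))

  -- The first spanning vector of a plane is (σ , τ) itself. As a vector of the plane of `Q` it is
  -- (σ Q x , τ Q x) for some x, so the slopes agree.
  sameSpan⇒cross : ∀ P Q → SameSpan (plane P) (plane Q) → σ P *ᴱ τ Q ≈ᴱ τ P *ᴱ σ Q
  sameSpan⇒cross P Q (P⊆Q , _) = E.parallel⇒cross
      (E.trans (E.sym (E.*-identityʳ (σ P))) (eq (# 0) , eq (# 1) , eq (# 2)))
      (E.trans (E.sym (E.*-identityʳ (τ P))) (eq (# 3) , eq (# 4) , eq (# 5)))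
    where
    first∈Q : InSpan (plane Q) (plane P (# 0))
    first∈Q = P⊆Q (plane P (# 0)) (basis (# 0) , λ i → sym (basis-∙ (# 0) (λ j → plane P j i)))

    eq : ∀ i → plane P (# 0) i ≈ pair (σ Q *ᴱ triple (proj₁ first∈Q)) (τ Q *ᴱ triple (proj₁ first∈Q)) i
    eq i = trans (proj₂ first∈Q i) (lincomb-plane Q (proj₁ first∈Q) i)

  module Slopes (k : Fin 5 → Carrier) (k≉0 : ∀ i → ¬ (k i ≈ 0#)) (v : Fin 5 → E) (v≉0 : ∀ i → ¬ (v i ≈ᴱ 0ᴱ))
                (distinct : ∀ i j → i ≢ j → ¬ (scalar (k i) *ᴱ v j ≈ᴱ scalar (k j) *ᴱ v i)) where

    slopes : Fin 7 → Slope
    slopes fzero           = ∞-slope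
    slopes (fsuc fzero)    = 0-slope
    slopes (fsuc (fsuc i)) = finite-slope (k i) (k≉0 i) (v i)

    cross≉0 : ∀ a b → a ≢ b → ¬ (σ (slopes a) *ᴱ τ (slopes b) ≈ᴱ τ (slopes a) *ᴱ σ (slopes b))
    cross≉0 fzero fzero a≢b = contradiction ≡.refl a≢b
    cross≉0 fzero (fsuc fzero) _ eq = 0≉1 (proj₁ (E.trans (E.sym (E.zeroˡ 0ᴱ)) (E.trans eq (E.*-identityˡ 1ᴱ))))
    cross≉0 fzero (fsuc (fsuc j)) _ eq = k≉0 j (proj₁ (E.sym (E.trans (E.sym (E.zeroˡ (v j))) (E.trans eq (E.*-identityˡ (scalar (k j)))))))
    cross≉0 (fsuc fzero) fzero _ eq = 0≉1 (proj₁ (E.trans (E.sym (E.zeroˡ 0ᴱ)) (E.trans (E.sym eq) (E.*-identityˡ 1ᴱ))))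
    cross≉0 (fsuc fzero) (fsuc fzero) a≢b = contradiction ≡.refl a≢b
    cross≉0 (fsuc fzero) (fsuc (fsuc j)) _ eq = v≉0 j (E.trans (E.sym (E.*-identityˡ (v j))) (E.trans eq (E.zeroˡ (scalar (k j)))))
    cross≉0 (fsuc (fsuc i)) fzero _ eq = k≉0 i (proj₁ (E.trans (E.sym (E.*-identityʳ (scalar (k i)))) (E.trans eq (E.zeroʳ (v i)))))
    cross≉0 (fsuc (fsuc i)) (fsuc fzero) _ eq = v≉0 i (E.sym (E.trans (E.sym (E.zeroʳ (scalar (k i)))) (E.trans eq (E.*-identityʳ (v i)))))
    cross≉0 (fsuc (fsuc i)) (fsuc (fsuc j)) a≢b eq = distinct i j (λ { ≡.refl → a≢b ≡.refl })
      (E.trans eq (E.*-comm (v i) (scalar (k j))))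

    ¬transversal⇒theorem : ¬ Transversal slopes → SevenPlanes F
    ¬transversal⇒theorem ¬transversal = (λ a → plane (slopes a)) , (λ a → plane-indep (slopes a))
      , (λ a b a≢b same → cross≉0 a b a≢b (sameSpan⇒cross (slopes a) (slopes b) same))
      , ¬transversal⇒higgledyPiggledy slopes ¬transversal

  -- [ x , y ] is the determinant of 1, x, y.
  [_,_] : E → E → Carrier
  [ x , y ] = c₁ x * c₂ y - c₂ x * c₁ y

  bracket-cong : ∀ {x x′ y y′} → x ≈ᴱ x′ → y ≈ᴱ y′ → [ x , y ] ≈ [ x′ , y′ ]
  bracket-cong (_ , x₁ , x₂) (_ , y₁ , y₂) = +-cong (*-cong x₁ y₂) (-‿cong (*-cong x₂ y₁))

  -- The coordinates of Norm(v) / v are `e₁` + `eₘ`, - (`eₘ` + `e₂`) and `e₂`, so the combinations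
  -- of these three forms are exactly the functionals composed with v ↦ Norm(v) / v. At s = 0 they
  -- become p², p r and r²; hence such a combination is determined by its restriction to ⟨ 1 , θ ⟩.
  e₁ eₘ e₂ : E → Carrier
  e₁ ⟨ p , r , s ⟩ = p * p - N * (r * s)
  eₘ ⟨ p , r , s ⟩ = p * r + p * s - N * (s * s)
  e₂ ⟨ p , r , s ⟩ = r * r - p * s + r * s

  -- Multiplication by v has determinant Norm(v), so det (1 , v x , v y) = det (Norm(v) / v , x ,
  -- y), a functional of Norm(v) / v. Its coefficients can be read off at v = p + r θ, where the
  -- bracket expands bilinearly.
  bracket-quadratic : ∀ v x y → [ v *ᴱ x , v *ᴱ y ] ≈
    [ x , y ] * e₁ v + ([ x , θ *ᴱ y ] + [ θ *ᴱ x , y ]) * eₘ v + [ θ *ᴱ x , θ *ᴱ y ] * e₂ v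
  bracket-quadratic ⟨ p , r , s ⟩ ⟨ x₀ , x₁ , x₂ ⟩ ⟨ y₀ , y₁ , y₂ ⟩ =
    solve 10 (λ n p r s x₀ x₁ x₂ y₀ y₁ y₂ →
      let infixl 7 _·_
          _·_ = TripleOps.mul _:+_ _:*_ n
          [_,,_] = λ a b → c₁ a :* c₂ b :- c₂ a :* c₁ b
          v = ⟨ p , r , s ⟩
          x = ⟨ x₀ , x₁ , x₂ ⟩
          y = ⟨ y₀ , y₁ , y₂ ⟩
          t = ⟨ con (+ 0) , con (+ 1) , con (+ 0) ⟩
      in [ v · x ,, v · y ] :=
         [ x ,, y ] :* (p :* p :- n :* (r :* s)) :+ ([ x ,, t · y ] :+ [ t · x ,, y ]) :* (p :* r :+ p :* s :- n :* (s :* s))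
           :+ [ t · x ,, t · y ] :* (r :* r :- p :* s :+ r :* s))
      refl N p r s x₀ x₁ x₂ y₀ y₁ y₂

  bracket-linearˡ : ∀ v x y → [ v *ᴱ x , y ] ≈
    c₀ v * [ x , y ] + c₁ v * [ θ *ᴱ x , y ] + c₂ v * [ θ² *ᴱ x , y ]
  bracket-linearˡ ⟨ p , r , s ⟩ ⟨ x₀ , x₁ , x₂ ⟩ y =
    solve 9 (λ n p r s x₀ x₁ x₂ y₁ y₂ →
      let infixl 7 _·_
          _·_ = TripleOps.mul _:+_ _:*_ n
          [_,,_] = λ a b → c₁ a :* y₂ :- c₂ a :* y₁
          x = ⟨ x₀ , x₁ , x₂ ⟩
          t = ⟨ con (+ 0) , con (+ 1) , con (+ 0) ⟩
          t² = ⟨ con (+ 0) , con (+ 0) , con (+ 1) ⟩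
      in [ ⟨ p , r , s ⟩ · x ,, t ] := p :* [ x ,, t ] :+ r :* [ t · x ,, t ] :+ s :* [ t² · x ,, t ])
      refl N p r s x₀ x₁ x₂ (c₁ y) (c₂ y)

  bracket-differenceʳ : ∀ x k y l z → [ x , scalar k *ᴱ y E.- scalar l *ᴱ z ] ≈ k * [ x , y ] - l * [ x , z ]
  bracket-differenceʳ x k y l z = begin
    [ x , scalar k *ᴱ y E.- scalar l *ᴱ z ]
      ≈⟨ bracket-cong {x} E.refl (E.+-cong (scalar-*ˡ k y) (E.-‿cong (scalar-*ˡ l z))) ⟩
    c₁ x * (k * c₂ y - l * c₂ z) - c₂ x * (k * c₁ y - l * c₁ z)
      ≈⟨ solve 8 (λ x₁ x₂ k y₁ y₂ l z₁ z₂ → x₁ :* (k :* y₂ :- l :* z₂) :- x₂ :* (k :* y₁ :- l :* z₁) :=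
           k :* (x₁ :* y₂ :- x₂ :* y₁) :- l :* (x₁ :* z₂ :- x₂ :* z₁)) refl (c₁ x) (c₂ x) k (c₁ y) (c₂ y) l (c₁ z) (c₂ z) ⟩
    k * [ x , y ] - l * [ x , z ] ∎

  bracket≈0 : ∀ {a b c A B} → scalar a *ᴱ A +ᴱ scalar b *ᴱ B +ᴱ scalar c ≈ᴱ 0ᴱ → ¬ (a ≈ 0# × b ≈ 0#) → [ A , B ] ≈ 0#
  bracket≈0 {a} {b} {c} {A} {B} eq ab≉0 = stable (λ AB≉0 → ab≉0 (a≈0 AB≉0 , b≈0 AB≉0))
    where
    expanded : ⟨ a * c₀ A + b * c₀ B + c , a * c₁ A + b * c₁ B + 0# , a * c₂ A + b * c₂ B + 0# ⟩ ≈ᴱ 0ᴱ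
    expanded = E.trans (E.sym (E.+-congʳ (E.+-cong (scalar-*ˡ a A) (scalar-*ˡ b B)))) eq

    eq₁ : a * c₁ A + b * c₁ B ≈ 0#
    eq₁ = trans (sym (+-identityʳ _)) (proj₁ (proj₂ expanded))

    eq₂ : a * c₂ A + b * c₂ B ≈ 0#
    eq₂ = trans (sym (+-identityʳ _)) (proj₂ (proj₂ expanded))

    a≈0 : ¬ ([ A , B ] ≈ 0#) → a ≈ 0#
    a≈0 AB≉0 = x≉0∧x*y≈0⇒y≈0 AB≉0 (begin
      [ A , B ] * a
        ≈⟨ solve 6 (λ a b A₁ A₂ B₁ B₂ → (A₁ :* B₂ :- A₂ :* B₁) :* a :=
             B₂ :* (a :* A₁ :+ b :* B₁) :- B₁ :* (a :* A₂ :+ b :* B₂)) refl a b (c₁ A) (c₂ A) (c₁ B) (c₂ B) ⟩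
      c₂ B * (a * c₁ A + b * c₁ B) - c₁ B * (a * c₂ A + b * c₂ B)
        ≈⟨ +-cong (*-congˡ eq₁) (-‿cong (*-congˡ eq₂)) ⟩
      c₂ B * 0# - c₁ B * 0#
        ≈⟨ solve 2 (λ x y → x :* con (+ 0) :- y :* con (+ 0) := con (+ 0)) refl (c₂ B) (c₁ B) ⟩
      0# ∎)

    b≈0 : ¬ ([ A , B ] ≈ 0#) → b ≈ 0#
    b≈0 AB≉0 = x≉0∧x*y≈0⇒y≈0 AB≉0 (begin
      [ A , B ] * b
        ≈⟨ solve 6 (λ a b A₁ A₂ B₁ B₂ → (A₁ :* B₂ :- A₂ :* B₁) :* b :=
             A₁ :* (a :* A₂ :+ b :* B₂) :- A₂ :* (a :* A₁ :+ b :* B₁)) refl a b (c₁ A) (c₂ A) (c₁ B) (c₂ B) ⟩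
      c₁ A * (a * c₂ A + b * c₂ B) - c₂ A * (a * c₁ A + b * c₁ B)
        ≈⟨ +-cong (*-congˡ eq₂) (-‿cong (*-congˡ eq₁)) ⟩
      c₁ A * 0# - c₂ A * 0#
        ≈⟨ solve 2 (λ x y → x :* con (+ 0) :- y :* con (+ 0) := con (+ 0)) refl (c₁ A) (c₂ A) ⟩
      0# ∎)

  module _ {w x y₁ y₂ v₁ v₂ : E} {k₁ k₂ : Carrier} (k₂≉0 : ¬ (k₂ ≈ 0#)) where
    private
      f g : Fin 3 → E
      f fzero               = x *ᴱ 0ᴱ E.- w *ᴱ 1ᴱ
      f (fsuc fzero)        = y₁ *ᴱ v₁ E.- w *ᴱ 1ᴱ
      f (fsuc (fsuc fzero)) = y₂ *ᴱ v₂ E.- w *ᴱ 1ᴱ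
      g fzero               = x *ᴱ 1ᴱ E.- w *ᴱ 0ᴱ
      g (fsuc fzero)        = y₁ *ᴱ scalar k₁ E.- w *ᴱ 0ᴱ
      g (fsuc (fsuc fzero)) = y₂ *ᴱ scalar k₂ E.- w *ᴱ 0ᴱ

    -- After division by w, eliminating y₂ leaves an F-linear relation between 1, v₂ X and k₁ v₂ Y -
    -- k₂ v₁ Y, where X = x W and Y = y₁ W. The coefficients of the last two are not both zero, as
    -- otherwise the constant term c₂ k₂, and with it the whole relation, would vanish. Hence the
    -- determinant of the three elements is zero.
    Dependent⇒bracket : ∀ {W} → w *ᴱ W ≈ᴱ 1ᴱ → Dependent f g →
      k₁ * [ v₂ *ᴱ (x *ᴱ W) , v₂ *ᴱ (y₁ *ᴱ W) ] ≈ k₂ * [ v₂ *ᴱ (x *ᴱ W) , v₁ *ᴱ (y₁ *ᴱ W) ]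
    Dependent⇒bracket {W} wW≈1 (c , nontrivial , f≈0 , g≈0) = x-y≈0⇒x≈y
      (trans (sym (bracket-differenceʳ (v₂ *ᴱ (x *ᴱ W)) k₁ (v₂ *ᴱ (y₁ *ᴱ W)) k₂ (v₁ *ᴱ (y₁ *ᴱ W))))
        (bracket≈0 {c (# 0)} {c (# 1)} {(c (# 0) + c (# 1) + c (# 2)) * k₂} relation c≉0))
      where
      A B : E
      A = v₂ *ᴱ (x *ᴱ W)
      B = scalar k₁ *ᴱ (v₂ *ᴱ (y₁ *ᴱ W)) E.- scalar k₂ *ᴱ (v₁ *ᴱ (y₁ *ᴱ W))

      sum-scalar : (scalar (c (# 0)) +ᴱ scalar (c (# 1)) +ᴱ scalar (c (# 2))) *ᴱ scalar k₂ ≈ᴱ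
                   scalar ((c (# 0) + c (# 1) + c (# 2)) * k₂)
      sum-scalar = E.trans (E.*-congʳ {scalar k₂} {scalar (c (# 0)) +ᴱ scalar (c (# 1)) +ᴱ scalar (c (# 2))} {scalar (c (# 0) + c (# 1) + c (# 2))} (refl , 0+0+0≈0 , 0+0+0≈0))
        (scalar-* (c (# 0) + c (# 1) + c (# 2)) k₂)
        where
        0+0+0≈0 : 0# + 0# + 0# ≈ 0#
        0+0+0≈0 = trans (+-identityʳ _) (+-identityʳ _)

      relation : scalar (c (# 0)) *ᴱ A +ᴱ scalar (c (# 1)) *ᴱ B +ᴱ scalar ((c (# 0) + c (# 1) + c (# 2)) * k₂) ≈ᴱ 0ᴱ
      relation = E.trans (E.+-congˡ {scalar (c (# 0)) *ᴱ A +ᴱ scalar (c (# 1)) *ᴱ B} (E.sym sum-scalar))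
        (E.eliminate (scalar (c (# 0))) (scalar (c (# 1))) (scalar (c (# 2))) x w y₁ y₂ v₁ v₂ (scalar k₁) (scalar k₂) W wW≈1 f≈0 g≈0)

      c≉0 : ¬ (c (# 0) ≈ 0# × c (# 1) ≈ 0#)
      c≉0 (c₀≈0 , c₁≈0) = nontrivial (λ { fzero → c₀≈0 ; (fsuc fzero) → c₁≈0 ; (fsuc (fsuc fzero)) → c₂≈0 })
        where
        c₂k₂≈0 : (c (# 0) + c (# 1) + c (# 2)) * k₂ ≈ 0#
        c₂k₂≈0 = trans (sym (trans (+-congʳ (trans (+-cong (*-congʳ c₀≈0) (*-congʳ c₁≈0))
            (solve 2 (λ a b → con (+ 0) :* a :+ con (+ 0) :* b := con (+ 0)) refl (c₀ A) (c₀ B)))) (+-identityˡ _)))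
          (proj₁ (E.trans (E.sym (E.+-congʳ {scalar ((c (# 0) + c (# 1) + c (# 2)) * k₂)} (E.+-cong (scalar-*ˡ (c (# 0)) A) (scalar-*ˡ (c (# 1)) B)))) relation))

        c₂≈0 : c (# 2) ≈ 0#
        c₂≈0 = trans (sym (+-identityˡ _)) (trans (+-congʳ (sym (trans (+-cong c₀≈0 c₁≈0) (+-identityˡ 0#))))
          (x≉0∧x*y≈0⇒y≈0 k₂≉0 (trans (*-comm _ _) c₂k₂≈0)))

  -- Five points v with θ²-coefficient 1, and why seven planes built on them have no transversal.

  module Configuration (p r : Fin 5 → Carrier) (B₁ Bₘ B₂ : Carrier) where
    v : Fin 5 → E
    v i = ⟨ p i , r i , 1# ⟩

    Q : Fin 5 → Carrier
    Q i = B₁ * e₁ (v i) + Bₘ * eₘ (v i) + B₂ * e₂ (v i)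

    module _ (Q≉0 : ∀ i → ¬ (Q i ≈ 0#))
             (distinct : ∀ i j → i ≢ j → ¬ (p i ≈ p j × r i ≈ r j))
             (anisotropic : ∀ x y → B₁ * (x * x) + Bₘ * (x * y) + B₂ * (y * y) ≈ 0# → x ≈ 0# × y ≈ 0#)
             -- The unknown linear form is p g₁ + r g₂ + s g₀, taken at s = 1. The multiples of (c₂
             -- , Q) always solve the system, so this asks for the smallest possible solution space.
             (unique : ∀ {b₁ bₘ b₂ g₀ g₁ g₂} →
               (∀ j → Q j * (p j * g₁ + r j * g₂ + g₀) ≈ b₁ * e₁ (v j) + bₘ * eₘ (v j) + b₂ * e₂ (v j)) →
               g₁ ≈ 0# × g₂ ≈ 0# × b₁ ≈ g₀ * B₁ × bₘ ≈ g₀ * Bₘ × b₂ ≈ g₀ * B₂) where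

      k : Fin 5 → Carrier
      k i = - Q i

      k≉0 : ∀ i → ¬ (k i ≈ 0#)
      k≉0 i = Q≉0 i ∘ -x≈0⇒x≈0

      v≉0 : ∀ i → ¬ (v i ≈ᴱ 0ᴱ)
      v≉0 i (_ , _ , 1≈0) = 1≉0 1≈0

      cross : ∀ i j → i ≢ j → ¬ (scalar (k i) *ᴱ v j ≈ᴱ scalar (k j) *ᴱ v i)
      cross i j i≢j eq = distinct i j i≢j
          ( *-cancelˡ-≉0 (k≉0 i) (sym (trans (proj₁ coordinates) (*-congʳ (sym ki≈kj))))
          , *-cancelˡ-≉0 (k≉0 i) (sym (trans (proj₁ (proj₂ coordinates)) (*-congʳ (sym ki≈kj)))))
        where
        coordinates : k i * p j ≈ k j * p i × k i * r j ≈ k j * r i × k i * 1# ≈ k j * 1#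
        coordinates = E.trans (E.sym (scalar-*ˡ (k i) (v j))) (E.trans eq (scalar-*ˡ (k j) (v i)))

        ki≈kj : k i ≈ k j
        ki≈kj = trans (sym (*-identityʳ (k i))) (trans (proj₂ (proj₂ coordinates)) (*-identityʳ (k j)))

      open Slopes k k≉0 v v≉0 cross

      -- In E* the seven conormals are w (1 , 0), x (0 , 1) and yᵢ (vᵢ , kᵢ), and X = x / w, Y = yᵢ / w.
      module Subline (X u : E) (uX≈1 : u *ᴱ X ≈ᴱ 1ᴱ) where

        u-unit : Unit u
        u-unit = X , uX≈1

        -- The subline { (a , b X) : a , b ∈ F } forces vᵢ ∈ F u.
        proportional : ∀ i (Y : E) → ¬ (Y ≈ᴱ 0ᴱ) →
          (∀ j → Q i * [ v j *ᴱ X , v j *ᴱ Y ] ≈ Q j * [ v j *ᴱ X , v i *ᴱ Y ]) →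
          ¬ (c₂ u ≈ 0#) × c₂ u * p i ≈ c₀ u × c₂ u * r i ≈ c₁ u
        proportional i Y Y≉0 brackets = u₂≉0 , p-eq , r-eq
          where
          A Z : E
          A = v i *ᴱ Y
          Z = u *ᴱ Y

          g₀ g₁ g₂ b₁ bₘ b₂ : Carrier
          g₀ = [ θ² *ᴱ X , A ]
          g₁ = [ X , A ]
          g₂ = [ θ *ᴱ X , A ]
          b₁ = [ X , Y ]
          bₘ = [ X , θ *ᴱ Y ] + [ θ *ᴱ X , Y ]
          b₂ = [ θ *ᴱ X , θ *ᴱ Y ]

          -- With i fixed, `brackets` equates a combination of `e₁`, `eₘ`, `e₂` at v j with Q j
          -- times a linear form in v j; the unknowns of `unique` are their coefficients.
          solution : g₁ ≈ 0# × g₂ ≈ 0# × Q i * b₁ ≈ g₀ * B₁ × Q i * bₘ ≈ g₀ * Bₘ × Q i * b₂ ≈ g₀ * B₂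
          solution = unique (λ j → begin
            Q j * (p j * g₁ + r j * g₂ + g₀)
              ≈⟨ *-congˡ (+-congˡ (*-identityˡ g₀)) ⟨
            Q j * (p j * g₁ + r j * g₂ + 1# * g₀)
              ≈⟨ *-congˡ (bracket-linearˡ (v j) X A) ⟨
            Q j * [ v j *ᴱ X , A ]
              ≈⟨ brackets j ⟨
            Q i * [ v j *ᴱ X , v j *ᴱ Y ]
              ≈⟨ *-congˡ (bracket-quadratic (v j) X Y) ⟩
            Q i * (b₁ * e₁ (v j) + bₘ * eₘ (v j) + b₂ * e₂ (v j))
              ≈⟨ distribute (Q i) b₁ (e₁ (v j)) bₘ (eₘ (v j)) b₂ (e₂ (v j)) ⟩
            Q i * b₁ * e₁ (v j) + Q i * bₘ * eₘ (v j) + Q i * b₂ * e₂ (v j) ∎)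

            where
            distribute : ∀ q a x b y c z → q * (a * x + b * y + c * z) ≈ q * a * x + q * b * y + q * c * z
            distribute = solve 7 (λ q a x b y c z →
              q :* (a :* x :+ b :* y :+ c :* z) := q :* a :* x :+ q :* b :* y :+ q :* c :* z) refl

          g₁≈0 = proj₁ solution
          g₂≈0 = proj₁ (proj₂ solution)
          Qb₁≈ = proj₁ (proj₂ (proj₂ solution))
          Qbₘ≈ = proj₁ (proj₂ (proj₂ (proj₂ solution)))
          Qb₂≈ = proj₂ (proj₂ (proj₂ (proj₂ solution)))

          linear : ∀ z → [ z *ᴱ X , A ] ≈ c₂ z * g₀
          linear z = begin
            [ z *ᴱ X , A ]                                ≈⟨ bracket-linearˡ z X A ⟩
            c₀ z * g₁ + c₁ z * g₂ + c₂ z * g₀             ≈⟨ +-congʳ (+-cong (*-congˡ g₁≈0) (*-congˡ g₂≈0)) ⟩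
            c₀ z * 0# + c₁ z * 0# + c₂ z * g₀             ≈⟨ solve 4 (λ a b c g → a :* con (+ 0) :+ b :* con (+ 0) :+ c :* g := c :* g) refl (c₀ z) (c₁ z) (c₂ z) g₀ ⟩
            c₂ z * g₀                                     ∎

          quadratic : ∀ z → Q i * [ z *ᴱ X , z *ᴱ Y ] ≈ g₀ * (B₁ * e₁ z + Bₘ * eₘ z + B₂ * e₂ z)
          quadratic z = begin
            Q i * [ z *ᴱ X , z *ᴱ Y ]
              ≈⟨ *-congˡ (bracket-quadratic z X Y) ⟩
            Q i * (b₁ * e₁ z + bₘ * eₘ z + b₂ * e₂ z)
              ≈⟨ solve 7 (λ q a x b y c z → q :* (a :* x :+ b :* y :+ c :* z) := q :* a :* x :+ q :* b :* y :+ q :* c :* z)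
                   refl (Q i) b₁ (e₁ z) bₘ (eₘ z) b₂ (e₂ z) ⟩
            Q i * b₁ * e₁ z + Q i * bₘ * eₘ z + Q i * b₂ * e₂ z
              ≈⟨ +-cong (+-cong (*-congʳ Qb₁≈) (*-congʳ Qbₘ≈)) (*-congʳ Qb₂≈) ⟩
            g₀ * B₁ * e₁ z + g₀ * Bₘ * eₘ z + g₀ * B₂ * e₂ z
              ≈⟨ solve 7 (λ q a x b y c z → q :* a :* x :+ q :* b :* y :+ q :* c :* z := q :* (a :* x :+ b :* y :+ c :* z))
                   refl g₀ B₁ (e₁ z) Bₘ (eₘ z) B₂ (e₂ z) ⟩
            g₀ * (B₁ * e₁ z + Bₘ * eₘ z + B₂ * e₂ z) ∎

          bracket-1 : ∀ z → [ 1ᴱ , z ] ≈ 0#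
          bracket-1 z = solve 2 (λ a b → con (+ 0) :* a :- con (+ 0) :* b := con (+ 0)) refl (c₂ z) (c₁ z)

          -- Both forms are evaluated at z = u, where z X = 1 and brackets with 1 vanish. If g₀ were
          -- nonzero, u would lie in ⟨ 1 , θ ⟩ and be a zero of the anisotropic form there, hence
          -- zero.
          g₀≈0 : g₀ ≈ 0#
          g₀≈0 = stable λ g₀≉0 →
            let u₂≈0 : c₂ u ≈ 0#
                u₂≈0 = x≉0∧x*y≈0⇒y≈0 g₀≉0 (trans (*-comm g₀ (c₂ u)) (trans (sym (linear u))
                  (trans (bracket-cong {y = A} uX≈1 E.refl) (bracket-1 A))))
                form≈0 : B₁ * e₁ u + Bₘ * eₘ u + B₂ * e₂ u ≈ 0#
                form≈0 = x≉0∧x*y≈0⇒y≈0 g₀≉0 (trans (sym (quadratic u))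
                  (trans (*-congˡ (trans (bracket-cong {y = Z} uX≈1 E.refl) (bracket-1 Z))) (zeroʳ (Q i))))
                u₀₁≈0 : c₀ u ≈ 0# × c₁ u ≈ 0#
                u₀₁≈0 = anisotropic (c₀ u) (c₁ u) (trans (restrict u₂≈0) form≈0)
            in 0≉1 (proj₁ (E.trans (E.sym (E.zeroˡ X)) (E.trans
                 (E.*-congʳ {X} (sym (proj₁ u₀₁≈0) , sym (proj₂ u₀₁≈0) , sym u₂≈0)) uX≈1)))
            where
            restrict : c₂ u ≈ 0# → B₁ * (c₀ u * c₀ u) + Bₘ * (c₀ u * c₁ u) + B₂ * (c₁ u * c₁ u) ≈
                                   B₁ * e₁ u + Bₘ * eₘ u + B₂ * e₂ u
            restrict u₂≈0 = begin
              B₁ * (c₀ u * c₀ u) + Bₘ * (c₀ u * c₁ u) + B₂ * (c₁ u * c₁ u)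
                ≈⟨ solve 6 (λ n B₁ Bₘ B₂ p r → let s = con (+ 0) in
                     B₁ :* (p :* p) :+ Bₘ :* (p :* r) :+ B₂ :* (r :* r) :=
                     B₁ :* (p :* p :- n :* (r :* s)) :+ Bₘ :* (p :* r :+ p :* s :- n :* (s :* s)) :+ B₂ :* (r :* r :- p :* s :+ r :* s))
                     refl N B₁ Bₘ B₂ (c₀ u) (c₁ u) ⟩
              B₁ * e₁ u′ + Bₘ * eₘ u′ + B₂ * e₂ u′
                ≈⟨ +-cong (+-cong
                     (*-congˡ (+-congˡ (-‿cong (*-congˡ (*-congˡ (sym u₂≈0))))))
                     (*-congˡ (+-cong (+-congˡ (*-congˡ (sym u₂≈0))) (-‿cong (*-congˡ (*-cong (sym u₂≈0) (sym u₂≈0)))))))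
                     (*-congˡ (+-cong (+-congˡ (-‿cong (*-congˡ (sym u₂≈0)))) (*-congˡ (sym u₂≈0)))) ⟩
              B₁ * e₁ u + Bₘ * eₘ u + B₂ * e₂ u ∎
              where
              u′ : E
              u′ = ⟨ c₀ u , c₁ u , 0# ⟩

          -- As X is invertible, the vanishing of both forms says that [ z , A ] and [ z , z Z ] are
          -- zero for every z; this forces A and Z into F.
          reach : ∀ z → z *ᴱ u *ᴱ X ≈ᴱ z
          reach z = E.trans (E.*-assoc z u X) (E.trans (E.*-congˡ {z} uX≈1) (E.*-identityʳ z))

          linear≈0 : ∀ z → [ z , A ] ≈ 0#
          linear≈0 z = trans (bracket-cong {y = A} (E.sym (reach z)) E.refl)
            (trans (linear (z *ᴱ u)) (trans (*-congˡ g₀≈0) (zeroʳ (c₂ (z *ᴱ u)))))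

          quadratic≈0 : ∀ z → [ z , z *ᴱ Z ] ≈ 0#
          quadratic≈0 z = x≉0∧x*y≈0⇒y≈0 (Q≉0 i) (begin
            Q i * [ z , z *ᴱ Z ]
              ≈⟨ *-congˡ (bracket-cong (reach z) (E.*-assoc z u Y)) ⟨
            Q i * [ z *ᴱ u *ᴱ X , z *ᴱ u *ᴱ Y ]
              ≈⟨ quadratic (z *ᴱ u) ⟩
            g₀ * (B₁ * e₁ (z *ᴱ u) + Bₘ * eₘ (z *ᴱ u) + B₂ * e₂ (z *ᴱ u))
              ≈⟨ trans (*-congʳ g₀≈0) (zeroˡ _) ⟩
            0# ∎)

          A₂≈0 : c₂ A ≈ 0#
          A₂≈0 = trans (solve 2 (λ a b → b := con (+ 1) :* b :- con (+ 0) :* a) refl (c₁ A) (c₂ A)) (linear≈0 θ)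

          A₁≈0 : c₁ A ≈ 0#
          A₁≈0 = trans (solve 2 (λ a b → a := :- (con (+ 0) :* b :- con (+ 1) :* a)) refl (c₁ A) (c₂ A))
            (trans (-‿cong (linear≈0 θ²)) -0#≈0#)

          -- The θ-coefficient of θ² Z is N c₂ Z, so z = θ² isolates c₂ Z.
          Z₂≈0 : c₂ Z ≈ 0#
          Z₂≈0 = x≉0∧x*y≈0⇒y≈0 N≉0 (begin
            N * c₂ Z
              ≈⟨ solve 4 (λ n z₀ z₁ z₂ →
                   let t² = ⟨ con (+ 0) , con (+ 0) , con (+ 1) ⟩ ; tz = TripleOps.mul _:+_ _:*_ n t² ⟨ z₀ , z₁ , z₂ ⟩
                   in n :* z₂ := :- (con (+ 0) :* c₂ tz :- con (+ 1) :* c₁ tz)) refl N (c₀ Z) (c₁ Z) (c₂ Z) ⟩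
            - [ θ² , θ² *ᴱ Z ]
              ≈⟨ trans (-‿cong (quadratic≈0 θ²)) -0#≈0# ⟩
            0# ∎)
            where
            N≉0 : ¬ (N ≈ 0#)
            N≉0 = irreducible⇒≉0 irreducible

          Z₁≈0 : c₁ Z ≈ 0#
          Z₁≈0 = begin
            c₁ Z
              ≈⟨ solve 4 (λ n z₀ z₁ z₂ →
                   let t = ⟨ con (+ 0) , con (+ 1) , con (+ 0) ⟩ ; tz = TripleOps.mul _:+_ _:*_ n t ⟨ z₀ , z₁ , z₂ ⟩
                   in z₁ := con (+ 1) :* c₂ tz :- con (+ 0) :* c₁ tz :- z₂) refl N (c₀ Z) (c₁ Z) (c₂ Z) ⟩
            [ θ , θ *ᴱ Z ] - c₂ Z
              ≈⟨ +-cong (quadratic≈0 θ) (-‿cong Z₂≈0) ⟩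
            0# - 0#
              ≈⟨ -‿inverseʳ 0# ⟩
            0# ∎

          Z₀≉0 : ¬ (c₀ Z ≈ 0#)
          Z₀≉0 Z₀≈0 = Y≉0 (unit-cancel u-unit (Z₀≈0 , Z₁≈0 , Z₂≈0))

          -- Z v i = v i u Y = A u, where Z and A are now known to be scalars.
          coordinates : c₀ Z * p i ≈ c₀ A * c₀ u × c₀ Z * r i ≈ c₀ A * c₁ u × c₀ Z * 1# ≈ c₀ A * c₂ u
          coordinates = E.trans (E.sym (scalar-*ˡ (c₀ Z) (v i)))
            (E.trans (E.*-congʳ {v i} (refl , sym Z₁≈0 , sym Z₂≈0))
            (E.trans (E.*-comm Z (v i))
            (E.trans (E.rearrange-product (v i) u Y)
            (E.trans (E.*-comm u A)
            (E.trans (E.*-congʳ {u} (refl , A₁≈0 , A₂≈0)) (scalar-*ˡ (c₀ A) u))))))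

          A₀u₂≈Z₀ : c₀ A * c₂ u ≈ c₀ Z
          A₀u₂≈Z₀ = trans (sym (proj₂ (proj₂ coordinates))) (*-identityʳ (c₀ Z))

          A₀≉0 : ¬ (c₀ A ≈ 0#)
          A₀≉0 A₀≈0 = Z₀≉0 (trans (sym A₀u₂≈Z₀) (trans (*-congʳ A₀≈0) (zeroˡ (c₂ u))))

          u₂≉0 : ¬ (c₂ u ≈ 0#)
          u₂≉0 u₂≈0 = Z₀≉0 (trans (sym A₀u₂≈Z₀) (trans (*-congˡ u₂≈0) (zeroʳ (c₀ A))))

          p-eq : c₂ u * p i ≈ c₀ u
          p-eq = *-cancelˡ-≉0 A₀≉0 (trans (sym (*-assoc _ _ _)) (trans (*-congʳ A₀u₂≈Z₀) (proj₁ coordinates)))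

          r-eq : c₂ u * r i ≈ c₁ u
          r-eq = *-cancelˡ-≉0 A₀≉0 (trans (sym (*-assoc _ _ _)) (trans (*-congʳ A₀u₂≈Z₀) (proj₁ (proj₂ coordinates))))

      -- Every v i is a multiple of the same u and has θ²-coefficient 1, so all of them coincide;
      -- the first two already contradict `distinct`.
      ¬transversal : ¬ Transversal slopes
      ¬transversal (y , y≉0 , dependent-conormals) = distinct (# 0) (# 1) (λ ())
          ( *-cancelˡ-≉0 (proj₁ (at (# 0))) (trans (proj₁ (proj₂ (at (# 0)))) (sym (proj₁ (proj₂ (at (# 1))))))
          , *-cancelˡ-≉0 (proj₁ (at (# 0))) (trans (proj₂ (proj₂ (at (# 0)))) (sym (proj₂ (proj₂ (at (# 1)))))) )
        where
        w x : E
        w = y (# 0)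
        x = y (# 1)

        w-unit : Unit w
        w-unit = unit w (y≉0 (# 0))

        W : E
        W = proj₁ w-unit

        x-unit : Unit x
        x-unit = unit x (y≉0 (# 1))

        X u : E
        X = x *ᴱ W
        u = w *ᴱ proj₁ x-unit

        uX≈1 : u *ᴱ X ≈ᴱ 1ᴱ
        uX≈1 = E.trans (E.interchange-inverse w (proj₁ x-unit) x W)
          (E.trans (E.*-cong (proj₂ w-unit) (proj₂ x-unit)) (E.*-identityˡ 1ᴱ))

        Y : Fin 5 → E
        Y i = y (fsuc (fsuc i)) *ᴱ W

        Y≉0 : ∀ i → ¬ (Y i ≈ᴱ 0ᴱ)
        Y≉0 i Y≈0 = y≉0 (fsuc (fsuc i)) (unit-cancel (w , E.trans (E.*-comm W w) (proj₂ w-unit))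
          (E.trans (E.*-comm W (y (fsuc (fsuc i)))) Y≈0))

        triad : Fin 5 → Fin 5 → Fin 3 → Fin 7
        triad i j fzero               = # 1
        triad i j (fsuc fzero)        = fsuc (fsuc i)
        triad i j (fsuc (fsuc fzero)) = fsuc (fsuc j)

        brackets : ∀ i j → Q i * [ v j *ᴱ X , v j *ᴱ Y i ] ≈ Q j * [ v j *ᴱ X , v i *ᴱ Y i ]
        brackets i j = begin
          Q i * [ v j *ᴱ X , v j *ᴱ Y i ]         ≈⟨ negate (Q i) _ ⟩
          - (k i * [ v j *ᴱ X , v j *ᴱ Y i ])     ≈⟨ -‿cong (Dependent⇒bracket {w} {x} {y (fsuc (fsuc i))} {y (fsuc (fsuc j))} {v i} {v j} {k i} {k j}
                                                       (k≉0 j) (proj₂ w-unit) (dependent-conormals (# 0) (triad i j))) ⟩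
          - (k j * [ v j *ᴱ X , v i *ᴱ Y i ])     ≈⟨ negate (Q j) _ ⟨
          Q j * [ v j *ᴱ X , v i *ᴱ Y i ]         ∎
          where
          negate : ∀ a b → a * b ≈ - (- a * b)
          negate = solve 2 (λ a b → a :* b := :- (:- a :* b)) refl

        at : ∀ i → ¬ (c₂ u ≈ 0#) × c₂ u * p i ≈ c₀ u × c₂ u * r i ≈ c₁ u
        at i = Subline.proportional X u uX≈1 i (Y i) (Y≉0 i) (brackets i)

      configuration⇒theorem : SevenPlanes F
      configuration⇒theorem = ¬transversal⇒theorem ¬transversal

-- Choice of the cubic, of the anisotropic form and of two abscissae.

module Parameters (F : CommutativeRing 0ℓ 0ℓ) (isField : IsField F) {q : ℕ} (card : HasCard F q) where
  open CommutativeRing F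
  open IntegerSolver F
  open Lin F
  open FiniteField F isField card
  open Relation.Binary.Reasoning.Setoid setoid

  missing-value-of : (f : Carrier → Carrier) → (∀ {x y} → x ≈ y → f x ≈ f y) →
                     ∀ {x y} → ¬ (x ≈ y) → f x ≈ f y → ∃[ z ] (∀ w → ¬ (f w ≈ z))
  missing-value-of f f-cong {x} {y} x≉y fx≈fy = proj₁ missed
    , λ w fw≈z → proj₂ missed (index w) (trans (f-cong (element-index w)) fw≈z)
    where
    missed : ∃[ z ] (∀ k → ¬ (f (element k) ≈ z))
    missed = missing-value (f ∘ element) {index x} {index y} (x≉y ∘ index-injective)
      (trans (f-cong (element-index x)) (trans fx≈fy (sym (f-cong (element-index y)))))

  irreducible-cubic : ∃ (Irreducible F)
  irreducible-cubic = N , λ x eq → missed x (begin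
      x * x * x - x * x          ≈⟨ +-congʳ eq ⟩
      x * x + N - x * x          ≈⟨ solve 2 (λ a n → a :+ n :- a := n) refl (x * x) N ⟩
      N                          ∎)
    where
    missing : ∃[ z ] (∀ x → ¬ (x * x * x - x * x ≈ z))
    missing = missing-value-of (λ x → x * x * x - x * x)
      (λ x≈y → +-cong (*-cong (*-cong x≈y x≈y) x≈y) (-‿cong (*-cong x≈y x≈y))) 0≉1
      (solve 0 (con (+ 0) :* con (+ 0) :* con (+ 0) :- con (+ 0) :* con (+ 0) :=
                con (+ 1) :* con (+ 1) :* con (+ 1) :- con (+ 1) :* con (+ 1)) refl)
    N = proj₁ missing
    missed = proj₂ missing

  -- z ↦ - z² / (z + 1), with the value at the pole z = -1 replaced by 1.
  private
    pencil : Fin q → Carrier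
    pencil k with element k + 1# ≟ 0#
    ... | yes _   = 1#
    ... | no  ≉0 = - (element k * element k) * proj₁ (inverse ≉0)

    pencil-pole : ∀ k → element k + 1# ≈ 0# → pencil k ≈ 1#
    pencil-pole k ≈0 with element k + 1# ≟ 0#
    ... | yes _   = refl
    ... | no  ≉0 = contradiction ≈0 ≉0

    pencil-regular : ∀ k → ¬ (element k + 1# ≈ 0#) → pencil k * (element k + 1#) ≈ - (element k * element k)
    pencil-regular k ≉0 with element k + 1# ≟ 0#
    ... | yes ≈0  = contradiction ≈0 ≉0
    ... | no  ≉0′ = trans (*-assoc _ _ _) (trans (*-congˡ (trans (*-comm _ _) (proj₂ (inverse ≉0′)))) (*-identityʳ _))

    -- In terms of ρ = z + 1 the function is 2 - ρ - ρ⁻¹, which is symmetric in ρ and ρ⁻¹. So any ρ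
    -- with ρ² ≠ 1 yields a value taken twice, and therefore a value that is missed.
    pencil-at : ∀ ρ σ → ρ * σ ≈ 1# → pencil (index (ρ - 1#)) ≈ 1# + 1# - ρ - σ
    pencil-at ρ σ ρσ≈1 = *-cancelˡ-≉0 ρ≉0 (begin
      ρ * pencil k                      ≈⟨ *-comm ρ (pencil k) ⟩
      pencil k * ρ                      ≈⟨ *-congˡ element+1≈ρ ⟨
      pencil k * (element k + 1#)       ≈⟨ pencil-regular k (λ ≈0 → ρ≉0 (trans (sym element+1≈ρ) ≈0)) ⟩
      - (element k * element k)         ≈⟨ -‿cong (*-cong (element-index (ρ - 1#)) (element-index (ρ - 1#))) ⟩
      - ((ρ - 1#) * (ρ - 1#))           ≈⟨ solve 1 (λ ρ → :- ((ρ :- con (+ 1)) :* (ρ :- con (+ 1))) := (con (+ 1) :+ con (+ 1) :- ρ) :* ρ :- con (+ 1)) refl ρ ⟩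
      (1# + 1# - ρ) * ρ - 1#            ≈⟨ +-congˡ (-‿cong ρσ≈1) ⟨
      (1# + 1# - ρ) * ρ - ρ * σ         ≈⟨ solve 2 (λ ρ σ → (con (+ 1) :+ con (+ 1) :- ρ) :* ρ :- ρ :* σ := ρ :* (con (+ 1) :+ con (+ 1) :- ρ :- σ)) refl ρ σ ⟩
      ρ * (1# + 1# - ρ - σ)             ∎)
      where
      k : Fin q
      k = index (ρ - 1#)

      element+1≈ρ : element k + 1# ≈ ρ
      element+1≈ρ = trans (+-congʳ (element-index (ρ - 1#))) (solve 1 (λ ρ → ρ :- con (+ 1) :+ con (+ 1) := ρ) refl ρ)

      ρ≉0 : ¬ (ρ ≈ 0#)
      ρ≉0 ρ≈0 = 0≉1 (trans (sym (trans (*-congʳ ρ≈0) (zeroˡ σ))) ρσ≈1)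

  Anisotropic : Carrier → Carrier → Carrier → Set
  Anisotropic A B C = ∀ x y → A * (x * x) + B * (x * y) + C * (y * y) ≈ 0# → x ≈ 0# × y ≈ 0#

  pencil-collision : ∀ {ρ σ} → ρ * σ ≈ 1# → ¬ (ρ * ρ ≈ 1#) → ∃[ z ] (∀ k → ¬ (pencil k ≈ z))
  pencil-collision {ρ} {σ} ρσ≈1 ρ²≉1 = missing-value pencil {index (ρ - 1#)} {index (σ - 1#)} different (begin
    pencil (index (ρ - 1#))   ≈⟨ pencil-at ρ σ ρσ≈1 ⟩
    1# + 1# - ρ - σ           ≈⟨ solve 2 (λ a b → con (+ 1) :+ con (+ 1) :- a :- b := con (+ 1) :+ con (+ 1) :- b :- a) refl ρ σ ⟩
    1# + 1# - σ - ρ           ≈⟨ pencil-at σ ρ (trans (*-comm σ ρ) ρσ≈1) ⟨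
    pencil (index (σ - 1#))   ∎)
    where
    different : index (ρ - 1#) ≢ index (σ - 1#)
    different eq = ρ²≉1 (trans (*-congˡ (x-y≈0⇒x≈y (trans
      (solve 2 (λ a b → a :- b := (a :- con (+ 1)) :- (b :- con (+ 1))) refl ρ σ)
      (x≈y⇒x-y≈0 (index-injective eq))))) ρσ≈1)

  -- A zero of the form with y ≠ 0 gives a root z = x / y of z² + m (z + 1), that is m = - z² / (z +
  -- 1). Missing the value at z = 0 gives m ≠ 0, and missing the value assigned to the pole gives m
  -- ≠ 1.
  missed⇒anisotropic : ∀ m → (∀ k → ¬ (pencil k ≈ m)) → ¬ (m ≈ 0#) × ¬ (1# - m ≈ 0#) × Anisotropic 1# m m
  missed⇒anisotropic m missed = m≉0 , 1-m≉0 , aniso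
    where
    m≉0 : ¬ (m ≈ 0#)
    m≉0 m≈0 = missed k (trans (sym (*-identityʳ (pencil k))) (begin
      pencil k * 1#                 ≈⟨ *-congˡ 0+1≈1 ⟨
      pencil k * (element k + 1#)   ≈⟨ pencil-regular k (λ ≈0 → 1≉0 (trans (sym 0+1≈1) ≈0)) ⟩
      - (element k * element k)     ≈⟨ -‿cong (*-cong (element-index 0#) (element-index 0#)) ⟩
      - (0# * 0#)                   ≈⟨ solve 0 (:- (con (+ 0) :* con (+ 0)) := con (+ 0)) refl ⟩
      0#                            ≈⟨ m≈0 ⟨
      m                             ∎))
      where
      k : Fin q
      k = index 0#

      0+1≈1 : element k + 1# ≈ 1#
      0+1≈1 = trans (+-congʳ (element-index 0#)) (+-identityˡ 1#)

    1-m≉0 : ¬ (1# - m ≈ 0#)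
    1-m≉0 1-m≈0 = missed (index (- 1#)) (trans
      (pencil-pole (index (- 1#)) (trans (+-congʳ (element-index (- 1#))) (-‿inverseˡ 1#))) (x-y≈0⇒x≈y 1-m≈0))

    no-root : ∀ x → ¬ (x * x + m * (x + 1#) ≈ 0#)
    no-root x root with x + 1# ≟ 0#
    -- At the pole the polynomial z² + m (z + 1) takes the value 1 for every m.
    ... | yes x+1≈0 = 1≉0 (begin
      1#                                        ≈⟨ solve 2 (λ x m → con (+ 1) := x :* x :+ m :* (x :+ con (+ 1)) :- (x :- con (+ 1) :+ m) :* (x :+ con (+ 1))) refl x m ⟩
      x * x + m * (x + 1#) - (x - 1# + m) * (x + 1#) ≈⟨ +-cong root (-‿cong (*-congˡ x+1≈0)) ⟩
      0# - (x - 1# + m) * 0#                    ≈⟨ solve 1 (λ a → con (+ 0) :- a :* con (+ 0) := con (+ 0)) refl (x - 1# + m) ⟩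
      0#                                        ∎)
    ... | no x+1≉0 = missed (index x) (*-cancelˡ-≉0 x+1≉0 (begin
      (x + 1#) * pencil (index x)                    ≈⟨ *-comm _ _ ⟩
      pencil (index x) * (x + 1#)                    ≈⟨ *-congˡ (+-congʳ (element-index x)) ⟨
      pencil (index x) * (element (index x) + 1#)    ≈⟨ pencil-regular (index x) (λ ≈0 → x+1≉0 (trans (+-congʳ (sym (element-index x))) ≈0)) ⟩
      - (element (index x) * element (index x))      ≈⟨ -‿cong (*-cong (element-index x) (element-index x)) ⟩
      - (x * x)                                      ≈⟨ solve 2 (λ x m → :- (x :* x) := (x :+ con (+ 1)) :* m :- (x :* x :+ m :* (x :+ con (+ 1)))) refl x m ⟩
      (x + 1#) * m - (x * x + m * (x + 1#))          ≈⟨ +-congˡ (-‿cong root) ⟩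
      (x + 1#) * m - 0#                              ≈⟨ solve 1 (λ a → a :- con (+ 0) := a) refl ((x + 1#) * m) ⟩
      (x + 1#) * m                                   ∎))

    aniso : Anisotropic 1# m m
    aniso x y form≈0 with y ≟ 0#
    ... | yes y≈0 = stable (λ x≉0 → *-≉0 x≉0 x≉0 (begin
        x * x                                              ≈⟨ solve 2 (λ x m → x :* x := con (+ 1) :* (x :* x) :+ m :* (x :* con (+ 0)) :+ m :* (con (+ 0) :* con (+ 0))) refl x m ⟩
        1# * (x * x) + m * (x * 0#) + m * (0# * 0#)        ≈⟨ +-cong (+-congˡ (*-congˡ (*-congˡ y≈0))) (*-congˡ (*-cong y≈0 y≈0)) ⟨
        1# * (x * x) + m * (x * y) + m * (y * y)           ≈⟨ form≈0 ⟩
        0#                                                 ∎)) , y≈0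
    ... | no y≉0 = contradiction (begin
        x * w * (x * w) + m * (x * w + 1#)
          ≈⟨ solve 3 (λ x w m → x :* w :* (x :* w) :+ m :* (x :* w :+ con (+ 1)) :=
               x :* w :* (x :* w) :+ m :* (x :* w :* con (+ 1) :+ con (+ 1) :* con (+ 1))) refl x w m ⟩
        x * w * (x * w) + m * (x * w * 1# + 1# * 1#)
          ≈⟨ +-congˡ (*-congˡ (+-cong (*-congˡ yw≈1) (*-cong yw≈1 yw≈1))) ⟨
        x * w * (x * w) + m * (x * w * (y * w) + y * w * (y * w))
          ≈⟨ solve 4 (λ x y w m → x :* w :* (x :* w) :+ m :* (x :* w :* (y :* w) :+ y :* w :* (y :* w)) :=
               w :* w :* (con (+ 1) :* (x :* x) :+ m :* (x :* y) :+ m :* (y :* y))) refl x y w m ⟩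
        w * w * (1# * (x * x) + m * (x * y) + m * (y * y))
          ≈⟨ *-congˡ form≈0 ⟩
        w * w * 0#
          ≈⟨ zeroʳ (w * w) ⟩
        0# ∎) (no-root (x * w))
      where
      w = proj₁ (inverse y≉0)
      yw≈1 = proj₂ (inverse y≉0)

  anisotropic-form : ∀ {ρ} → ¬ (ρ ≈ 0#) → ¬ (ρ * ρ ≈ 1#) →
                     ∃[ m ] (¬ (m ≈ 0#) × ¬ (1# - m ≈ 0#) × Anisotropic 1# m m)
  anisotropic-form ρ≉0 ρ²≉1 = proj₁ missing , missed⇒anisotropic (proj₁ missing) (proj₂ missing)
    where
    missing : ∃[ z ] (∀ k → ¬ (pencil k ≈ z))
    missing = pencil-collision (proj₂ (inverse ρ≉0)) ρ²≉1

  -- The points (a , 0) and (b , 0) complete (0 , 0), (0 , -1), (0 , -m) to a configuration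
  -- whose linear system (Configuration.unique) is nondegenerate.
  Abscissae : (N m a b : Carrier) → Set
  Abscissae N m a b = ¬ (a ≈ 0#) × ¬ (b ≈ 0#) × ¬ (a - b ≈ 0#) × ¬ (a * a - m * N ≈ 0#) × ¬ (b * b - m * N ≈ 0#) ×
                      ¬ ((1# - m) * (a * b + m * N) - (m * m + N) * (a + b) ≈ 0#)

  -- The last condition is the delicate one. Where 1 + 1 ≠ 0, the choice b = - a removes its term
  -- with a + b. In characteristic two, a b = m N removes the other term and leaves (m² + N) (a +
  -- b); this breaks down for N = m², where a = m and b = 1 serve instead.
  abscissae : ∀ {N m ρ} → Irreducible F N → ¬ (m ≈ 0#) → ¬ (1# - m ≈ 0#) → ¬ (ρ ≈ 0#) → ¬ (ρ * ρ ≈ 1#) →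
              ∃[ a ] ∃[ b ] Abscissae N m a b
  abscissae {N} {m} {ρ} irreducible m≉0 1-m≉0 ρ≉0 ρ²≉1 = go nonsquare-abscissa (1# + 1# ≟ 0#) (N ≟ m * m)
    where
    N≉0 : ¬ (N ≈ 0#)
    N≉0 = irreducible⇒≉0 irreducible

    mN≉0 : ¬ (m * N ≈ 0#)
    mN≉0 = *-≉0 m≉0 N≉0

    -- The choice a = 1 fails only if m N = 1, and then a = ρ works because ρ² ≠ 1.
    nonsquare-abscissa : ∃[ a ] (¬ (a ≈ 0#) × ¬ (a * a ≈ m * N))
    nonsquare-abscissa with 1# * 1# ≟ m * N
    ... | no  1≉mN = 1# , 1≉0 , 1≉mN
    ... | yes 1≈mN = ρ , ρ≉0 , λ ρ²≈mN → ρ²≉1 (trans ρ²≈mN (trans (sym 1≈mN) (*-identityˡ 1#)))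

    odd : ∀ a → ¬ (a ≈ 0#) → ¬ (a * a ≈ m * N) → ¬ (1# + 1# ≈ 0#) → Abscissae N m a (- a)
    odd a a≉0 a²≉mN 2≉0 = a≉0 , a≉0 ∘ -x≈0⇒x≈0
      , (λ eq → *-≉0 2≉0 a≉0 (trans (solve 1 (λ a → (con (+ 1) :+ con (+ 1)) :* a := a :- :- a) refl a) eq))
      , a²≉mN ∘ x-y≈0⇒x≈y
      , (λ eq → a²≉mN (x-y≈0⇒x≈y (trans (solve 2 (λ a n → a :* a :- n := :- a :* :- a :- n) refl a (m * N)) eq)))
      , (λ eq → *-≉0 1-m≉0 (a²≉mN ∘ x-y≈0⇒x≈y) (trans
          (solve 3 (λ n m a → (con (+ 1) :- m) :* (a :* a :- m :* n) :=
             :- ((con (+ 1) :- m) :* (a :* :- a :+ m :* n) :- (m :* m :+ n) :* (a :+ :- a))) refl N m a)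
          (trans (-‿cong eq) -0#≈0#)))

    even : ∀ a → ¬ (a ≈ 0#) → ¬ (a * a ≈ m * N) → 1# + 1# ≈ 0# → ¬ (N ≈ m * m) →
           ∀ b → a * b ≈ m * N → Abscissae N m a b
    even a a≉0 a²≉mN 2≈0 N≉m² b ab≈mN = a≉0 , b≉0
      , (λ a-b≈0 → a²≉mN (trans (*-congˡ (x-y≈0⇒x≈y a-b≈0)) ab≈mN))
      , a²≉mN ∘ x-y≈0⇒x≈y
      , (λ eq → a≉b (*-cancelˡ-≉0 b≉0 (trans (*-comm b a) (trans ab≈mN (sym (x-y≈0⇒x≈y eq))))))
      , (λ eq → *-≉0 m²+N≉0 a+b≉0 (begin
          (m * m + N) * (a + b)
            ≈⟨ solve 4 (λ n m a b → (m :* m :+ n) :* (a :+ b) :=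
                 (con (+ 1) :- m) :* (a :* b :- m :* n) :+ (con (+ 1) :+ con (+ 1)) :* ((con (+ 1) :- m) :* (m :* n))
                 :- ((con (+ 1) :- m) :* (a :* b :+ m :* n) :- (m :* m :+ n) :* (a :+ b))) refl N m a b ⟩
          (1# - m) * (a * b - m * N) + (1# + 1#) * ((1# - m) * (m * N)) - ((1# - m) * (a * b + m * N) - (m * m + N) * (a + b))
            ≈⟨ +-cong (+-cong (*-congˡ (x≈y⇒x-y≈0 ab≈mN)) (*-congʳ 2≈0)) (-‿cong eq) ⟩
          (1# - m) * 0# + 0# * ((1# - m) * (m * N)) - 0#
            ≈⟨ solve 2 (λ x y → x :* con (+ 0) :+ con (+ 0) :* y :- con (+ 0) := con (+ 0)) refl (1# - m) ((1# - m) * (m * N)) ⟩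
          0# ∎))
      where
      b≉0 : ¬ (b ≈ 0#)
      b≉0 b≈0 = mN≉0 (trans (sym ab≈mN) (trans (*-congˡ b≈0) (zeroʳ a)))

      a≉b : ¬ (a ≈ b)
      a≉b a≈b = a²≉mN (trans (*-congˡ a≈b) ab≈mN)

      x+y≈0⇒x≈y : ∀ {x y} → x + y ≈ 0# → x ≈ y
      x+y≈0⇒x≈y {x} {y} eq = begin
        x                            ≈⟨ solve 2 (λ x y → x := x :+ y :+ y :- (con (+ 1) :+ con (+ 1)) :* y) refl x y ⟩
        x + y + y - (1# + 1#) * y    ≈⟨ +-cong (+-congʳ eq) (-‿cong (*-congʳ 2≈0)) ⟩
        0# + y - 0# * y              ≈⟨ solve 1 (λ y → con (+ 0) :+ y :- con (+ 0) :* y := y) refl y ⟩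
        y                            ∎

      m²+N≉0 : ¬ (m * m + N ≈ 0#)
      m²+N≉0 eq = N≉m² (sym (x+y≈0⇒x≈y eq))

      a+b≉0 : ¬ (a + b ≈ 0#)
      a+b≉0 eq = a≉b (x+y≈0⇒x≈y eq)

    -- If m³ = 1 ≠ m and N = m², then m + 1 would be a root of x³ - x² - N.
    special : 1# + 1# ≈ 0# → N ≈ m * m → Abscissae N m m 1#
    special 2≈0 N≈m² = m≉0 , 1≉0 , m-1≉0
      , (λ eq → *-≉0 (*-≉0 m≉0 m≉0) 1-m≉0 (trans (solve 1 (λ m → m :* m :* (con (+ 1) :- m) := m :* m :- m :* (m :* m)) refl m)
          (trans (+-congˡ (-‿cong (*-congˡ (sym N≈m²)))) eq)))
      , (λ eq → *-≉0 1-m≉0 m²+m+1≉0 (trans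
          (solve 1 (λ m → (con (+ 1) :- m) :* (m :* m :+ m :+ con (+ 1)) := con (+ 1) :* con (+ 1) :- m :* (m :* m)) refl m)
          (trans (+-congˡ (-‿cong (*-congˡ (sym N≈m²)))) eq)))
      , (λ eq → *-≉0 m≉0 (*-≉0 1-m≉0 (*-≉0 1-m≉0 1-m≉0)) (begin
          m * ((1# - m) * ((1# - m) * (1# - m)))
            ≈⟨ solve 1 (λ m → let one-m = con (+ 1) :- m in
                 m :* (one-m :* (one-m :* one-m)) :=
                 (one-m :* (m :* con (+ 1) :+ m :* (m :* m)) :- (m :* m :+ m :* m) :* (m :+ con (+ 1)))
                 :- (con (+ 1) :+ con (+ 1)) :* (one-m :* m :* m :- m :* m :* (m :+ con (+ 1)))) refl m ⟩
          ((1# - m) * (m * 1# + m * (m * m)) - (m * m + m * m) * (m + 1#)) - (1# + 1#) * S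
            ≈⟨ +-cong (+-cong (*-congˡ (+-congˡ (*-congˡ (sym N≈m²)))) (-‿cong (*-congʳ (+-congˡ (sym N≈m²))))) (-‿cong (*-congʳ 2≈0)) ⟩
          ((1# - m) * (m * 1# + m * N) - (m * m + N) * (m + 1#)) - 0# * S
            ≈⟨ +-congʳ eq ⟩
          0# - 0# * S
            ≈⟨ solve 1 (λ s → con (+ 0) :- con (+ 0) :* s := con (+ 0)) refl S ⟩
          0# ∎))
      where
      S : Carrier
      S = (1# - m) * m * m - m * m * (m + 1#)

      m-1≉0 : ¬ (m - 1# ≈ 0#)
      m-1≉0 eq = 1-m≉0 (trans (solve 1 (λ m → con (+ 1) :- m := :- (m :- con (+ 1))) refl m)
        (trans (-‿cong eq) -0#≈0#))

      m²+m+1≉0 : ¬ (m * m + m + 1# ≈ 0#)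
      m²+m+1≉0 eq = irreducible (m + 1#) (x-y≈0⇒x≈y (begin
        (m + 1#) * (m + 1#) * (m + 1#) - ((m + 1#) * (m + 1#) + N)
          ≈⟨ +-congˡ (-‿cong (+-congˡ N≈m²)) ⟩
        (m + 1#) * (m + 1#) * (m + 1#) - ((m + 1#) * (m + 1#) + m * m)
          ≈⟨ solve 1 (λ m → let m+1 = m :+ con (+ 1) in
               m+1 :* m+1 :* m+1 :- (m+1 :* m+1 :+ m :* m) := m :* (m :* m :+ m :+ con (+ 1))) refl m ⟩
        m * (m * m + m + 1#)
          ≈⟨ trans (*-congˡ eq) (zeroʳ m) ⟩
        0# ∎))

    go : ∃[ a ] (¬ (a ≈ 0#) × ¬ (a * a ≈ m * N)) → Dec (1# + 1# ≈ 0#) → Dec (N ≈ m * m) → ∃[ a ] ∃[ b ] Abscissae N m a b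
    go (a , a≉0 , a²≉mN) (no 2≉0)  _           = a , - a , odd a a≉0 a²≉mN 2≉0
    go (a , a≉0 , a²≉mN) (yes 2≈0) (yes N≈m²)  = m , 1# , special 2≈0 N≈m²
    go (a , a≉0 , a²≉mN) (yes 2≈0) (no N≉m²)   = a , b , even a a≉0 a²≉mN 2≈0 N≉m² b ab≈mN
      where
      b : Carrier
      b = proj₁ (inverse a≉0) * (m * N)

      ab≈mN : a * b ≈ m * N
      ab≈mN = trans (sym (*-assoc _ _ _)) (trans (*-congʳ (proj₂ (inverse a≉0))) (*-identityˡ _))

-- The configuration for fields with an element other than 0, 1 and -1.

module GenericConfiguration (F : CommutativeRing 0ℓ 0ℓ) (isField : IsField F) {q : ℕ} (card : HasCard F q)
                            (N : CommutativeRing.Carrier F)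
                            (irreducible : Irreducible F N) where
  open CommutativeRing F
  open IntegerSolver F
  open Lin F
  open FiniteField F isField card
  open Parameters F isField card
  open SevenSlopes F isField card N irreducible
  open Relation.Binary.Reasoning.Setoid setoid

  -- Residual of the linear system of Configuration.unique at the point (p , r).
  residual : ∀ {n} → (N B₁ Bₘ B₂ g₀ g₁ g₂ b₁ bₘ b₂ p r : Polynomial n) → Polynomial n
  residual n B₁ Bₘ B₂ g₀ g₁ g₂ b₁ bₘ b₂ p r =
    (B₁ :* e :+ Bₘ :* e′ :+ B₂ :* e″) :* (p :* g₁ :+ r :* g₂ :+ g₀) :- (b₁ :* e :+ bₘ :* e′ :+ b₂ :* e″)
    where
    s = con (+ 1)
    e = p :* p :- n :* (r :* s)
    e′ = p :* r :+ p :* s :- n :* (s :* s)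
    e″ = r :* r :- p :* s :+ r :* s

  module _ {m a b : Carrier} (m≉0 : ¬ (m ≈ 0#)) (1-m≉0 : ¬ (1# - m ≈ 0#)) (aniso : Anisotropic 1# m m)
           (abscissae : Abscissae N m a b) where
    private
      a≉0 = proj₁ abscissae
      b≉0 = proj₁ (proj₂ abscissae)
      a-b≉0 = proj₁ (proj₂ (proj₂ abscissae))
      Qa≉0 = proj₁ (proj₂ (proj₂ (proj₂ abscissae)))
      Qb≉0 = proj₁ (proj₂ (proj₂ (proj₂ (proj₂ abscissae))))
      Δ≉0  = proj₂ (proj₂ (proj₂ (proj₂ (proj₂ abscissae))))

      p r : Fin 5 → Carrier
      -- The three points with p = 0 determine the b in turn: at r = 0 only `eₘ` is nonzero, at r =
      -- -1 the form `e₂` vanishes, and at r = - m the terms of Q with N cancel. At the points (x ,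
      -- 0) the equal coefficients m of `eₘ` and `e₂` cancel the linear term, so that Q = x² - m N.
      p = lookup (0# ∷ 0# ∷ 0# ∷ a ∷ b ∷ [])
      r = lookup (0# ∷ - 1# ∷ - m ∷ 0# ∷ 0# ∷ [])

      open Configuration p r 1# m m using (v; Q; configuration⇒theorem)

      N≉0 : ¬ (N ≈ 0#)
      N≉0 = irreducible⇒≉0 irreducible

      nonzero : ∀ {x y} → x ≈ y → ¬ (y ≈ 0#) → ¬ (x ≈ 0#)
      nonzero x≈y y≉0 x≈0 = y≉0 (trans (sym x≈y) x≈0)

      quadric : ∀ {n} (N m p r : Polynomial n) → Polynomial n
      quadric n m p r = con (+ 1) :* (p :* p :- n :* (r :* s)) :+ m :* (p :* r :+ p :* s :- n :* (s :* s)) :+ m :* (r :* r :- p :* s :+ r :* s)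
        where s = con (+ 1)

      Q≉0 : ∀ i → ¬ (Q i ≈ 0#)
      Q≉0 fzero = nonzero (solve 2 (λ n m → quadric n m (con (+ 0)) (con (+ 0)) := :- (m :* n)) refl N m)
        (*-≉0 m≉0 N≉0 ∘ -x≈0⇒x≈0)
      Q≉0 (fsuc fzero) = nonzero (solve 2 (λ n m → quadric n m (con (+ 0)) (:- con (+ 1)) := n :* (con (+ 1) :- m)) refl N m)
        (*-≉0 N≉0 1-m≉0)
      Q≉0 (fsuc (fsuc fzero)) = nonzero (solve 2 (λ n m → quadric n m (con (+ 0)) (:- m) := :- (m :* m :* (con (+ 1) :- m))) refl N m)
        (*-≉0 (*-≉0 m≉0 m≉0) 1-m≉0 ∘ -x≈0⇒x≈0)
      Q≉0 (fsuc (fsuc (fsuc fzero))) = nonzero (solve 3 (λ n m a → quadric n m a (con (+ 0)) := a :* a :- m :* n) refl N m a) Qa≉0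
      Q≉0 (fsuc (fsuc (fsuc (fsuc fzero)))) = nonzero (solve 3 (λ n m a → quadric n m a (con (+ 0)) := a :* a :- m :* n) refl N m b) Qb≉0

      distinct : ∀ i j → i ≢ j → ¬ (p i ≈ p j × r i ≈ r j)
      distinct = distinct-from-< (λ (p≈ , r≈) → sym p≈ , sym r≈) λ
        { fzero (fsuc fzero) _ (_ , 0≈-1) → 1≉0 (-x≈0⇒x≈0 (sym 0≈-1))
        ; fzero (fsuc (fsuc fzero)) _ (_ , 0≈-m) → m≉0 (-x≈0⇒x≈0 (sym 0≈-m))
        ; fzero (fsuc (fsuc (fsuc fzero))) _ (0≈a , _) → a≉0 (sym 0≈a)
        ; fzero (fsuc (fsuc (fsuc (fsuc fzero)))) _ (0≈b , _) → b≉0 (sym 0≈b)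
        ; (fsuc fzero) (fsuc (fsuc fzero)) _ (_ , -1≈-m) → 1-m≉0 (-x≈0⇒x≈0 (trans
            (solve 1 (λ m → :- (con (+ 1) :- m) := :- con (+ 1) :- :- m) refl m) (x≈y⇒x-y≈0 -1≈-m)))
        ; (fsuc fzero) (fsuc (fsuc (fsuc fzero))) _ (_ , -1≈0) → 1≉0 (-x≈0⇒x≈0 -1≈0)
        ; (fsuc fzero) (fsuc (fsuc (fsuc (fsuc fzero)))) _ (_ , -1≈0) → 1≉0 (-x≈0⇒x≈0 -1≈0)
        ; (fsuc (fsuc fzero)) (fsuc (fsuc (fsuc fzero))) _ (_ , -m≈0) → m≉0 (-x≈0⇒x≈0 -m≈0)
        ; (fsuc (fsuc fzero)) (fsuc (fsuc (fsuc (fsuc fzero)))) _ (_ , -m≈0) → m≉0 (-x≈0⇒x≈0 -m≈0)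
        ; (fsuc (fsuc (fsuc fzero))) (fsuc (fsuc (fsuc (fsuc fzero)))) _ (a≈b , _) → a-b≉0 (x≈y⇒x-y≈0 a≈b)
        ; _ fzero () _
        ; (fsuc _) (fsuc fzero) (ℕ.s≤s ()) _
        ; (fsuc (fsuc _)) (fsuc (fsuc fzero)) (ℕ.s≤s (ℕ.s≤s ())) _
        ; (fsuc (fsuc (fsuc _))) (fsuc (fsuc (fsuc fzero))) (ℕ.s≤s (ℕ.s≤s (ℕ.s≤s ()))) _
        ; (fsuc (fsuc (fsuc (fsuc _)))) (fsuc (fsuc (fsuc (fsuc fzero)))) (ℕ.s≤s (ℕ.s≤s (ℕ.s≤s (ℕ.s≤s ())))) _
        }

      module _ {b₁ bₘ b₂ g₀ g₁ g₂ : Carrier}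
               (h : ∀ j → Q j * (p j * g₁ + r j * g₂ + g₀) ≈ b₁ * e₁ (v j) + bₘ * eₘ (v j) + b₂ * e₂ (v j)) where
        d : Fin 5 → Carrier
        d j = Q j * (p j * g₁ + r j * g₂ + g₀) - (b₁ * e₁ (v j) + bₘ * eₘ (v j) + b₂ * e₂ (v j))

        d≈0 : ∀ j → d j ≈ 0#
        d≈0 j = x≈y⇒x-y≈0 (h j)

        -- The deviations of the b from g₀ (1 , m , m), with the multiples of g₂ that the points on
        -- p = 0 leave undetermined; those points make all three vanish.
        uₘ u₁ u₂ : Carrier
        uₘ = bₘ - g₀ * m
        u₁ = b₁ - g₀ + (1# - m) * g₂
        u₂ = b₂ - g₀ * m + (m * m + N) * g₂

        uₘ≈0 : uₘ ≈ 0#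
        uₘ≈0 = x≉0∧x*y≈0⇒y≈0 N≉0 (trans
          (solve 8 (λ n m g₀ g₁ g₂ b₁ bₘ b₂ → n :* (bₘ :- g₀ :* m) :=
            residual n (con (+ 1)) m m g₀ g₁ g₂ b₁ bₘ b₂ (con (+ 0)) (con (+ 0))) refl N m g₀ g₁ g₂ b₁ bₘ b₂)
          (d≈0 (# 0)))

        u₁≈0 : u₁ ≈ 0#
        u₁≈0 = x≉0∧x*y≈0⇒y≈0 N≉0 (begin
          N * u₁
            ≈⟨ solve 8 (λ n m g₀ g₁ g₂ b₁ bₘ b₂ → n :* (b₁ :- g₀ :+ (con (+ 1) :- m) :* g₂) :=
                 n :* (bₘ :- g₀ :* m) :- residual n (con (+ 1)) m m g₀ g₁ g₂ b₁ bₘ b₂ (con (+ 0)) (:- con (+ 1)))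
                 refl N m g₀ g₁ g₂ b₁ bₘ b₂ ⟩
          N * uₘ - d (# 1)
            ≈⟨ +-cong (*-congˡ uₘ≈0) (-‿cong (d≈0 (# 1))) ⟩
          N * 0# - 0#
            ≈⟨ solve 1 (λ n → n :* con (+ 0) :- con (+ 0) := con (+ 0)) refl N ⟩
          0# ∎)

        u₂≈0 : u₂ ≈ 0#
        u₂≈0 = x≉0∧x*y≈0⇒y≈0 (*-≉0 m≉0 1-m≉0) (begin
          m * (1# - m) * u₂
            ≈⟨ solve 8 (λ n m g₀ g₁ g₂ b₁ bₘ b₂ →
                 m :* (con (+ 1) :- m) :* (b₂ :- g₀ :* m :+ (m :* m :+ n) :* g₂) :=
                 residual n (con (+ 1)) m m g₀ g₁ g₂ b₁ bₘ b₂ (con (+ 0)) (:- m)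
                 :+ n :* m :* (b₁ :- g₀ :+ (con (+ 1) :- m) :* g₂) :- n :* (bₘ :- g₀ :* m)) refl N m g₀ g₁ g₂ b₁ bₘ b₂ ⟩
          d (# 2) + N * m * u₁ - N * uₘ
            ≈⟨ +-cong (+-cong (d≈0 (# 2)) (*-congˡ u₁≈0)) (-‿cong (*-congˡ uₘ≈0)) ⟩
          0# + N * m * 0# - N * 0#
            ≈⟨ solve 2 (λ n m → con (+ 0) :+ n :* m :* con (+ 0) :- n :* con (+ 0) := con (+ 0)) refl N m ⟩
          0# ∎)

        -- Once the three relations are substituted into the residual at (x , 0), only g₁ and g₂
        -- remain, with a common factor x.
        slope-relation : ∀ x → ¬ (x ≈ 0#) →
          (1# * (x * x - N * (0# * 1#)) + m * (x * 0# + x * 1# - N * (1# * 1#)) + m * (0# * 0# - x * 1# + 0# * 1#)) * (x * g₁ + 0# * g₂ + g₀)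
            - (b₁ * (x * x - N * (0# * 1#)) + bₘ * (x * 0# + x * 1# - N * (1# * 1#)) + b₂ * (0# * 0# - x * 1# + 0# * 1#)) ≈ 0# →
          (x * x - m * N) * g₁ + ((1# - m) * x - (m * m + N)) * g₂ ≈ 0#
        slope-relation x x≉0 dx≈0 = x≉0∧x*y≈0⇒y≈0 x≉0 (begin
          x * ((x * x - m * N) * g₁ + ((1# - m) * x - (m * m + N)) * g₂)
            ≈⟨ solve 9 (λ n m g₀ g₁ g₂ b₁ bₘ b₂ x →
                 x :* ((x :* x :- m :* n) :* g₁ :+ ((con (+ 1) :- m) :* x :- (m :* m :+ n)) :* g₂) :=
                 residual n (con (+ 1)) m m g₀ g₁ g₂ b₁ bₘ b₂ x (con (+ 0))
                 :+ x :* x :* (b₁ :- g₀ :+ (con (+ 1) :- m) :* g₂) :+ (x :- n) :* (bₘ :- g₀ :* m)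
                 :- x :* (b₂ :- g₀ :* m :+ (m :* m :+ n) :* g₂)) refl N m g₀ g₁ g₂ b₁ bₘ b₂ x ⟩
          _ + x * x * u₁ + (x - N) * uₘ - x * u₂
            ≈⟨ +-cong (+-cong (+-cong dx≈0 (*-congˡ u₁≈0)) (*-congˡ uₘ≈0)) (-‿cong (*-congˡ u₂≈0)) ⟩
          0# + x * x * 0# + (x - N) * 0# - x * 0#
            ≈⟨ solve 2 (λ n x → con (+ 0) :+ x :* x :* con (+ 0) :+ (x :- n) :* con (+ 0) :- x :* con (+ 0) := con (+ 0)) refl N x ⟩
          0# ∎)

        relation-a = slope-relation a a≉0 (d≈0 (# 3))
        relation-b = slope-relation b b≉0 (d≈0 (# 4))

        -- Cramer's rule: the two relations in g₁ and g₂ have determinant (a - b) times the last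
        -- quantity of `Abscissae`, up to sign.
        g₂≈0 : g₂ ≈ 0#
        g₂≈0 = x≉0∧x*y≈0⇒y≈0 (*-≉0 a-b≉0 Δ≉0) (begin
          (a - b) * ((1# - m) * (a * b + m * N) - (m * m + N) * (a + b)) * g₂
            ≈⟨ solve 6 (λ n m a b g₁ g₂ →
                 (a :- b) :* ((con (+ 1) :- m) :* (a :* b :+ m :* n) :- (m :* m :+ n) :* (a :+ b)) :* g₂ :=
                 (a :* a :- m :* n) :* ((b :* b :- m :* n) :* g₁ :+ ((con (+ 1) :- m) :* b :- (m :* m :+ n)) :* g₂)
                 :- (b :* b :- m :* n) :* ((a :* a :- m :* n) :* g₁ :+ ((con (+ 1) :- m) :* a :- (m :* m :+ n)) :* g₂))
                 refl N m a b g₁ g₂ ⟩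
          (a * a - m * N) * _ - (b * b - m * N) * _
            ≈⟨ +-cong (*-congˡ relation-b) (-‿cong (*-congˡ relation-a)) ⟩
          (a * a - m * N) * 0# - (b * b - m * N) * 0#
            ≈⟨ solve 2 (λ x y → x :* con (+ 0) :- y :* con (+ 0) := con (+ 0)) refl (a * a - m * N) (b * b - m * N) ⟩
          0# ∎)

        g₁≈0 : g₁ ≈ 0#
        g₁≈0 = x≉0∧x*y≈0⇒y≈0 Qa≉0 (trans (sym (trans (+-congˡ (trans (*-congˡ g₂≈0) (zeroʳ _))) (+-identityʳ _))) relation-a)

        b₁≈ : b₁ ≈ g₀ * 1#
        b₁≈ = x-y≈0⇒x≈y (begin
          b₁ - g₀ * 1#             ≈⟨ solve 4 (λ m g₀ g₂ b₁ → b₁ :- g₀ :* con (+ 1) := (b₁ :- g₀ :+ (con (+ 1) :- m) :* g₂) :- (con (+ 1) :- m) :* g₂) refl m g₀ g₂ b₁ ⟩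
          u₁ - (1# - m) * g₂       ≈⟨ +-cong u₁≈0 (-‿cong (*-congˡ g₂≈0)) ⟩
          0# - (1# - m) * 0#       ≈⟨ solve 1 (λ m → con (+ 0) :- (con (+ 1) :- m) :* con (+ 0) := con (+ 0)) refl m ⟩
          0#                       ∎)

        b₂≈ : b₂ ≈ g₀ * m
        b₂≈ = x-y≈0⇒x≈y (begin
          b₂ - g₀ * m              ≈⟨ solve 5 (λ n m g₀ g₂ b₂ → b₂ :- g₀ :* m := (b₂ :- g₀ :* m :+ (m :* m :+ n) :* g₂) :- (m :* m :+ n) :* g₂) refl N m g₀ g₂ b₂ ⟩
          u₂ - (m * m + N) * g₂    ≈⟨ +-cong u₂≈0 (-‿cong (*-congˡ g₂≈0)) ⟩
          0# - (m * m + N) * 0#    ≈⟨ solve 1 (λ a → con (+ 0) :- a :* con (+ 0) := con (+ 0)) refl (m * m + N) ⟩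
          0#                       ∎)

    generic-theorem : SevenPlanes F
    generic-theorem = configuration⇒theorem Q≉0 distinct aniso
      (λ h → g₁≈0 h , g₂≈0 h , b₁≈ h , x-y≈0⇒x≈y (uₘ≈0 h) , b₂≈ h)

-- Small fields: the field with three elements.

Binary Ternary : CommutativeRing 0ℓ 0ℓ → Set
Binary F = 1# ≈ - 1# × (∀ x → x ≈ 0# ⊎ x ≈ 1#)
  where open CommutativeRing F
Ternary F = ¬ (1# ≈ - 1#) × (∀ x → x ≈ 0# ⊎ x ≈ 1# ⊎ x ≈ - 1#)
  where open CommutativeRing F

module TernaryConfiguration (F : CommutativeRing 0ℓ 0ℓ) (isField : IsField F) {q : ℕ} (card : HasCard F q)
    (ternary : Ternary F) where
  open CommutativeRing F
  open IntegerSolver F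
  open Lin F
  open FiniteField F isField card
  open Parameters F isField card
  open Relation.Binary.Reasoning.Setoid setoid

  private
    1≉-1 = proj₁ ternary
    trichotomy = proj₂ ternary

  2≉0 : ¬ (1# + 1# ≈ 0#)
  2≉0 2≈0 = 1≉-1 (x-y≈0⇒x≈y (trans (solve 0 (con (+ 1) :- :- con (+ 1) := con (+ 1) :+ con (+ 1)) refl) 2≈0))

  3≈0 : 1# + 1# + 1# ≈ 0#
  3≈0 with trichotomy (1# + 1#)
  ... | inj₁ 2≈0         = contradiction 2≈0 2≉0
  ... | inj₂ (inj₁ 2≈1)  = contradiction (trans (solve 0 (con (+ 1) := con (+ 1) :+ con (+ 1) :- con (+ 1)) refl) (x≈y⇒x-y≈0 2≈1)) 1≉0
  ... | inj₂ (inj₂ 2≈-1) = trans (+-congʳ 2≈-1) (-‿inverseˡ 1#)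

  cube : ∀ x → x * x * x ≈ x
  cube x with trichotomy x
  ... | inj₁ x≈0        = trans (*-congˡ x≈0) (trans (zeroʳ _) (sym x≈0))
  ... | inj₂ (inj₁ x≈1) = trans (*-cong (*-cong x≈1 x≈1) x≈1) (trans (solve 0 (con (+ 1) :* con (+ 1) :* con (+ 1) := con (+ 1)) refl) (sym x≈1))
  ... | inj₂ (inj₂ x≈-1) = trans (*-cong (*-cong x≈-1 x≈-1) x≈-1)
    (trans (solve 0 (:- con (+ 1) :* :- con (+ 1) :* :- con (+ 1) := :- con (+ 1)) refl) (sym x≈-1))

  square : ∀ x → x ≈ 0# ⊎ x * x ≈ 1#
  square x with trichotomy x
  ... | inj₁ x≈0         = inj₁ x≈0
  ... | inj₂ (inj₁ x≈1)  = inj₂ (trans (*-cong x≈1 x≈1) (*-identityˡ 1#))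
  ... | inj₂ (inj₂ x≈-1) = inj₂ (trans (*-cong x≈-1 x≈-1) (solve 0 (:- con (+ 1) :* :- con (+ 1) := con (+ 1)) refl))

  -- As x³ = x in 𝔽₃, a root satisfies x = x² - 1, which fails both for x = 0 and for x² = 1.
  irreducible : Irreducible F (- 1#)
  irreducible x x³≈x²-1 = [ (λ x≈0 → 1≉0 (-x≈0⇒x≈0 (trans (sym (+-identityˡ _)) (trans (+-congʳ (sym (trans (*-congˡ x≈0) (zeroʳ x))))
      (trans (sym x≈x²-1) x≈0)))))
    , (λ x²≈1 → 1≉0 (trans (sym x²≈1) (trans (*-congˡ (trans x≈x²-1 (x≈y⇒x-y≈0 x²≈1))) (zeroʳ x)))) ]′ (square x)
    where
    x≈x²-1 : x ≈ x * x - 1#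
    x≈x²-1 = trans (sym (cube x)) x³≈x²-1

  form⇒sum : ∀ x y → 1# * (x * x) + 0# * (x * y) + 1# * (y * y) ≈ 0# → x * x + y * y ≈ 0#
  form⇒sum x y = trans (solve 2 (λ x y → x :* x :+ y :* y :=
    con (+ 1) :* (x :* x) :+ con (+ 0) :* (x :* y) :+ con (+ 1) :* (y :* y)) refl x y)

  -- A nonzero square is 1, so a nontrivial zero of x² + y² would make 1 or 1 + 1 vanish.
  aniso : Anisotropic 1# 0# 1#
  aniso x y form≈0 with square x | square y
  ... | inj₁ x≈0  | inj₁ y≈0  = x≈0 , y≈0
  ... | inj₁ x≈0  | inj₂ y²≈1 = contradiction (trans (sym y²≈1) (trans
    (trans (solve 1 (λ y → y :* y := con (+ 0) :* con (+ 0) :+ y :* y) refl y) (+-congʳ (*-cong (sym x≈0) (sym x≈0)))) (form⇒sum x y form≈0))) 1≉0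
  ... | inj₂ x²≈1 | inj₁ y≈0  = contradiction (trans (sym x²≈1) (trans
    (trans (solve 1 (λ x → x :* x := x :* x :+ con (+ 0) :* con (+ 0)) refl x) (+-congˡ (*-cong (sym y≈0) (sym y≈0)))) (form⇒sum x y form≈0))) 1≉0
  ... | inj₂ x²≈1 | inj₂ y²≈1 = contradiction (trans (+-cong (sym x²≈1) (sym y²≈1)) (form⇒sum x y form≈0)) 2≉0

  open SevenSlopes F isField card (- 1#) irreducible
  open GenericConfiguration F isField card (- 1#) irreducible using (residual)

  private
    -- The five points of the affine plane over 𝔽₃ off the ellipse Q = 0.
    p r : Fin 5 → Carrier
    p = lookup (- 1# ∷ - 1# ∷ - 1# ∷ 0# ∷ 1# ∷ [])
    r = lookup (- 1# ∷ 0# ∷ 1# ∷ - 1# ∷ - 1# ∷ [])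

    open Configuration p r 1# 0# 1# using (v; Q; configuration⇒theorem)

    0≉-1 : ¬ (0# ≈ - 1#)
    0≉-1 0≈-1 = 1≉0 (-x≈0⇒x≈0 (sym 0≈-1))

    -1≉0 : ¬ (- 1# ≈ 0#)
    -1≉0 = 0≉-1 ∘ sym

    distinct : ∀ i j → i ≢ j → ¬ (p i ≈ p j × r i ≈ r j)
    distinct = distinct-from-< (λ (p≈ , r≈) → sym p≈ , sym r≈) λ
      { fzero (fsuc fzero) _ (_ , eq) → -1≉0 eq
      ; fzero (fsuc (fsuc fzero)) _ (_ , eq) → 1≉-1 (sym eq)
      ; fzero (fsuc (fsuc (fsuc fzero))) _ (eq , _) → -1≉0 eq
      ; fzero (fsuc (fsuc (fsuc (fsuc fzero)))) _ (eq , _) → 1≉-1 (sym eq)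
      ; (fsuc fzero) (fsuc (fsuc fzero)) _ (_ , eq) → 0≉1 eq
      ; (fsuc fzero) (fsuc (fsuc (fsuc fzero))) _ (_ , eq) → 0≉-1 eq
      ; (fsuc fzero) (fsuc (fsuc (fsuc (fsuc fzero)))) _ (_ , eq) → 0≉-1 eq
      ; (fsuc (fsuc fzero)) (fsuc (fsuc (fsuc fzero))) _ (_ , eq) → 1≉-1 eq
      ; (fsuc (fsuc fzero)) (fsuc (fsuc (fsuc (fsuc fzero)))) _ (_ , eq) → 1≉-1 eq
      ; (fsuc (fsuc (fsuc fzero))) (fsuc (fsuc (fsuc (fsuc fzero)))) _ (eq , _) → 0≉1 eq
      ; _ fzero () _
      ; (fsuc _) (fsuc fzero) (ℕ.s≤s ()) _
      ; (fsuc (fsuc _)) (fsuc (fsuc fzero)) (ℕ.s≤s (ℕ.s≤s ())) _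
      ; (fsuc (fsuc (fsuc _))) (fsuc (fsuc (fsuc fzero))) (ℕ.s≤s (ℕ.s≤s (ℕ.s≤s ()))) _
      ; (fsuc (fsuc (fsuc (fsuc _)))) (fsuc (fsuc (fsuc (fsuc fzero)))) (ℕ.s≤s (ℕ.s≤s (ℕ.s≤s (ℕ.s≤s ())))) _
      }

    o i j : ∀ {n} → Polynomial n
    o = con (+ 0)
    i = con (+ 1)
    j = :- con (+ 1)

    quadric : ∀ {n} (p r : Polynomial n) → Polynomial n
    quadric p r = i :* (p :* p :- j :* (r :* i)) :+ o :* (p :* r :+ p :* i :- j :* (i :* i)) :+ i :* (r :* r :- p :* i :+ r :* i)

    -- The solver computes over the integers, so a value modulo 3 appears as 1 or -1 plus an
    -- explicit multiple of three. The argument `y` of `combine` below has the same purpose.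
    nonzero : ∀ {x} y → x ≈ 1# + (1# + 1# + 1#) * y ⊎ x ≈ - 1# + (1# + 1# + 1#) * y → ¬ (x ≈ 0#)
    nonzero {x} y x≈ x≈0 = [ (λ e → 1≉0 (reduce e)) , (λ e → -1≉0 (reduce e)) ]′ x≈
      where
      reduce : ∀ {z} → x ≈ z + (1# + 1# + 1#) * y → z ≈ 0#
      reduce {z} e = trans (sym (trans (+-congˡ (trans (*-congʳ 3≈0) (zeroˡ y))) (+-identityʳ z))) (trans (sym e) x≈0)

    Q≉0 : ∀ k → ¬ (Q k ≈ 0#)
    Q≉0 fzero                             = nonzero 0# (inj₁ (solve 0 (quadric j j := i :+ (i :+ i :+ i) :* o) refl))
    Q≉0 (fsuc fzero)                      = nonzero 1# (inj₂ (solve 0 (quadric j o := j :+ (i :+ i :+ i) :* i) refl))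
    Q≉0 (fsuc (fsuc fzero))               = nonzero (1# + 1#) (inj₂ (solve 0 (quadric j i := j :+ (i :+ i :+ i) :* (i :+ i)) refl))
    Q≉0 (fsuc (fsuc (fsuc fzero)))        = nonzero 0# (inj₂ (solve 0 (quadric o j := j :+ (i :+ i :+ i) :* o) refl))
    Q≉0 (fsuc (fsuc (fsuc (fsuc fzero)))) = nonzero 0# (inj₂ (solve 0 (quadric i j := j :+ (i :+ i :+ i) :* o) refl))

    module _ {b₁ bₘ b₂ g₀ g₁ g₂ : Carrier}
             (h : ∀ k → Q k * (p k * g₁ + r k * g₂ + g₀) ≈ b₁ * e₁ (v k) + bₘ * eₘ (v k) + b₂ * e₂ (v k)) where
      d : Fin 5 → Carrier
      d k = Q k * (p k * g₁ + r k * g₂ + g₀) - (b₁ * e₁ (v k) + bₘ * eₘ (v k) + b₂ * e₂ (v k))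

      combine : ∀ a₀ a₁ a₂ a₃ a₄ {x y} →
        x ≈ a₀ * d (# 0) + (a₁ * d (# 1) + (a₂ * d (# 2) + (a₃ * d (# 3) + a₄ * d (# 4)))) + (1# + 1# + 1#) * y → x ≈ 0#
      combine a₀ a₁ a₂ a₃ a₄ {x} {y} x≈ = trans x≈ (trans
        (+-cong (+-cong (*-congˡ (d≈0 (# 0))) (+-cong (*-congˡ (d≈0 (# 1))) (+-cong (*-congˡ (d≈0 (# 2)))
          (+-cong (*-congˡ (d≈0 (# 3))) (*-congˡ (d≈0 (# 4))))))) (*-congʳ 3≈0))
        (solve 6 (λ a b c d e y → a :* o :+ (b :* o :+ (c :* o :+ (d :* o :+ e :* o))) :+ o :* y := o) refl a₀ a₁ a₂ a₃ a₄ y))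
        where
        d≈0 : ∀ k → d k ≈ 0#
        d≈0 k = x≈y⇒x-y≈0 (h k)

      combination : ∀ {n} (a₀ a₁ a₂ a₃ a₄ g₀ g₁ g₂ b₁ bₘ b₂ y : Polynomial n) → Polynomial n
      combination a₀ a₁ a₂ a₃ a₄ g₀ g₁ g₂ b₁ bₘ b₂ y =
        a₀ :* D j j :+ (a₁ :* D j o :+ (a₂ :* D j i :+ (a₃ :* D o j :+ a₄ :* D i j))) :+ (i :+ i :+ i) :* y
        where
        D = residual j i o i g₀ g₁ g₂ b₁ bₘ b₂

      -- The coefficients below invert the linear system modulo 3.
      g₁≈0 : g₁ ≈ 0#
      g₁≈0 = combine 0# 1# 1# 0# 1# (solve 6 (λ g₀ g₁ g₂ b₁ bₘ b₂ → g₁ :=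
        combination o i i o i g₀ g₁ g₂ b₁ bₘ b₂ (:- g₀ :- g₀ :+ (g₁ :+ g₁ :+ g₁) :- g₂ :- g₂ :+ b₁ :+ b₂)) refl g₀ g₁ g₂ b₁ bₘ b₂)

      g₂≈0 : g₂ ≈ 0#
      g₂≈0 = combine 1# 1# (- 1#) (- 1#) (- 1#) (solve 6 (λ g₀ g₁ g₂ b₁ bₘ b₂ → g₂ :=
        combination i i j j j g₀ g₁ g₂ b₁ bₘ b₂ (:- g₁ :+ (g₂ :+ g₂ :+ g₂))) refl g₀ g₁ g₂ b₁ bₘ b₂)

      b₁≈ : b₁ ≈ g₀ * 1#
      b₁≈ = x-y≈0⇒x≈y (combine 0# 1# 0# (- 1#) 1# (solve 6 (λ g₀ g₁ g₂ b₁ bₘ b₂ → b₁ :- g₀ :* i :=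
        combination o i o j i g₀ g₁ g₂ b₁ bₘ b₂ (:- g₀ :+ g₁ :+ b₁)) refl g₀ g₁ g₂ b₁ bₘ b₂))

      bₘ≈ : bₘ ≈ g₀ * 0#
      bₘ≈ = trans (combine 1# (- 1#) (- 1#) 0# 0# (solve 6 (λ g₀ g₁ g₂ b₁ bₘ b₂ → bₘ :=
        combination i j j o o g₀ g₁ g₂ b₁ bₘ b₂ (g₀ :+ g₀ :- g₁ :- g₁ :+ g₂ :+ g₂ :- b₁ :+ bₘ :- b₂)) refl g₀ g₁ g₂ b₁ bₘ b₂)) (sym (zeroʳ g₀))

      b₂≈ : b₂ ≈ g₀ * 1#
      b₂≈ = x-y≈0⇒x≈y (combine 0# (- 1#) 1# 1# 0# (solve 6 (λ g₀ g₁ g₂ b₁ bₘ b₂ → b₂ :- g₀ :* i :=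
        combination o j i i o g₀ g₁ g₂ b₁ bₘ b₂ (:- g₀ :+ g₁ :- g₂ :- g₂ :+ b₂)) refl g₀ g₁ g₂ b₁ bₘ b₂))

  ternary-theorem : SevenPlanes F
  ternary-theorem = configuration⇒theorem Q≉0 distinct aniso
    (λ h → g₁≈0 h , g₂≈0 h , b₁≈ h , bₘ≈ h , b₂≈ h)

-- The field with two elements.

module BinaryConfiguration (F : CommutativeRing 0ℓ 0ℓ) (isField : IsField F) {q : ℕ} (card : HasCard F q)
    (binary : Binary F)
    (N : CommutativeRing.Carrier F) (irreducible : Irreducible F N) where
  open CommutativeRing F
  open IntegerSolver F
  open Lin F
  open FiniteField F isField card
  open CubicExtension F N
  open CubicField F isField card N irreducible
  open SevenSlopes F isField card N irreducible

  2≈0 : 1# + 1# ≈ 0#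
  2≈0 = trans (+-congˡ (proj₁ binary)) (-‿inverseʳ 1#)

  2ᴱ≈0 : 1ᴱ +ᴱ 1ᴱ ≈ᴱ 0ᴱ
  2ᴱ≈0 = 2≈0 , +-identityˡ 0# , +-identityˡ 0#

  private
    module E where
      open CommutativeRing cubicExtension public
      open Algebra.Properties.Group (CommutativeRing.+-group cubicExtension) public using (x∙y⁻¹≈ε⇒x≈y)
      open RingIdentities cubicExtension public
      open RingIdentities.CharacteristicTwo cubicExtension 2ᴱ≈0 public

    v : Fin 5 → E
    v = lookup (1ᴱ ∷ θ ∷ θ² ∷ ⟨ 1# , 1# , 0# ⟩ ∷ ⟨ 1# , 0# , 1# ⟩ ∷ [])

    v≉0 : ∀ i → ¬ (v i ≈ᴱ 0ᴱ)
    v≉0 fzero                             (e , _ , _) = 1≉0 e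
    v≉0 (fsuc fzero)                      (_ , e , _) = 1≉0 e
    v≉0 (fsuc (fsuc fzero))               (_ , _ , e) = 1≉0 e
    v≉0 (fsuc (fsuc (fsuc fzero)))        (e , _ , _) = 1≉0 e
    v≉0 (fsuc (fsuc (fsuc (fsuc fzero)))) (e , _ , _) = 1≉0 e

    v-distinct : ∀ i j → i ≢ j → ¬ (v i ≈ᴱ v j)
    v-distinct = distinct-from-< {P = λ i j → v i ≈ᴱ v j} E.sym λ
      { fzero (fsuc fzero) _ (e , _ , _) → 1≉0 e
      ; fzero (fsuc (fsuc fzero)) _ (e , _ , _) → 1≉0 e
      ; fzero (fsuc (fsuc (fsuc fzero))) _ (_ , e , _) → 0≉1 e
      ; fzero (fsuc (fsuc (fsuc (fsuc fzero)))) _ (_ , _ , e) → 0≉1 e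
      ; (fsuc fzero) (fsuc (fsuc fzero)) _ (_ , e , _) → 1≉0 e
      ; (fsuc fzero) (fsuc (fsuc (fsuc fzero))) _ (e , _ , _) → 0≉1 e
      ; (fsuc fzero) (fsuc (fsuc (fsuc (fsuc fzero)))) _ (e , _ , _) → 0≉1 e
      ; (fsuc (fsuc fzero)) (fsuc (fsuc (fsuc fzero))) _ (e , _ , _) → 0≉1 e
      ; (fsuc (fsuc fzero)) (fsuc (fsuc (fsuc (fsuc fzero)))) _ (e , _ , _) → 0≉1 e
      ; (fsuc (fsuc (fsuc fzero))) (fsuc (fsuc (fsuc (fsuc fzero)))) _ (_ , e , _) → 1≉0 e
      ; _ fzero () _
      ; (fsuc _) (fsuc fzero) (ℕ.s≤s ()) _
      ; (fsuc (fsuc _)) (fsuc (fsuc fzero)) (ℕ.s≤s (ℕ.s≤s ())) _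
      ; (fsuc (fsuc (fsuc _))) (fsuc (fsuc (fsuc fzero))) (ℕ.s≤s (ℕ.s≤s (ℕ.s≤s ()))) _
      ; (fsuc (fsuc (fsuc (fsuc _)))) (fsuc (fsuc (fsuc (fsuc fzero)))) (ℕ.s≤s (ℕ.s≤s (ℕ.s≤s (ℕ.s≤s ())))) _
      }

    open Slopes (λ _ → 1#) (λ _ → 1≉0) v v≉0
      (λ i j i≢j eq → v-distinct i j i≢j (E.sym (E.trans (E.sym (E.*-identityˡ (v j))) (E.trans eq (E.*-identityˡ (v i))))))

    module _ (y : Fin 7 → E) (y≉0 : ∀ a → ¬ (y a ≈ᴱ 0ᴱ))
             (dependent-conormals : ∀ a (b : Fin 3 → Fin 7) →
               Dependent (λ k → y (b k) *ᴱ τ (slopes (b k)) E.- y a *ᴱ τ (slopes a))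
                         (λ k → y (b k) *ᴱ σ (slopes (b k)) E.- y a *ᴱ σ (slopes a))) where
      T S : Fin 7 → E
      T a = y a *ᴱ τ (slopes a)
      S a = y a *ᴱ σ (slopes a)

      -- Equal vectors y (τ , σ) of two planes would, after cross multiplication and cancellation of
      -- the invertible y, give equal slopes.
      separated : ∀ {a b} → a ≢ b → ¬ (T a ≈ᴱ T b × S a ≈ᴱ S b)
      separated {a} {b} a≢b (T≈ , S≈) = cross≉0 a b a≢b
        (E.x∙y⁻¹≈ε⇒x≈y (σ (slopes a) *ᴱ τ (slopes b)) (τ (slopes a) *ᴱ σ (slopes b))
          (unit-cancel {y b} {D} (unit (y b) (y≉0 b)) (unit-cancel {y a} {y b *ᴱ D} (unit (y a) (y≉0 a))
            (E.cross-multiply {y a} {σ (slopes a)} {τ (slopes a)} {y b} {σ (slopes b)} {τ (slopes b)} T≈ S≈))))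
        where
        D : E
        D = σ (slopes a) *ᴱ τ (slopes b) E.- τ (slopes a) *ᴱ σ (slopes b)

      -- Four points of an affine plane over 𝔽₂ are affinely dependent only if they sum to zero.
      fourth : ∀ {a b c d} → a ≢ b → a ≢ c → a ≢ d → b ≢ c → b ≢ d → c ≢ d →
               T d ≈ᴱ T a +ᴱ T b +ᴱ T c × S d ≈ᴱ S a +ᴱ S b +ᴱ S c
      fourth {a} {b} {c} {d} a≢b a≢c a≢d b≢c b≢d c≢d = conclude (dependent-conormals a triad)
        where
        triad : Fin 3 → Fin 7
        triad = lookup (b ∷ c ∷ d ∷ [])

        ↑ : ∀ {x y} → x ≈ y → scalar x ≈ᴱ scalar y
        ↑ x≈y = x≈y , refl , refl

        conclude : Dependent (λ k → T (triad k) E.- T a) (λ k → S (triad k) E.- S a) →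
                   T d ≈ᴱ T a +ᴱ T b +ᴱ T c × S d ≈ᴱ S a +ᴱ S b +ᴱ S c
        conclude (γ , nontrivial , eqT , eqS) = cases (proj₂ binary (γ (# 0))) (proj₂ binary (γ (# 1))) (proj₂ binary (γ (# 2)))
          where
          module RT = E.AffineRelation (scalar (γ (# 0))) (scalar (γ (# 1))) (scalar (γ (# 2))) (T a) (T b) (T c) (T d) eqT
          module RS = E.AffineRelation (scalar (γ (# 0))) (scalar (γ (# 1))) (scalar (γ (# 2))) (S a) (S b) (S c) (S d) eqS

          cases : γ (# 0) ≈ 0# ⊎ γ (# 0) ≈ 1# → γ (# 1) ≈ 0# ⊎ γ (# 1) ≈ 1# → γ (# 2) ≈ 0# ⊎ γ (# 2) ≈ 1# →
                  T d ≈ᴱ T a +ᴱ T b +ᴱ T c × S d ≈ᴱ S a +ᴱ S b +ᴱ S c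
          cases (inj₁ p) (inj₁ q) (inj₁ r) =
            contradiction (λ { fzero → p ; (fsuc fzero) → q ; (fsuc (fsuc fzero)) → r }) nontrivial
          cases (inj₂ p) (inj₁ q) (inj₁ r) =
            contradiction (RT.relation-100 (↑ p) (↑ q) (↑ r) , RS.relation-100 (↑ p) (↑ q) (↑ r)) (separated a≢b)
          cases (inj₁ p) (inj₂ q) (inj₁ r) =
            contradiction (RT.relation-010 (↑ p) (↑ q) (↑ r) , RS.relation-010 (↑ p) (↑ q) (↑ r)) (separated a≢c)
          cases (inj₁ p) (inj₁ q) (inj₂ r) =
            contradiction (RT.relation-001 (↑ p) (↑ q) (↑ r) , RS.relation-001 (↑ p) (↑ q) (↑ r)) (separated a≢d)
          cases (inj₂ p) (inj₂ q) (inj₁ r) =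
            contradiction (RT.relation-110 (↑ p) (↑ q) (↑ r) , RS.relation-110 (↑ p) (↑ q) (↑ r)) (separated b≢c)
          cases (inj₂ p) (inj₁ q) (inj₂ r) =
            contradiction (RT.relation-101 (↑ p) (↑ q) (↑ r) , RS.relation-101 (↑ p) (↑ q) (↑ r)) (separated b≢d)
          cases (inj₁ p) (inj₂ q) (inj₂ r) =
            contradiction (RT.relation-011 (↑ p) (↑ q) (↑ r) , RS.relation-011 (↑ p) (↑ q) (↑ r)) (separated c≢d)
          cases (inj₂ p) (inj₂ q) (inj₂ r) = RT.relation-111 (↑ p) (↑ q) (↑ r) , RS.relation-111 (↑ p) (↑ q) (↑ r)

      -- The sum condition determines a fourth vector from three others, so the planes 3 and 4 would
      -- both carry the vector determined by the planes 0, 1 and 2.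
      collision : T (# 3) ≈ᴱ T (# 4) × S (# 3) ≈ᴱ S (# 4)
      collision = E.trans (proj₁ third) (E.sym (proj₁ fourth′)) , E.trans (proj₂ third) (E.sym (proj₂ fourth′))
        where
        third   = fourth {# 0} {# 1} {# 2} {# 3} (λ ()) (λ ()) (λ ()) (λ ()) (λ ()) (λ ())
        fourth′ = fourth {# 0} {# 1} {# 2} {# 4} (λ ()) (λ ()) (λ ()) (λ ()) (λ ()) (λ ())

  binary-theorem : SevenPlanes F
  binary-theorem = ¬transversal⇒theorem λ (y , y≉0 , dependent-conormals) →
    separated y y≉0 dependent-conormals {# 3} {# 4} (λ ()) (collision y y≉0 dependent-conormals)

-- The case distinction on the field.

module Cases (F : CommutativeRing 0ℓ 0ℓ) (isField : IsField F) {q : ℕ} (card : HasCard F q) where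
  open CommutativeRing F
  open IntegerSolver F
  open Lin F
  open FiniteField F isField card
  open Parameters F isField card

  large : ∀ {ρ} → ¬ (ρ ≈ 0#) → ¬ (ρ * ρ ≈ 1#) → SevenPlanes F
  large ρ≉0 ρ²≉1 = assemble irreducible-cubic (anisotropic-form ρ≉0 ρ²≉1)
    where
    assemble : ∃ (Irreducible F) → ∃[ m ] (¬ (m ≈ 0#) × ¬ (1# - m ≈ 0#) × Anisotropic 1# m m) → SevenPlanes F
    assemble (N , irreducible) (m , m≉0 , 1-m≉0 , aniso) =
      GenericConfiguration.generic-theorem F isField card N irreducible m≉0 1-m≉0 aniso
        (proj₂ (proj₂ (abscissae irreducible m≉0 1-m≉0 ρ≉0 ρ²≉1)))

  small : (∀ x → x ≈ 0# ⊎ x ≈ 1# ⊎ x ≈ - 1#) → SevenPlanes F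
  small trichotomy with 1# ≟ - 1#
  ... | no  1≉-1 = TernaryConfiguration.ternary-theorem F isField card (1≉-1 , trichotomy)
  ... | yes 1≈-1 = BinaryConfiguration.binary-theorem F isField card (1≈-1 , dichotomy)
      (proj₁ irreducible-cubic) (proj₂ irreducible-cubic)
    where
    dichotomy : ∀ x → x ≈ 0# ⊎ x ≈ 1#
    dichotomy x = [ inj₁ , [ inj₂ , (λ x≈-1 → inj₂ (trans x≈-1 (sym 1≈-1))) ]′ ]′ (trichotomy x)

  square≈1 : ∀ {x} → x * x ≈ 1# → x ≈ 1# ⊎ x ≈ - 1#
  square≈1 {x} x²≈1 with x - 1# ≟ 0#
  ... | yes x-1≈0 = inj₁ (x-y≈0⇒x≈y x-1≈0)
  ... | no  x-1≉0 = inj₂ (x-y≈0⇒x≈y (x≉0∧x*y≈0⇒y≈0 x-1≉0 (trans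
      (solve 1 (λ x → (x :- con (+ 1)) :* (x :- :- con (+ 1)) := x :* x :- con (+ 1)) refl x) (x≈y⇒x-y≈0 x²≈1))))

  -- The search for ρ is decidable because the field is enumerated. If it fails, every nonzero
  -- element has square 1 and is therefore 1 or -1.
  seven-planes : SevenPlanes F
  seven-planes = decide (any? {λ ρ → ¬ (ρ ≈ 0#) × ¬ (ρ * ρ ≈ 1#)}
      (λ x≈y (x≉0 , x²≉1) → (λ y≈0 → x≉0 (trans x≈y y≈0)) , (λ y²≈1 → x²≉1 (trans (*-cong x≈y x≈y) y²≈1)))
      (λ ρ → ¬? (ρ ≟ 0#) ×-dec ¬? (ρ * ρ ≟ 1#)))
    where
    decide : Dec (∃[ ρ ] (¬ (ρ ≈ 0#) × ¬ (ρ * ρ ≈ 1#))) → SevenPlanes F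
    decide (yes (ρ , ρ≉0 , ρ²≉1)) = large ρ≉0 ρ²≉1
    decide (no ¬ρ) = small classify
      where
      classify : ∀ x → x ≈ 0# ⊎ x ≈ 1# ⊎ x ≈ - 1#
      classify x with x ≟ 0#
      ... | yes x≈0 = inj₁ x≈0
      ... | no  x≉0 = inj₂ (square≈1 (stable (λ x²≉1 → ¬ρ (x , x≉0 , x²≉1))))

theorem5p6 : (q : ℕ) → IsPrimePower q →
    (F : CommutativeRing 0ℓ 0ℓ) → IsField F → HasCard F q →
    let open Lin F in
    ∃[ K ] ((∀ (a : Fin 7) → LinIndep {6} {3} (K a)) ×
    (∀ (a b : Fin 7) → a ≢ b → ¬ SameSpan (K a) (K b)) ×
    HigglePiggle 5 2 {7} K)
theorem5p6 q _ F isField card = Cases.seven-planes F isField card
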